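{- There is an algorithm that, given an instance of the Gas-Capacitated Vehicle Routing Problem (GasCVRP) and $r\in\mathbb N$, decides whether there exists a routing of weight at most $r$ in $f(r)\cdot n^{O(1)}$ steps, for some computable function $f$, where $n=|V(G)|$ is the number of vertices of the input graph.
   Context: All graphs are finite and undirected, and $\mathbb N = \{0,1,2,\dots\}$. A walk in $G$ is a sequence of vertices $(v_1,\dots,v_m)$ with consecutive vertices adjacent; vertices and edges may be repeated. It is closed if $v_1 = v_m$. The weight of a walk is $w(p)=\sum_{i=1}^{m-1} w(v_i,v_{i+1})$. GasCVRP: An instance contains a graph $G$ with edge weights $w\colon E(G)\to\mathbb N$ (weight zero is allowed), a nonempty set of depots $D\subseteq V(G)$, a set of clients $C\subseteq V(G)$, a number of vehicles $k\in\mathbb N$, and a gas capacity $g\in\mathbb N$. A routing is a set of $k'$ walks $R=\{p_1,\dots,p_{k'}\}$ (one walk per vehicle) together with an assignment $A\colon C\to[k']$ such that $k'\le k$, every walk starts at a vertex of $D$, every client $c\in C$ is a vertex of $p_{A(c)}$, every walk in $R$ is closed, and $w(p)\le g$ for every $p\in R$. Its weight is $w(R)=\sum_{p\in R}w(p)$. -}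

module Defs where

open import Algebra.Properties.CommutativeMonoid.Sum using (sum)
open import Data.Bool using (if_then_else_)
open import Data.Fin using (Fin)
open import Data.Fin.Subset using (Subset; _∈_; Nonempty)
open import Data.List using (List; []; _∷_)
import Data.List.Membership.Propositional as List
open import Data.Maybe using (Maybe; just; maybe′)
open import Data.Nat using (ℕ; zero; suc; _+_; _∸_; _≤_; _≟_)
open import Data.Nat.Properties using (+-0-commutativeMonoid)
open import Data.Product using (_×_; _,_; ∃-syntax)
open import Data.Sum using (_⊎_)
open import Data.Vec using (Vec; []; _∷_)
import Data.Vec as Vec
open import Relation.Binary.Construct.Closure.ReflexiveTransitive
  using (Star; ε; _◅_)
open import Relation.Binary.PropositionalEquality using (_≡_; _≢_)
open import Relation.Nullary using (¬_; does)

------------------------------------------------------------------------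
-- Gas-capacitated vehicle routing

-- `edge u v` is `just x` when uv is an edge of weight x, and `nothing`
-- when u and v are not adjacent.  Loops are allowed but not required.
record Graph (n : ℕ) : Set where
  field
    edge     : Fin n → Fin n → Maybe ℕ
    edge-sym : ∀ u v → edge u v ≡ edge v u

  Adj : Fin n → Fin n → Set
  Adj u v = ∃[ x ] edge u v ≡ just x

  -- A walk (v₁, …, vₘ), m ≥ 1, indexed by v₁ and vₘ; `ε` is the
  -- one-vertex walk.  A closed walk is an element of `Walk v v`.
  Walk : Fin n → Fin n → Set
  Walk = Star Adj

  vertices : ∀ {u v} → Walk u v → List (Fin n)
  vertices {u} ε       = u ∷ []
  vertices {u} (_ ◅ p) = u ∷ vertices p

  weight : ∀ {u v} → Walk u v → ℕ
  weight ε             = 0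
  weight ((x , _) ◅ p) = x + weight p

record GasCVRP : Set where
  field
    n        : ℕ
    graph    : Graph n
    depots   : Subset n
    depot    : Nonempty depots
    clients  : Subset n
    vehicles : ℕ
    gas      : ℕ

  open Graph graph public

record Routing (I : GasCVRP) : Set where
  open GasCVRP I
  field
    k′          : ℕ
    k′≤vehicles : k′ ≤ vehicles
    start       : Fin k′ → Fin n
    start∈D     : ∀ j → start j ∈ depots
    walk        : ∀ j → Walk (start j) (start j)
    assign      : ∀ c → c ∈ clients → Fin k′
    visited     : ∀ c (c∈C : c ∈ clients) →
                  c List.∈ vertices (walk (assign c c∈C))
    within-gas  : ∀ j → weight (walk j) ≤ gas

  totalWeight : ℕ
  totalWeight = sum +-0-commutativeMonoid λ j → weight (walk j)

------------------------------------------------------------------------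
-- Unit-cost random access machines

-- A structured RAM.  Registers and arrays are named by numerals fixed in
-- the program, so that each program uses finitely many of them; cells of
-- an array are addressed by register contents.  Several arrays amount to
-- one memory with interleaved addresses.  All cells hold natural numbers.
-- The only arithmetic is addition and truncated subtraction: unit-cost
-- multiplication would make the model unreasonably powerful.

infix  20 _≔#_ _≔_ _≔_⊕_ _≔_⊖_ _≔_[_] _[_]≔_
infixr 10 _⨾_

data Program : Set where
  skip        : Program
  _≔#_        : (x c : ℕ) → Program
  _≔_         : (x y : ℕ) → Program
  _≔_⊕_ _≔_⊖_ : (x y z : ℕ) → Program
  _≔_[_]      : (x a y : ℕ) → Program
  _[_]≔_      : (a x y : ℕ) → Program
  _⨾_         : (P Q : Program) → Program
  ifnz        : (x : ℕ) (P Q : Program) → Program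
  whilenz     : (x : ℕ) (P : Program) → Program

record State : Set where
  constructor ⟪_,_⟫
  field
    reg : ℕ → ℕ
    arr : ℕ → ℕ → ℕ

open State public

_[_↦_] : {A : Set} → (ℕ → A) → ℕ → A → ℕ → A
(f [ x ↦ v ]) y = if does (y ≟ x) then v else f y

setReg : ℕ → ℕ → State → State
setReg x v ⟪ ρ , μ ⟫ = ⟪ ρ [ x ↦ v ] , μ ⟫

setArr : ℕ → ℕ → ℕ → State → State
setArr a i v ⟪ ρ , μ ⟫ = ⟪ ρ , μ [ a ↦ μ a [ i ↦ v ] ] ⟫

-- ⟨ P , s ⟩⇓[ t ] s′ : started in s, P halts in s′ after exactly t steps,
-- where each elementary instruction and each test counts as one step.
data ⟨_,_⟩⇓[_]_ : Program → State → ℕ → State → Set where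
  skip   : ∀ {s} → ⟨ skip , s ⟩⇓[ 1 ] s
  const  : ∀ {s x c} → ⟨ x ≔# c , s ⟩⇓[ 1 ] setReg x c s
  copy   : ∀ {s x y} → ⟨ x ≔ y , s ⟩⇓[ 1 ] setReg x (reg s y) s
  add    : ∀ {s x y z} →
           ⟨ x ≔ y ⊕ z , s ⟩⇓[ 1 ] setReg x (reg s y + reg s z) s
  sub    : ∀ {s x y z} →
           ⟨ x ≔ y ⊖ z , s ⟩⇓[ 1 ] setReg x (reg s y ∸ reg s z) s
  load   : ∀ {s x a y} →
           ⟨ x ≔ a [ y ] , s ⟩⇓[ 1 ] setReg x (arr s a (reg s y)) s
  store  : ∀ {s a x y} →
           ⟨ a [ x ]≔ y , s ⟩⇓[ 1 ] setArr a (reg s x) (reg s y) s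
  seq    : ∀ {s s′ s″ P Q t t′} →
           ⟨ P , s ⟩⇓[ t ] s′ → ⟨ Q , s′ ⟩⇓[ t′ ] s″ →
           ⟨ P ⨾ Q , s ⟩⇓[ t + t′ ] s″
  if-yes : ∀ {s s′ x P Q t} → reg s x ≢ 0 →
           ⟨ P , s ⟩⇓[ t ] s′ → ⟨ ifnz x P Q , s ⟩⇓[ suc t ] s′
  if-no  : ∀ {s s′ x P Q t} → reg s x ≡ 0 →
           ⟨ Q , s ⟩⇓[ t ] s′ → ⟨ ifnz x P Q , s ⟩⇓[ suc t ] s′
  loop   : ∀ {s s′ s″ x P t t′} → reg s x ≢ 0 →
           ⟨ P , s ⟩⇓[ t ] s′ → ⟨ whilenz x P , s′ ⟩⇓[ t′ ] s″ →
           ⟨ whilenz x P , s ⟩⇓[ suc (t + t′) ] s″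
  exit   : ∀ {s x P} → reg s x ≡ 0 → ⟨ whilenz x P , s ⟩⇓[ 1 ] s

output : State → ℕ
output s = reg s 0

zeros : ℕ → ℕ
zeros _ = 0

-- The given numbers from address 0 on, followed by zeros.
cells : ∀ {m} → Vec ℕ m → ℕ → ℕ
cells []       _       = 0
cells (x ∷ _)  zero    = x
cells (_ ∷ xs) (suc i) = cells xs i

Computable : (ℕ → ℕ) → Set
Computable f = ∃[ P ] ∀ m → ∃[ t ] ∃[ s ]
  ⟨ P , ⟪ cells (m ∷ []) , (λ _ → zeros) ⟫ ⟩⇓[ t ] s × output s ≡ f m

------------------------------------------------------------------------
-- Instances as machine inputs

-- Registers 0–3 hold n, the number of vehicles, the gas capacity and r.
-- Array 0 is the n × n edge matrix in row-major order, with 0 for a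
-- non-edge and x + 1 for an edge of weight x; arrays 1 and 2 are the
-- characteristic vectors of the depots and the clients.
encode : GasCVRP → ℕ → State
encode I r = ⟪ cells (n ∷ vehicles ∷ gas ∷ r ∷ []) , arrays ⟫
  where
  open GasCVRP I

  matrix : Vec (Vec ℕ n) n
  matrix = Vec.tabulate λ u → Vec.tabulate λ v → maybe′ suc 0 (edge u v)

  bits : Subset n → Vec ℕ n
  bits = Vec.map λ b → if b then 1 else 0

  arrays : ℕ → ℕ → ℕ
  arrays 0 = cells (Vec.concat matrix)
  arrays 1 = cells (bits depots)
  arrays 2 = cells (bits clients)
  arrays _ = zeros

Answers : State → Set → Set
Answers s Q = (output s ≡ 1 × Q) ⊎ (output s ≡ 0 × ¬ Q)

{-# OPTIONS --safe #-}
-- Vertices at distance 0 are served together, so only one representative client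
-- per class matters.  A closed walk of weight w > 0 meets at most w classes, one
-- of weight 0 only the class of its depot.  Hence a routing of weight at most r
-- is determined by at most r distinct stops on the walks of positive weight: they
-- include every representative that has no depot at distance 0, and there are
-- enough vehicles left to serve each of the others by a walk of weight 0.
--
-- The stops are found by colour coding.  If the i-th stop has colour i, and it is
-- known after which stops a tour is closed, then a dynamic program over the
-- distances finds the cheapest tours, and the colours keep the stops distinct.
-- Since r distinct numbers below 2^l already differ in their digits at r suitable
-- binary places, a colouring is given by r places and a relabelling of the 2^r
-- digit strings.  With 2^l about n this leaves (l + r + 2)^(2^r) choices for each,
-- and x^k ≤ k^k · 2^x bounds this number by f(r) · n.
module Submission where

-- Edge weights, gas capacity and number of vehicles are not bounded in terms of `n` and `r`, so
-- none of them may bound a loop. They are only added, subtracted and compared, and `suc r` serves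
-- as infinity. The program never constructs the walks of weight 0: it only counts them, one vehicle
-- for each representative that is not a stop. Once the colours fix the order of the stops and the
-- marks fix where tours end, the tours no longer interact: each can be made as cheap as possible on
-- its own, and the dynamic program keeps no sets of visited vertices. The program tries every
-- `q ≤ r` and three numbers below `Z = b ^ L`. Their digits in base `b = l + r + 2` are the binary
-- places, the colours of the hash values and the marks. The base exceeds every place (at most `l`),
-- colour (at most `r`) and mark (at most 1), and `L = 2 ^ r` digits are enough for all hash values.

open import Defs
open import Algebra.Properties.CommutativeMonoid.Sum using (sum)
open import Data.Bool using (true; false; T; not; if_then_else_)
open import Data.Empty using (⊥-elim)
open import Data.Fin as Fin using (Fin; zero; suc; toℕ; fromℕ<; #_)
open import Data.Fin.Properties as Finₚ using (toℕ<n; toℕ-injective; toℕ-fromℕ<; any?; all?)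
open import Data.Fin.Subset using (Subset; _∈_)
open import Data.Fin.Subset.Properties using (_∈?_)
open import Data.List using (List; []; _∷_; _++_; length; map; concat; filter; allFin; deduplicate; tabulate)
import Data.List as Listᵇ
open import Data.List.Properties using (length-++; length-map; map-++; concat-++; ++-identityʳ; length-tabulate; map-tabulate)
open import Data.List.Membership.Propositional using (find) renaming (_∈_ to _∈ˡ_)
open import Data.List.Membership.Propositional.Properties
  using (∈-∃++; ∈-++⁻; ∈-++⁺ˡ; ∈-++⁺ʳ; ∈-filter⁺; ∈-filter⁻; ∈-allFin; ∈-deduplicate⁺; ∈-deduplicate⁻; ∈-map⁺)
open import Data.List.Relation.Binary.Sublist.Propositional using (_⊆_; []; _∷ʳ_; _∷_; ⊆-trans)
open import Data.List.Relation.Binary.Sublist.Propositional.Properties using (filter-⊆)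
open import Data.List.Relation.Unary.All as All using (All; []; _∷_)
import Data.List.Relation.Unary.All.Properties as Allₚ
open import Data.List.Relation.Unary.Any as Any using (Any; here; there)
import Data.List.Relation.Unary.Any.Properties as Anyₚ
open import Data.List.Relation.Unary.AllPairs using ([]; _∷_)
open import Data.List.Relation.Unary.Unique.Propositional using (Unique)
import Data.List.Relation.Unary.Unique.Propositional.Properties as Uniqueₚ
import Data.List.Relation.Unary.Unique.DecPropositional.Properties as DecUniqueₚ
open import Data.Maybe using (Maybe; just; nothing; maybe′)
open import Data.Maybe.Properties using (just-injective) renaming (≡-dec to maybe-≡-dec)
open import Data.Nat
open import Data.Nat.DivMod
open import Data.Nat.Tactic.RingSolver using (solve-∀)
open import Data.Nat.Induction using (<-rec)
open import Data.Nat.Properties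
open import Data.Nat.ListAction renaming (sum to total)
open import Data.Nat.ListAction.Properties using () renaming (sum-++ to total-++)
open import Data.Product using (_×_; _,_; ∃-syntax; Σ-syntax; proj₁; proj₂)
open import Data.Sum using (_⊎_; inj₁; inj₂; [_,_]′)
open import Data.Unit using (⊤)
open import Data.Vec as Vec using (Vec; []; _∷_)
import Data.Vec.Properties as Vecₚ
open import Relation.Binary.Construct.Closure.ReflexiveTransitive using (ε; _◅_; _◅◅_)
open import Relation.Binary.Definitions using (tri<; tri≈; tri>)
open import Relation.Binary.PropositionalEquality hiding ([_])
open import Relation.Nullary using (¬_; yes; no; Dec)
open import Relation.Nullary.Decidable using (_×-dec_; _→-dec_; ¬?)
open import Function using (_∘_; id; case_of_)

-- A total language compiled to the machine

infixl 9 _⊞_ _⊟_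
infixr 5 _▸_

Env : ℕ → Set
Env k = Fin k → ℕ

_▸_ : ∀ {k} → ℕ → Env k → Env (suc k)
(x ▸ γ) zero    = x
(x ▸ γ) (suc i) = γ i

none : Fin 0 → ℕ
none ()

iter : {A : Set} → ℕ → A → (ℕ → A → A) → A
iter zero    a f = a
iter (suc m) a f = f m (iter m a f)

branch : {A : Set} → ℕ → A → A → A
branch (suc _) a b = a
branch zero    a b = b

-- `glob x` reads register x, and register 4 + x holds the number of
-- iterations of `rec x e₀ e`.  Since an expression cannot write these
-- registers, the cost of evaluation does not depend on the local variables.
data Exp (k : ℕ) : Set where
  lit     : ℕ → Exp k
  var     : Fin k → Exp k
  glob    : Fin 20 → Exp k
  _⊞_ _⊟_ : Exp k → Exp k → Exp k
  get     : ℕ → Exp k → Exp k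
  ifn     : Exp k → Exp k → Exp k → Exp k
  rec     : Fin 16 → Exp k → Exp (2 + k) → Exp k
  ren     : ∀ {m} → (Fin m → Fin k) → Exp m → Exp k

-- Commands write to arrays only. The registers that bound loops stay fixed, so a cost can be
-- computed from the initial registers.
data Cmd (k : ℕ) : Set where
  put     : ℕ → Exp k → Exp k → Cmd k
  _▷_     : Cmd k → Cmd k → Cmd k
  iterate : Fin 16 → Cmd (suc k) → Cmd k

infixr 4 _▷_

Regs Mem : Set
Regs = ℕ → ℕ
Mem  = ℕ → ℕ → ℕ

bound : Regs → Fin 16 → ℕ
bound ρ x = ρ (4 + toℕ x)

⟦_⟧ : ∀ {k} → Exp k → Regs → Mem → Env k → ℕ
⟦ lit c ⟧     ρ μ γ = c
⟦ var i ⟧     ρ μ γ = γ i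
⟦ glob x ⟧    ρ μ γ = ρ (toℕ x)
⟦ e ⊞ e′ ⟧    ρ μ γ = ⟦ e ⟧ ρ μ γ + ⟦ e′ ⟧ ρ μ γ
⟦ e ⊟ e′ ⟧    ρ μ γ = ⟦ e ⟧ ρ μ γ ∸ ⟦ e′ ⟧ ρ μ γ
⟦ get a e ⟧   ρ μ γ = μ a (⟦ e ⟧ ρ μ γ)
⟦ ifn c e e′ ⟧ ρ μ γ = branch (⟦ c ⟧ ρ μ γ) (⟦ e ⟧ ρ μ γ) (⟦ e′ ⟧ ρ μ γ)
⟦ rec x e₀ e ⟧ ρ μ γ =
  iter (bound ρ x) (⟦ e₀ ⟧ ρ μ γ) λ i acc → ⟦ e ⟧ ρ μ (acc ▸ i ▸ γ)
⟦ ren σ e ⟧   ρ μ γ = ⟦ e ⟧ ρ μ (γ ∘ σ)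

⟦_⟧ᶜ : ∀ {k} → Cmd k → Regs → Env k → Mem → Mem
⟦ put a e e′ ⟧ᶜ  ρ γ μ = μ [ a ↦ μ a [ ⟦ e ⟧ ρ μ γ ↦ ⟦ e′ ⟧ ρ μ γ ] ]
⟦ c ▷ c′ ⟧ᶜ      ρ γ μ = ⟦ c′ ⟧ᶜ ρ γ (⟦ c ⟧ᶜ ρ γ μ)
⟦ iterate x c ⟧ᶜ ρ γ μ = iter (bound ρ x) μ λ i → ⟦ c ⟧ᶜ ρ (i ▸ γ)

-- A conditional is charged for both branches: the result is an upper bound that does not depend on
-- the branch taken.
cost : ∀ {k} → Exp k → Regs → ℕ
cost (lit c)      ρ = 1
cost (var i)      ρ = 1
cost (glob x)     ρ = 1
cost (e ⊞ e′)     ρ = cost e ρ + (cost e′ ρ + 1)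
cost (e ⊟ e′)     ρ = cost e ρ + (cost e′ ρ + 1)
cost (get a e)    ρ = cost e ρ + 1
cost (ifn c e e′) ρ = cost c ρ + suc (cost e ρ + cost e′ ρ)
-- Two initialisations and the final test; each round adds its own test and the four instructions
-- after the body.
cost (rec x e₀ e) ρ = cost e₀ ρ + (1 + (1 + suc (bound ρ x * suc (cost e ρ + 4))))
cost (ren σ e)    ρ = cost e ρ

costᶜ : ∀ {k} → Cmd k → Regs → ℕ
costᶜ (put a e e′)  ρ = cost e ρ + (cost e′ ρ + 1)
costᶜ (c ▷ c′)      ρ = costᶜ c ρ + costᶜ c′ ρ
costᶜ (iterate x c) ρ = 1 + (1 + suc (bound ρ x * suc (costᶜ c ρ + 3)))

-- `compile θ d e` leaves the value of e in register d and changes no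
-- register below d; θ tells where the variables are.
compile : ∀ {k} → (Fin k → ℕ) → ℕ → Exp k → Program
compile θ d (lit c)      = d ≔# c
compile θ d (var i)      = d ≔ θ i
compile θ d (glob x)     = d ≔ toℕ x
compile θ d (e ⊞ e′)     = compile θ d e ⨾ compile θ (suc d) e′ ⨾ d ≔ d ⊕ suc d
compile θ d (e ⊟ e′)     = compile θ d e ⨾ compile θ (suc d) e′ ⨾ d ≔ d ⊖ suc d
compile θ d (get a e)    = compile θ d e ⨾ d ≔ a [ d ]
compile θ d (ifn c e e′) = compile θ d c ⨾ ifnz d (compile θ d e) (compile θ d e′)
-- Register `d` is the accumulator, `1 + d` the index and `2 + d` the number of rounds left. The
-- body is evaluated in `3 + d`, which afterwards holds the constant 1 for the counters.
compile θ d (rec x e₀ e) =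
  compile θ d e₀ ⨾ (1 + d) ≔# 0 ⨾ ((2 + d) ≔ (4 + toℕ x)) ⨾
  whilenz (2 + d)
    (compile (d ▸ 1 + d ▸ θ) (3 + d) e ⨾
     (d ≔ (3 + d)) ⨾ (3 + d) ≔# 1 ⨾
     (1 + d) ≔ (1 + d) ⊕ (3 + d) ⨾ (2 + d) ≔ (2 + d) ⊖ (3 + d))
compile θ d (ren σ e)    = compile (θ ∘ σ) d e

compileᶜ : ∀ {k} → (Fin k → ℕ) → ℕ → Cmd k → Program
compileᶜ θ d (put a e e′) =
  compile θ d e ⨾ compile θ (suc d) e′ ⨾ a [ d ]≔ suc d
compileᶜ θ d (c ▷ c′) = compileᶜ θ d c ⨾ compileᶜ θ d c′
compileᶜ θ d (iterate x c) =
  d ≔# 0 ⨾ ((1 + d) ≔ (4 + toℕ x)) ⨾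
  whilenz (1 + d)
    (compileᶜ (d ▸ θ) (2 + d) c ⨾ (2 + d) ≔# 1 ⨾
     d ≔ d ⊕ (2 + d) ⨾ (1 + d) ≔ (1 + d) ⊖ (2 + d))

-- Executions within a step budget and the correctness of compilation

update-same : ∀ {A : Set} (f : ℕ → A) x v → (f [ x ↦ v ]) x ≡ v
update-same f x v with x ≡ᵇ x | ≡⇒≡ᵇ x x refl
... | true | _ = refl

update-other : ∀ {A : Set} (f : ℕ → A) {x y} v → y ≢ x → (f [ x ↦ v ]) y ≡ f y
update-other f {x} {y} v y≢x with y ≡ᵇ x | ≡ᵇ⇒≡ y x
... | true  | y≡x = ⊥-elim (y≢x (y≡x _))
... | false | _   = refl

Runs : State → Program → ℕ → (State → Set) → Set
Runs s P c Q = ∃[ t ] ∃[ s′ ] ⟨ P , s ⟩⇓[ t ] s′ × t ≤ c × Q s′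

runs-seq : ∀ {s P P′ c c′ Q Q′} → Runs s P c Q →
           (∀ {s′} → Q s′ → Runs s′ P′ c′ Q′) → Runs s (P ⨾ P′) (c + c′) Q′
runs-seq (t , s′ , ex , t≤c , q) k =
  let t′ , s″ , ex′ , t′≤c′ , q′ = k q
  in t + t′ , s″ , seq ex ex′ , +-mono-≤ t≤c t′≤c′ , q′

runs-weaken : ∀ {s P c c′ Q Q′} → c ≤ c′ → (∀ {s′} → Q s′ → Q′ s′) →
              Runs s P c Q → Runs s P c′ Q′
runs-weaken c≤c′ f (t , s′ , ex , t≤c , q) = t , s′ , ex , ≤-trans t≤c c≤c′ , f q

runs-const : ∀ {s x c} (Q : State → Set) → Q (setReg x c s) → Runs s (x ≔# c) 1 Q
runs-const Q q = 1 , _ , const , ≤-refl , q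

runs-copy : ∀ {s x y} (Q : State → Set) → Q (setReg x (reg s y) s) → Runs s (x ≔ y) 1 Q
runs-copy Q q = 1 , _ , copy , ≤-refl , q

runs-add : ∀ {s x y z} (Q : State → Set) →
           Q (setReg x (reg s y + reg s z) s) → Runs s (x ≔ y ⊕ z) 1 Q
runs-add Q q = 1 , _ , add , ≤-refl , q

runs-sub : ∀ {s x y z} (Q : State → Set) →
           Q (setReg x (reg s y ∸ reg s z) s) → Runs s (x ≔ y ⊖ z) 1 Q
runs-sub Q q = 1 , _ , sub , ≤-refl , q

-- The invariant is indexed by the content of the tested register, which a round lowers by one; the
-- index is thus also the termination measure.
runs-while : ∀ {x P c} (I : ℕ → State → Set) →
             (∀ {m s} → I m s → reg s x ≡ m) →
             (∀ {m s} → I (suc m) s → Runs s P c (I m)) →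
             ∀ m {s} → I m s → Runs s (whilenz x P) (suc (m * suc c)) (I 0)
runs-while I x≡m body zero inv = 1 , _ , exit (x≡m inv) , s≤s z≤n , inv
runs-while {c = c} I x≡m body (suc m) inv =
  let t  , s′ , ex  , t≤  , inv′ = body inv
      t′ , s″ , ex′ , t′≤ , inv″ = runs-while I x≡m body m inv′
      x≢0 x≡0 = 1+n≢0 (trans (sym (x≡m inv)) x≡0)
  in _ , _ , loop x≢0 ex ex′ ,
     s≤s (≤-trans (+-mono-≤ t≤ t′≤) (≤-reflexive (+-suc c _))) , inv″

Agree : ℕ → Regs → Regs → Set
Agree d ρ ρ′ = ∀ {y} → y < d → ρ′ y ≡ ρ y

Keeps : ℕ → State → State → Set
Keeps d s s′ = Agree d (reg s) (reg s′)

keeps-trans : ∀ {d d′} {ρ ρ′ ρ″ : Regs} → d ≤ d′ →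
              Agree d ρ ρ′ → Agree d′ ρ′ ρ″ → Agree d ρ ρ″
keeps-trans d≤d′ k k′ y<d = trans (k′ (<-≤-trans y<d d≤d′)) (k y<d)

keeps-set : ∀ {d x v s} → d ≤ x → Keeps d s (setReg x v s)
keeps-set {s = s} d≤x y<d = update-other (reg s) _ (<⇒≢ (<-≤-trans y<d d≤x))

-- What code at level `d` relies on: the globals and all local variables lie below `d`, where it
-- never writes, so the scope survives every evaluation.
record Scope {k} (ρ : Regs) (θ : Fin k → ℕ) (γ : Env k) (d : ℕ) (s : State) : Set where
  constructor scope
  field
    globals : ∀ {x} → x < 20 → reg s x ≡ ρ x
    20≤d    : 20 ≤ d
    θ<d     : ∀ i → θ i < d
    locals  : ∀ i → reg s (θ i) ≡ γ i

scope-keeps : ∀ {k ρ} {θ : Fin k → ℕ} {γ d d′ s s′} →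
              d ≤ d′ → Keeps d s s′ → Scope ρ θ γ d s → Scope ρ θ γ d′ s′
scope-keeps d≤d′ keeps (scope glb 20≤d θ<d loc) = scope
  (λ x<20 → trans (keeps (<-≤-trans x<20 20≤d)) (glb x<20))
  (≤-trans 20≤d d≤d′)
  (λ i → <-≤-trans (θ<d i) d≤d′)
  (λ i → trans (keeps (θ<d i)) (loc i))

scope-push : ∀ {k ρ} {θ : Fin k → ℕ} {γ d s x v} → x < d → reg s x ≡ v →
             Scope ρ θ γ d s → Scope ρ (x ▸ θ) (v ▸ γ) d s
scope-push x<d eq (scope glb 20≤d θ<d loc) = scope glb 20≤d
  (λ { zero → x<d ; (suc i) → θ<d i }) (λ { zero → eq ; (suc i) → loc i })

record Evaluated (d v : ℕ) (s s′ : State) : Set where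
  constructor evaluated
  field
    value  : reg s′ d ≡ v
    keeps  : Keeps d s s′
    memory : arr s′ ≡ arr s

-- `runs-while` counts the rounds left, while the accumulator is known by the rounds done; `sum≡m`
-- links the two.
record Iterating (d m : ℕ) (acc : ℕ → ℕ) (s₀ : State) (todo : ℕ) (s : State) : Set where
  constructor iterating
  field
    done   : ℕ
    sum≡m  : done + todo ≡ m
    accreg : reg s d ≡ acc done
    idx    : reg s (1 + d) ≡ done
    left   : reg s (2 + d) ≡ todo
    kept   : Keeps d s₀ s
    mem    : arr s ≡ arr s₀

toℕ<20 : (x : Fin 16) → 4 + toℕ x < 20
toℕ<20 x = +-monoʳ-≤ 4 (toℕ<n x)

n≢1+n : ∀ {n} → n ≢ suc n
n≢1+n = 1+n≢n ∘ sym

n≢2+n : ∀ {n} → n ≢ 2 + n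
n≢2+n = <⇒≢ (m<n⇒m<1+n ≤-refl)

n≢3+n : ∀ {n} → n ≢ 3 + n
n≢3+n = <⇒≢ (m<n⇒m<1+n (m<n⇒m<1+n ≤-refl))

compile-correct :
  ∀ {k} (e : Exp k) {ρ θ γ d s} → Scope ρ θ γ d s →
  Runs s (compile θ d e) (cost e ρ) (Evaluated d (⟦ e ⟧ ρ (arr s) γ) s)

binary-correct :
  ∀ {k} (_∙_ : ℕ → ℕ → ℕ) (e e′ : Exp k) {ρ θ γ d s P} → Scope ρ θ γ d s →
  (∀ {s} (Q : State → Set) → Q (setReg d (reg s d ∙ reg s (suc d)) s) → Runs s P 1 Q) →
  Runs s (compile θ d e ⨾ compile θ (suc d) e′ ⨾ P)
    (cost e ρ + (cost e′ ρ + 1))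
    (Evaluated d (⟦ e ⟧ ρ (arr s) γ ∙ ⟦ e′ ⟧ ρ (arr s) γ) s)
binary-correct _∙_ e e′ {ρ} {γ = γ} {d} {s} sc step =
  runs-seq (compile-correct e sc) λ {s₁} (evaluated r₁ k₁ m₁) →
  runs-seq (compile-correct e′ (scope-keeps (n≤1+n d) k₁ sc)) λ {s₂} (evaluated r₂ k₂ m₂) →
  step _ (evaluated
    (trans (update-same (reg s₂) d _)
      (cong₂ _∙_ (trans (k₂ (n<1+n d)) r₁)
                 (trans r₂ (cong (λ μ → ⟦ e′ ⟧ ρ μ γ) m₁))))
    (keeps-trans ≤-refl (keeps-trans (n≤1+n d) k₁ k₂) (keeps-set {s = s₂} ≤-refl))
    (trans m₂ m₁))

compile-correct (lit c) {s = s} sc =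
  runs-const _ (evaluated (update-same (reg s) _ _) (keeps-set {s = s} ≤-refl) refl)
compile-correct (var i) {s = s} sc =
  runs-copy _ (evaluated (trans (update-same (reg s) _ _) (Scope.locals sc i))
                         (keeps-set {s = s} ≤-refl) refl)
compile-correct (glob x) {s = s} sc =
  runs-copy _ (evaluated (trans (update-same (reg s) _ _) (Scope.globals sc (toℕ<n x)))
                         (keeps-set {s = s} ≤-refl) refl)
compile-correct (e ⊞ e′) sc = binary-correct _+_ e e′ sc runs-add
compile-correct (e ⊟ e′) sc = binary-correct _∸_ e e′ sc runs-sub
compile-correct (get a e) {ρ} {γ = γ} {d} {s} sc =
  runs-seq (compile-correct e sc) λ {s₁} (evaluated r₁ k₁ m₁) →
  1 , _ , load , ≤-refl ,
  evaluated (trans (update-same (reg s₁) d _) (cong₂ (λ μ i → μ a i) m₁ r₁))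
            (keeps-trans ≤-refl k₁ (keeps-set {s = s₁} ≤-refl)) m₁
compile-correct (ifn c e e′) {ρ} {θ} {γ} {d} {s} sc =
  runs-seq (compile-correct c sc) λ {s₁} (evaluated r₁ k₁ m₁) →
  choose s₁ r₁ k₁ m₁ (⟦ c ⟧ ρ (arr s) γ) refl
  where
  -- The tested value is generalised to `b` so that `branch` reduces; the equation carries the case
  -- back to the register.
  choose : ∀ s₁ → reg s₁ d ≡ ⟦ c ⟧ ρ (arr s) γ → Keeps d s s₁ → arr s₁ ≡ arr s →
           ∀ b → ⟦ c ⟧ ρ (arr s) γ ≡ b →
           Runs s₁ (ifnz d (compile θ d e) (compile θ d e′))
             (suc (cost e ρ + cost e′ ρ))
             (Evaluated d (branch b (⟦ e ⟧ ρ (arr s) γ) (⟦ e′ ⟧ ρ (arr s) γ)) s)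
  choose s₁ r₁ k₁ m₁ (suc b) eq =
    let t , s₂ , ex , t≤ , evaluated r₂ k₂ m₂ =
          compile-correct e (scope-keeps ≤-refl k₁ sc)
    in suc t , s₂ , if-yes (λ z → 1+n≢0 (trans (sym (trans r₁ eq)) z)) ex ,
       s≤s (≤-trans t≤ (m≤m+n _ _)) ,
       evaluated (trans r₂ (cong (λ μ → ⟦ e ⟧ ρ μ γ) m₁))
                 (keeps-trans ≤-refl k₁ k₂) (trans m₂ m₁)
  choose s₁ r₁ k₁ m₁ zero eq =
    let t , s₂ , ex , t≤ , evaluated r₂ k₂ m₂ =
          compile-correct e′ (scope-keeps ≤-refl k₁ sc)
    in suc t , s₂ , if-no (trans r₁ eq) ex ,
       s≤s (≤-trans t≤ (m≤n+m _ _)) ,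
       evaluated (trans r₂ (cong (λ μ → ⟦ e′ ⟧ ρ μ γ) m₁))
                 (keeps-trans ≤-refl k₁ k₂) (trans m₂ m₁)
compile-correct (rec x e₀ e) {ρ} {θ} {γ} {d} {s} sc =
  runs-seq (compile-correct e₀ sc) λ {s₁} (evaluated r₁ k₁ m₁) →
  runs-seq (runs-const (λ s₂ → s₂ ≡ setReg (1 + d) 0 s₁) refl) λ { refl →
  runs-seq (runs-copy (Inv (bound ρ x)) (iterating 0 refl
      (trans (update-other (reg (setReg (1 + d) 0 s₁)) _ (n≢2+n {d}))
        (trans (update-other (reg s₁) _ (n≢1+n {d})) r₁))
      (trans (update-other (reg (setReg (1 + d) 0 s₁)) _ (n≢1+n {1 + d})) (update-same (reg s₁) (1 + d) _))
      (trans (update-same (reg (setReg (1 + d) 0 s₁)) (2 + d) _)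
        (trans (keeps-set {s = s₁} (n≤1+n d) (x<d))
          (trans (k₁ x<d) (Scope.globals sc (toℕ<20 x)))))
      (keeps-trans ≤-refl k₁ (keeps-trans ≤-refl (keeps-set {s = s₁} (n≤1+n d))
        (keeps-set {s = setReg (1 + d) 0 s₁} (m≤n+m d 2))))
      m₁)) λ inv →
  runs-weaken ≤-refl finish
    (runs-while Inv Iterating.left body (bound ρ x) inv) }
  where
  acc : ℕ → ℕ
  acc i = iter i (⟦ e₀ ⟧ ρ (arr s) γ) λ i acc → ⟦ e ⟧ ρ (arr s) (acc ▸ i ▸ γ)
  Inv : ℕ → State → Set
  Inv = Iterating d (bound ρ x) acc s
  x<d : 4 + toℕ x < d
  x<d = <-≤-trans (toℕ<20 x) (Scope.20≤d sc)
  finish : ∀ {s′} → Inv 0 s′ → Evaluated d (acc (bound ρ x)) s s′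
  finish (iterating i tot a _ _ k m) =
    evaluated (trans a (cong acc (trans (sym (+-identityʳ i)) tot))) k m
  body : ∀ {m s₁} → Inv (suc m) s₁ → Runs s₁ _ (cost e ρ + 4) (Inv m)
  body {m} {s₁} (iterating i tot a id lf k mm) =
    runs-seq (compile-correct e
      (scope-push (≤-trans (n<1+n d) (m≤n+m (1 + d) 2)) a
        (scope-push (m<n⇒m<1+n (n<1+n (1 + d))) id
          (scope-keeps (m≤n+m d 3) k sc)))) λ {s₂} (evaluated r₂ k₂ m₂) →
    let s₃ = setReg d (reg s₂ (3 + d)) s₂
        s₄ = setReg (3 + d) 1 s₃
        s₅ = setReg (1 + d) (reg s₄ (1 + d) + reg s₄ (3 + d)) s₄
        e₁ : reg s₄ (1 + d) ≡ i
        e₁ = trans (update-other (reg s₃) _ (n≢2+n {1 + d}))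
               (trans (update-other (reg s₂) _ (1+n≢n {d}))
                 (trans (k₂ (n≤1+n (2 + d))) id))
        e₂ : reg s₄ (2 + d) ≡ suc m
        e₂ = trans (update-other (reg s₃) _ (n≢1+n {2 + d}))
               (trans (update-other (reg s₂) _ (n≢2+n {d} ∘ sym))
                 (trans (k₂ (n<1+n (2 + d))) lf))
        e₃ : reg s₄ (3 + d) ≡ 1
        e₃ = update-same (reg s₃) (3 + d) _
    in
    runs-seq (runs-copy (_≡ s₃) refl) λ { refl →
    runs-seq (runs-const (_≡ s₄) refl) λ { refl →
    runs-seq (runs-add (_≡ s₅) refl) λ { refl →
    runs-sub _ (iterating (suc i) (trans (sym (+-suc i m)) tot)
      (trans (update-other (reg s₅) _ (n≢2+n {d}))
        (trans (update-other (reg s₄) _ (n≢1+n {d}))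
          (trans (update-other (reg s₃) _ (n≢3+n {d}))
            (trans (update-same (reg s₂) d _)
              (trans r₂ (cong (λ μ → ⟦ e ⟧ ρ μ (acc i ▸ i ▸ γ)) mm))))))
      (trans (update-other (reg s₅) _ (n≢1+n {1 + d}))
        (trans (update-same (reg s₄) (1 + d) _)
          (trans (cong₂ _+_ e₁ e₃) (+-comm i 1))))
      (trans (update-same (reg s₅) (2 + d) _)
        (cong₂ _∸_ (trans (update-other (reg s₄) _ (1+n≢n {1 + d})) e₂)
                   (trans (update-other (reg s₄) _ (n≢2+n {1 + d} ∘ sym)) e₃)))
      (λ {y} y<d →
        trans (keeps-set {s = s₅} (m≤n+m d 2) y<d)
          (trans (keeps-set {s = s₄} (n≤1+n d) y<d)
            (trans (keeps-set {s = s₃} (m≤n+m d 3) y<d)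
              (trans (keeps-set {s = s₂} ≤-refl y<d)
                (trans (k₂ (<-≤-trans y<d (m≤n+m d 3))) (k y<d))))))
      (trans m₂ mm)) } } }
compile-correct (ren σ e) (scope glb 20≤d θ<d loc) =
  compile-correct e (scope glb 20≤d (θ<d ∘ σ) (loc ∘ σ))

record Executed (d : ℕ) (μ : Mem) (s s′ : State) : Set where
  constructor executed
  field
    keeps  : Keeps d s s′
    memory : arr s′ ≡ μ

record Repeating (d m : ℕ) (mems : ℕ → Mem) (s₀ : State) (todo : ℕ) (s : State) : Set where
  constructor repeating
  field
    done   : ℕ
    sum≡m  : done + todo ≡ m
    idx    : reg s d ≡ done
    left   : reg s (1 + d) ≡ todo
    kept   : Keeps d s₀ s
    mem    : arr s ≡ mems done

compileᶜ-correct :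
  ∀ {k} (c : Cmd k) {ρ θ γ d s} → Scope ρ θ γ d s →
  Runs s (compileᶜ θ d c) (costᶜ c ρ) (Executed d (⟦ c ⟧ᶜ ρ γ (arr s)) s)
compileᶜ-correct (put a e e′) {ρ} {γ = γ} {d} {s} sc =
  runs-seq (compile-correct e sc) λ {s₁} (evaluated r₁ k₁ m₁) →
  runs-seq (compile-correct e′ (scope-keeps (n≤1+n d) k₁ sc)) λ {s₂} (evaluated r₂ k₂ m₂) →
  1 , _ , store , ≤-refl , executed (keeps-trans (n≤1+n d) k₁ k₂)
    (lemma (trans m₂ m₁) (trans (k₂ (n<1+n d)) r₁)
           (trans r₂ (cong (λ μ → ⟦ e′ ⟧ ρ μ γ) m₁)))
  where
  lemma : ∀ {μ μ′ i i′ v v′} → μ ≡ μ′ → i ≡ i′ → v ≡ v′ →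
          μ [ a ↦ μ a [ i ↦ v ] ] ≡ μ′ [ a ↦ μ′ a [ i′ ↦ v′ ] ]
  lemma refl refl refl = refl
compileᶜ-correct (c ▷ c′) {ρ} {γ = γ} sc =
  runs-seq (compileᶜ-correct c sc) λ (executed k₁ m₁) →
  runs-weaken ≤-refl
    (λ (executed k₂ m₂) → executed (keeps-trans ≤-refl k₁ k₂)
       (trans m₂ (cong (⟦ c′ ⟧ᶜ ρ γ) m₁)))
    (compileᶜ-correct c′ (scope-keeps ≤-refl k₁ sc))
compileᶜ-correct (iterate x c) {ρ} {θ} {γ} {d} {s} sc =
  let s₁ = setReg d 0 s in
  runs-seq (runs-const (_≡ s₁) refl) λ { refl →
  runs-seq (runs-copy (Inv (bound ρ x)) (repeating 0 refl
      (trans (update-other (reg s₁) _ (n≢1+n {d})) (update-same (reg s) d _))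
      (trans (update-same (reg s₁) (1 + d) _)
        (trans (keeps-set {s = s} ≤-refl x<d) (Scope.globals sc (toℕ<20 x))))
      (keeps-trans ≤-refl (keeps-set {s = s} ≤-refl)
        (keeps-set {s = s₁} (n≤1+n d)))
      refl)) λ inv →
  runs-weaken ≤-refl finish
    (runs-while Inv Repeating.left body (bound ρ x) inv) }
  where
  mems : ℕ → Mem
  mems i = iter i (arr s) λ i → ⟦ c ⟧ᶜ ρ (i ▸ γ)
  Inv : ℕ → State → Set
  Inv = Repeating d (bound ρ x) mems s
  x<d : 4 + toℕ x < d
  x<d = <-≤-trans (toℕ<20 x) (Scope.20≤d sc)
  finish : ∀ {s′} → Inv 0 s′ → Executed d (mems (bound ρ x)) s s′
  finish (repeating i tot _ _ k m) =
    executed k (trans m (cong mems (trans (sym (+-identityʳ i)) tot)))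
  body : ∀ {m s₁} → Inv (suc m) s₁ → Runs s₁ _ (costᶜ c ρ + 3) (Inv m)
  body {m} {s₁} (repeating i tot id lf k mm) =
    runs-seq (compileᶜ-correct c
      (scope-push (m<n⇒m<1+n (n<1+n d)) id (scope-keeps (m≤n+m d 2) k sc)))
      λ {s₂} (executed k₂ m₂) →
    let s₃ = setReg (2 + d) 1 s₂
        s₄ = setReg d (reg s₃ d + reg s₃ (2 + d)) s₃
        e₁ : reg s₃ d ≡ i
        e₁ = trans (update-other (reg s₂) _ (n≢2+n {d})) (trans (k₂ (m<n⇒m<1+n (n<1+n d))) id)
        e₂ : reg s₃ (1 + d) ≡ suc m
        e₂ = trans (update-other (reg s₂) _ (n≢1+n {1 + d})) (trans (k₂ (n<1+n (1 + d))) lf)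
        e₃ : reg s₃ (2 + d) ≡ 1
        e₃ = update-same (reg s₂) (2 + d) _
    in
    runs-seq (runs-const (_≡ s₃) refl) λ { refl →
    runs-seq (runs-add (_≡ s₄) refl) λ { refl →
    runs-sub _ (repeating (suc i) (trans (sym (+-suc i m)) tot)
      (trans (update-other (reg s₄) _ (n≢1+n {d}))
        (trans (update-same (reg s₃) d _)
          (trans (cong₂ _+_ e₁ e₃) (+-comm i 1))))
      (trans (update-same (reg s₄) (1 + d) _)
        (cong₂ _∸_ (trans (update-other (reg s₃) _ (1+n≢n {d})) e₂)
                   (trans (update-other (reg s₃) _ (n≢2+n {d} ∘ sym)) e₃)))
      (λ {y} y<d →
        trans (keeps-set {s = s₄} (n≤1+n d) y<d)
          (trans (keeps-set {s = s₃} ≤-refl y<d)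
            (trans (keeps-set {s = s₂} (m≤n+m d 2) y<d)
              (trans (k₂ (<-≤-trans y<d (m≤n+m d 2))) (k y<d)))))
      (trans m₂ (cong (⟦ c ⟧ᶜ ρ (i ▸ γ)) mm))) } }

-- Compiled expressions and commands leave the globals alone. This is the one step that changes a
-- global, and `ρ` changes with it.
runs-put : ∀ {ρ s} x (e : Exp 0) → Scope ρ none none 20 s → x < 20 →
           Runs s (compile none 20 e ⨾ x ≔ 20) (cost e ρ + 1) λ s′ →
             Scope (ρ [ x ↦ ⟦ e ⟧ ρ (arr s) none ]) none none 20 s′ ×
             arr s′ ≡ arr s
runs-put {ρ} {s} x e sc x<20 =
  runs-seq (compile-correct e sc) λ {s₁} (evaluated r k m) →
  runs-copy _ (scope (glb s₁ r k) ≤-refl (λ ()) (λ ()) , m)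
  where
  glb : ∀ s₁ → reg s₁ 20 ≡ ⟦ e ⟧ ρ (arr s) none → Keeps 20 s s₁ → ∀ {y} → y < 20 →
        reg (setReg x (reg s₁ 20) s₁) y ≡ (ρ [ x ↦ ⟦ e ⟧ ρ (arr s) none ]) y
  glb s₁ r k {y} y<20 with y ≡ᵇ x
  ... | true  = r
  ... | false = trans (k y<20) (Scope.globals sc y<20)

-- Costs are polynomial in the largest loop bound

-- For a fixed expression the cost is a polynomial in the loop bounds with natural coefficients. Its
-- value at 1 is the sum of the coefficients, and this sum times `B ^ degree` bounds the cost
-- whenever all loop bounds are at most `B` and `B ≥ 1`.
unitCost : ∀ {k} → Exp k → ℕ
unitCost e = cost e λ _ → 1

unitCostᶜ : ∀ {k} → Cmd k → ℕ
unitCostᶜ c = costᶜ c λ _ → 1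

-- Sums of costs add degrees instead of taking the maximum, so that `degree` follows `cost` clause
-- by clause; the summands 0 belong to the constant summands there.
degree : ∀ {k} → Exp k → ℕ
degree (lit c)      = 0
degree (var i)      = 0
degree (glob x)     = 0
degree (e ⊞ e′)     = degree e + (degree e′ + 0)
degree (e ⊟ e′)     = degree e + (degree e′ + 0)
degree (get a e)    = degree e + 0
degree (ifn c e e′) = degree c + (degree e + degree e′)
degree (rec x e₀ e) = degree e₀ + suc (degree e + 0)
degree (ren σ e)    = degree e

degreeᶜ : ∀ {k} → Cmd k → ℕ
degreeᶜ (put a e e′)  = degree e + (degree e′ + 0)
degreeᶜ (c ▷ c′)      = degreeᶜ c + degreeᶜ c′
degreeᶜ (iterate x c) = suc (degreeᶜ c + 0)

record Poly (B c u d : ℕ) : Set where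
  constructor poly
  field evaluate : c ≤ u * B ^ d

lit-bound : ∀ {B} m → Poly B m m 0
lit-bound m = poly (≤-reflexive (sym (*-identityʳ m)))

sum-bound : ∀ {B c c′ u u′ d d′} → 1 ≤ B → Poly B c u d → Poly B c′ u′ d′ →
            Poly B (c + c′) (u + u′) (d + d′)
sum-bound {B} {c} {c′} {u} {u′} {d} {d′} 1≤B (poly p) (poly p′) = poly (begin
  c + c′                                 ≤⟨ +-mono-≤ p p′ ⟩
  u * B ^ d + u′ * B ^ d′                ≤⟨ +-mono-≤ (*-monoʳ-≤ u q) (*-monoʳ-≤ u′ q′) ⟩
  u * B ^ (d + d′) + u′ * B ^ (d + d′)   ≡⟨ *-distribʳ-+ (B ^ (d + d′)) u u′ ⟨
  (u + u′) * B ^ (d + d′)                ∎)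
  where
  open ≤-Reasoning
  instance B≢0 : NonZero B
  B≢0 = >-nonZero 1≤B
  q  = ^-monoʳ-≤ B (m≤m+n d d′)
  q′ = ^-monoʳ-≤ B (m≤n+m d′ d)

times-bound : ∀ {B b c u d} → b ≤ B → Poly B c u d → Poly B (b * c) (1 * u) (suc d)
times-bound {B} {b} {c} {u} {d} b≤B (poly p) = poly (begin
  b * c              ≤⟨ *-mono-≤ b≤B p ⟩
  B * (u * B ^ d)    ≡⟨ *-assoc B u _ ⟨
  B * u * B ^ d      ≡⟨ cong (_* B ^ d) (*-comm B u) ⟩
  u * B * B ^ d      ≡⟨ *-assoc u B _ ⟩
  u * B ^ suc d      ≡⟨ cong (_* B ^ suc d) (*-identityˡ u) ⟨
  1 * u * B ^ suc d  ∎)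
  where open ≤-Reasoning

loop-bound : ∀ {B b c u d} m → 1 ≤ B → b ≤ B → Poly B c u d →
             Poly B (3 + b * suc (c + m)) (3 + 1 * suc (u + m)) (suc (d + 0))
loop-bound m 1≤B b≤B p = sum-bound 1≤B (lit-bound 3) (times-bound b≤B
  (sum-bound 1≤B (lit-bound 1) (sum-bound 1≤B p (lit-bound m))))

cost-bound : ∀ {k ρ B} (e : Exp k) → 1 ≤ B → (∀ x → bound ρ x ≤ B) →
             Poly B (cost e ρ) (unitCost e) (degree e)
cost-bound (lit c)  1≤B bd = lit-bound 1
cost-bound (var i)  1≤B bd = lit-bound 1
cost-bound (glob x) 1≤B bd = lit-bound 1
cost-bound (e ⊞ e′) 1≤B bd =
  sum-bound 1≤B (cost-bound e 1≤B bd) (sum-bound 1≤B (cost-bound e′ 1≤B bd) (lit-bound 1))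
cost-bound (e ⊟ e′) 1≤B bd =
  sum-bound 1≤B (cost-bound e 1≤B bd) (sum-bound 1≤B (cost-bound e′ 1≤B bd) (lit-bound 1))
cost-bound (get a e) 1≤B bd = sum-bound 1≤B (cost-bound e 1≤B bd) (lit-bound 1)
cost-bound (ifn c e e′) 1≤B bd =
  sum-bound 1≤B (cost-bound c 1≤B bd) (sum-bound 1≤B (lit-bound 1)
    (sum-bound 1≤B (cost-bound e 1≤B bd) (cost-bound e′ 1≤B bd)))
cost-bound (rec x e₀ e) 1≤B bd =
  sum-bound 1≤B (cost-bound e₀ 1≤B bd) (loop-bound 4 1≤B (bd x) (cost-bound e 1≤B bd))
cost-bound (ren σ e) 1≤B bd = cost-bound e 1≤B bd

costᶜ-bound : ∀ {k ρ B} (c : Cmd k) → 1 ≤ B → (∀ x → bound ρ x ≤ B) →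
              Poly B (costᶜ c ρ) (unitCostᶜ c) (degreeᶜ c)
costᶜ-bound (put a e e′) 1≤B bd =
  sum-bound 1≤B (cost-bound e 1≤B bd) (sum-bound 1≤B (cost-bound e′ 1≤B bd) (lit-bound 1))
costᶜ-bound (c ▷ c′) 1≤B bd = sum-bound 1≤B (costᶜ-bound c 1≤B bd) (costᶜ-bound c′ 1≤B bd)
costᶜ-bound (iterate x c) 1≤B bd = loop-bound 3 1≤B (bd x) (costᶜ-bound c 1≤B bd)

-- Arrays that a command does not write or an expression does not read

-- Built on a Boolean test: for a concrete command and array it reduces to a product of unit types,
-- which is inferred as an implicit argument wherever a frame condition is needed.
Unwritten : ∀ {k} → ℕ → Cmd k → Set
Unwritten b (put a e e′)  = T (not (b ≡ᵇ a))
Unwritten b (c ▷ c′)      = Unwritten b c × Unwritten b c′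
Unwritten b (iterate x c) = Unwritten b c

Unread : ∀ {k} → ℕ → Exp k → Set
Unread a (get b e)    = T (not (b ≡ᵇ a)) × Unread a e
Unread a (lit c)      = ⊤
Unread a (var i)      = ⊤
Unread a (glob x)     = ⊤
Unread a (e ⊞ e′)     = Unread a e × Unread a e′
Unread a (e ⊟ e′)     = Unread a e × Unread a e′
Unread a (ifn c e e′) = Unread a c × Unread a e × Unread a e′
Unread a (rec x e e′) = Unread a e × Unread a e′
Unread a (ren σ e)    = Unread a e

≢-if-not-≡ᵇ : ∀ {a b} → T (not (b ≡ᵇ a)) → b ≢ a
≢-if-not-≡ᵇ {a} p refl with a ≡ᵇ a | ≡⇒≡ᵇ a a refl
... | true | _ = p

unwritten : ∀ {k ρ γ μ b} (c : Cmd k) → Unwritten b c → ⟦ c ⟧ᶜ ρ γ μ b ≡ μ b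
unwritten {μ = μ} (put a e e′) p = update-other μ _ (≢-if-not-≡ᵇ p)
unwritten (c ▷ c′) (p , p′) = trans (unwritten c′ p′) (unwritten c p)
unwritten {ρ = ρ} {γ} {μ} {b} (iterate x c) p = go (bound ρ x)
  where
  go : ∀ m → iter m μ (λ i → ⟦ c ⟧ᶜ ρ (i ▸ γ)) b ≡ μ b
  go zero    = refl
  go (suc m) = trans (unwritten c p) (go m)

unread : ∀ {k ρ γ μ μ′ a} (e : Exp k) → Unread a e → (∀ b → b ≢ a → μ b ≡ μ′ b) →
         ⟦ e ⟧ ρ μ γ ≡ ⟦ e ⟧ ρ μ′ γ
unread (lit c) p eq = refl
unread (var i) p eq = refl
unread (glob x) p eq = refl
unread (e ⊞ e′) (p , p′) eq = cong₂ _+_ (unread e p eq) (unread e′ p′ eq)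
unread (e ⊟ e′) (p , p′) eq = cong₂ _∸_ (unread e p eq) (unread e′ p′ eq)
unread (get b e) (p , p′) eq = cong₂ (λ f i → f i) (eq b (≢-if-not-≡ᵇ p)) (unread e p′ eq)
unread {ρ = ρ} {γ} {μ} {μ′} (ifn c e e′) (p , p′ , p″) eq
  rewrite unread {ρ = ρ} {γ} c p eq | unread {ρ = ρ} {γ} e p′ eq | unread {ρ = ρ} {γ} e′ p″ eq = refl
unread {ρ = ρ} {γ} {μ} {μ′} (rec x e₀ e) (p , p′) eq = go (bound ρ x)
  where
  go : ∀ m → iter m (⟦ e₀ ⟧ ρ μ γ) (λ i acc → ⟦ e ⟧ ρ μ (acc ▸ i ▸ γ)) ≡
             iter m (⟦ e₀ ⟧ ρ μ′ γ) (λ i acc → ⟦ e ⟧ ρ μ′ (acc ▸ i ▸ γ))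
  go zero    = unread e₀ p eq
  go (suc m) rewrite go m = unread e p′ eq
unread (ren σ e) p eq = unread e p eq

-- Filling an array from an expression

fill : ∀ {k} → ℕ → Fin 16 → Exp (suc k) → Cmd k
fill a x e = iterate x (put a (var zero) e)

-- Since `e` does not read `a`, each entry is computed as if from the initial memory, although
-- earlier entries of `a` have been written by then.
fill-get : ∀ {k ρ γ μ} a x (e : Exp (suc k)) {t} → Unread a e → t < bound ρ x →
           ⟦ fill a x e ⟧ᶜ ρ γ μ a t ≡ ⟦ e ⟧ ρ μ (t ▸ γ)
fill-get {ρ = ρ} {γ} {μ} a x e {t} p = go (bound ρ x)
  where
  mems : ℕ → Mem
  mems m = iter m μ λ i → ⟦ put a (var zero) e ⟧ᶜ ρ (i ▸ γ)
  others : ∀ m b → b ≢ a → mems m b ≡ μ b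
  others zero    b b≢a = refl
  others (suc m) b b≢a = trans (update-other (mems m) _ b≢a) (others m b b≢a)
  go : ∀ m → t < m → mems m a t ≡ ⟦ e ⟧ ρ μ (t ▸ γ)
  go (suc m) t<1+m with t ≟ m
  ... | yes refl = trans (cong (λ f → f t) (update-same (mems m) a _))
        (trans (update-same (mems m a) m _) (unread e p (others m)))
  ... | no t≢m = trans (cong (λ f → f t) (update-same (mems m) a _))
        (trans (update-other (mems m a) _ t≢m) (go m (≤∧≢⇒< (s≤s⁻¹ t<1+m) t≢m)))

-- Truth values: nonzero means true

data Reflects (P : Set) : ℕ → Set where
  holds : ∀ {m} → P → Reflects P (suc m)
  fails : ¬ P → Reflects P 0

reflects-map : ∀ {P Q m} → (P → Q) → (Q → P) → Reflects P m → Reflects Q m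
reflects-map f g (holds p)  = holds (f p)
reflects-map f g (fails ¬p) = fails (¬p ∘ g)

reflects-nonzero : ∀ {P m} → Reflects P m → P → m ≢ 0
reflects-nonzero (holds _)  _ ()
reflects-nonzero (fails ¬p) p _ = ¬p p

reflects-≤ : ∀ x y → Reflects (x ≤ y) (1 ∸ (x ∸ y))
reflects-≤ x y with x ≤? y
... | yes x≤y rewrite m≤n⇒m∸n≡0 x≤y = holds x≤y
... | no  x≰y with x ∸ y | m<n⇒0<n∸m (≰⇒> x≰y)
...   | suc d | _ rewrite 0∸n≡0 d = fails x≰y

reflects-< : ∀ x y → Reflects (x < y) (y ∸ x)
reflects-< x y with y ∸ x in eq
... | zero  = fails (≤⇒≯ (m∸n≡0⇒m≤n eq))
... | suc d = holds (m∸n≢0⇒n<m (λ z → 1+n≢0 (trans (sym eq) z)))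

reflects-≢0 : ∀ m → Reflects (m ≢ 0) m
reflects-≢0 zero    = fails (λ z → z refl)
reflects-≢0 (suc m) = holds λ ()

reflects-× : ∀ {P Q m m′} → Reflects P m → Reflects Q m′ → Reflects (P × Q) (branch m m′ 0)
reflects-× (holds p)  (holds q)  = holds (p , q)
reflects-× (holds p)  (fails ¬q) = fails (¬q ∘ proj₂)
reflects-× (fails ¬p) _          = fails (¬p ∘ proj₁)

reflects-⊎ : ∀ {P Q m m′} → Reflects P m → Reflects Q m′ → Reflects (P ⊎ Q) (branch m 1 m′)
reflects-⊎ (holds p)  _          = holds (inj₁ p)
reflects-⊎ (fails ¬p) (holds q)  = holds (inj₂ q)
reflects-⊎ (fails ¬p) (fails ¬q) = fails λ { (inj₁ p) → ¬p p ; (inj₂ q) → ¬q q }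

reflects-→ : ∀ {P Q m m′} → Reflects P m → Reflects Q m′ → Reflects (P → Q) (branch m m′ 1)
reflects-→ (holds p)  (holds q)  = holds (λ _ → q)
reflects-→ (holds p)  (fails ¬q) = fails (λ f → ¬q (f p))
reflects-→ (fails ¬p) _          = holds (λ p → ⊥-elim (¬p p))

reflects-¬ : ∀ {P m} → Reflects P m → Reflects (¬ P) (1 ∸ m)
reflects-¬ (holds {m} p) rewrite 0∸n≡0 m = fails (λ ¬p → ¬p p)
reflects-¬ (fails ¬p) = holds ¬p

infixr 7 _∧ᵉ_
infixr 6 _→ᵉ_ _∨ᵉ_
infix  8 _≤ᵉ_ _<ᵉ_ _≡ᵉ_

¬ᵉ_ : ∀ {k} → Exp k → Exp k
¬ᵉ e = lit 1 ⊟ e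

_≤ᵉ_ _<ᵉ_ _≡ᵉ_ _∧ᵉ_ _∨ᵉ_ _→ᵉ_ : ∀ {k} → Exp k → Exp k → Exp k
e ≤ᵉ e′ = lit 1 ⊟ (e ⊟ e′)
e <ᵉ e′ = e′ ⊟ e
e ∧ᵉ e′ = ifn e e′ (lit 0)
e ∨ᵉ e′ = ifn e (lit 1) e′
e →ᵉ e′ = ifn e e′ (lit 1)
e ≡ᵉ e′ = (e ≤ᵉ e′) ∧ᵉ (e′ ≤ᵉ e)

reflects-≡ : ∀ x y → Reflects (x ≡ y) (branch (1 ∸ (x ∸ y)) (1 ∸ (y ∸ x)) 0)
reflects-≡ x y = reflects-map (λ (p , q) → ≤-antisym p q)
  (λ p → ≤-reflexive p , ≤-reflexive (sym p)) (reflects-× (reflects-≤ x y) (reflects-≤ y x))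

anyᵉ allᵉ sumᵉ : ∀ {k} → Fin 16 → Exp (suc k) → Exp k
anyᵉ x e = rec x (lit 0) (var zero ∨ᵉ ren suc e)
allᵉ x e = ¬ᵉ anyᵉ x (¬ᵉ e)
sumᵉ x e = rec x (lit 0) (var zero ⊞ ren suc e)

reflects-any : ∀ {P : ℕ → Set} {f : ℕ → ℕ} m → (∀ {i} → i < m → Reflects (P i) (f i)) →
               Reflects (∃[ i ] i < m × P i) (iter m 0 λ i acc → branch acc 1 (f i))
reflects-any zero    ref = fails λ ()
reflects-any {P} {f} (suc m) ref = reflects-map to from
  (reflects-⊎ (reflects-any {P} {f} m (ref ∘ m<n⇒m<1+n)) (ref ≤-refl))
  where
  to : (∃[ i ] i < m × P i) ⊎ P m → ∃[ i ] i < suc m × P i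
  to (inj₁ (i , i<m , p)) = i , m<n⇒m<1+n i<m , p
  to (inj₂ p)             = m , ≤-refl , p
  from : ∃[ i ] i < suc m × P i → (∃[ i ] i < m × P i) ⊎ P m
  from (i , i<1+m , p) with i ≟ m
  ... | yes refl = inj₂ p
  ... | no  i≢m  = inj₁ (i , ≤∧≢⇒< (s≤s⁻¹ i<1+m) i≢m , p)

-- Passing from `¬ ∃ ¬` to `∀` is constructive here because `f i` decides every instance.
reflects-all : ∀ {P : ℕ → Set} {f : ℕ → ℕ} m → (∀ {i} → i < m → Reflects (P i) (f i)) →
               Reflects (∀ {i} → i < m → P i)
                        (1 ∸ (iter m 0 λ i acc → branch acc 1 (1 ∸ f i)))
reflects-all {P} {f} m ref = reflects-map to (λ all (i , i<m , ¬p) → ¬p (all i<m))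
  (reflects-¬ (reflects-any {¬_ ∘ P} {λ i → 1 ∸ f i} m (λ i<m → reflects-¬ (ref i<m))))
  where
  to : ¬ (∃[ i ] i < m × ¬ P i) → ∀ {i} → i < m → P i
  to ¬ex {i} i<m with f i | ref i<m
  ... | _ | holds p  = p
  ... | _ | fails ¬p = ⊥-elim (¬ex (i , i<m , ¬p))

minᵉ : ∀ {k} → Fin 16 → Exp k → Exp (suc k) → Exp k
minᵉ x e₀ e = rec x e₀ (ifn (var zero ≤ᵉ ren suc e) (var zero) (ren suc e))

minimum : ℕ → ℕ → (ℕ → ℕ) → ℕ
minimum m v f = iter m v λ i acc → branch (1 ∸ (acc ∸ f i)) acc (f i)

branch-≤ : ∀ x y → branch (1 ∸ (x ∸ y)) x y ≡ x ⊓ y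
branch-≤ x y with 1 ∸ (x ∸ y) | reflects-≤ x y
... | _ | holds x≤y = sym (m≤n⇒m⊓n≡m x≤y)
... | _ | fails x≰y = sym (m≥n⇒m⊓n≡n (≰⇒≥ x≰y))

-- The start value `v` acts as infinity: a result below it must come from one of the indices.
minimum-≤ : ∀ {m v f w} → w < v → minimum m v f ≤ w → ∃[ i ] i < m × f i ≤ w
minimum-≤ {zero}  w<v p = ⊥-elim (<⇒≱ w<v p)
minimum-≤ {suc m} {v} {f} {w} w<v p
  with ⊓-sel (minimum m v f) (f m) | subst (_≤ w) (branch-≤ (minimum m v f) (f m)) p
... | inj₁ eq | q = let i , i<m , fi≤w = minimum-≤ {m} {v} {f} w<v (subst (_≤ w) eq q)
                    in i , m<n⇒m<1+n i<m , fi≤w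
... | inj₂ eq | q = m , ≤-refl , subst (_≤ w) eq q

≤-minimum : ∀ {m v f i} → i < m → minimum m v f ≤ f i
≤-minimum {suc m} {v} {f} {i} i<1+m rewrite branch-≤ (minimum m v f) (f m) with i ≟ m
... | yes refl = m⊓n≤n (minimum m v f) (f m)
... | no  i≢m  = ≤-trans (m⊓n≤m _ (f m)) (≤-minimum {m} {v} {f} (≤∧≢⇒< (s≤s⁻¹ i<1+m) i≢m))

-- Arithmetic: products with a loop bound, digits

wk₂ : ∀ {k} → Exp k → Exp (2 + k)
wk₂ = ren (λ i → suc (suc i))

mulᵉ : ∀ {k} → Fin 16 → Exp k → Exp k
mulᵉ x e = rec x (lit 0) (var zero ⊞ wk₂ e)

iter-+ : ∀ m v → iter m 0 (λ _ acc → acc + v) ≡ m * v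
iter-+ zero    v = refl
iter-+ (suc m) v = trans (cong (_+ v) (iter-+ m v)) (+-comm (m * v) v)

-- Stands for register 14, which holds `top`. It bounds every number that is divided, so it can
-- bound the search for a quotient.
big : Fin 16
big = Fin.fromℕ< {10} (s≤s (s≤s (s≤s (s≤s (s≤s (s≤s (s≤s (s≤s (s≤s (s≤s (s≤s z≤n)))))))))))

divᵉ modᵉ : ∀ {k} → Fin 16 → Exp k → Exp k
divᵉ x e = rec big (lit 0)
  (ifn (mulᵉ x (lit 1 ⊞ var zero) ≤ᵉ wk₂ e) (lit 1 ⊞ var zero) (var zero))
modᵉ x e = e ⊟ mulᵉ x (divᵉ x e)

quotient-unique : ∀ {b v q} .{{_ : NonZero b}} → b * q ≤ v → v < b * suc q → q ≡ v / b
quotient-unique {b} {v} {q} lo hi = ≤-antisym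
  (≤-trans (≤-reflexive (sym (trans (cong (_/ b) (*-comm b q)) (m*n/n≡m q b)))) (/-monoˡ-≤ b lo))
  (s≤s⁻¹ (m<n*o⇒m/o<n (subst (v <_) (*-comm b (suc q)) hi)))

divᵉ-spec : ∀ {k} ρ μ (γ : Env k) x (e : Exp k) .{{_ : NonZero (bound ρ x)}} →
            ⟦ e ⟧ ρ μ γ ≤ bound ρ big → ⟦ divᵉ x e ⟧ ρ μ γ ≡ ⟦ e ⟧ ρ μ γ / bound ρ x
divᵉ-spec ρ μ γ x e v≤B =
  let lo , hi = scan (bound ρ big)
  in quotient-unique lo (finish hi)
  where
  b = bound ρ x
  v = ⟦ e ⟧ ρ μ γ
  q : ℕ → ℕ
  q m = iter m 0 λ _ acc → branch (1 ∸ (iter b 0 (λ _ a → a + (1 + acc)) ∸ v)) (1 + acc) acc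
  -- After `m` rounds either every round has raised the quotient, or it has reached its final value.
  -- After `bound ρ big ≥ v` rounds the first case is final too, as the divisor is nonzero.
  scan : ∀ m → b * q m ≤ v × (q m ≡ m ⊎ v < b * suc (q m))
  scan zero = subst (_≤ v) (sym (*-zeroʳ b)) z≤n , inj₁ refl
  scan (suc m)
    rewrite iter-+ b (1 + q m)
    with 1 ∸ (b * suc (q m) ∸ v) | reflects-≤ (b * suc (q m)) v | scan m
  ... | _ | holds p | lo , inj₁ eq = p , inj₁ (cong suc eq)
  ... | _ | holds p | lo , inj₂ hi = ⊥-elim (<⇒≱ hi p)
  ... | _ | fails p | lo , _       = lo , inj₂ (≰⇒> p)
  finish : q (bound ρ big) ≡ bound ρ big ⊎ v < b * suc (q (bound ρ big)) →
           v < b * suc (q (bound ρ big))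
  finish (inj₂ hi) = hi
  finish (inj₁ eq) rewrite eq = ≤-trans (s≤s v≤B) (m≤n*m (suc (bound ρ big)) b)

modᵉ-spec : ∀ {k} ρ μ (γ : Env k) x (e : Exp k) .{{_ : NonZero (bound ρ x)}} →
            ⟦ e ⟧ ρ μ γ ≤ bound ρ big → ⟦ modᵉ x e ⟧ ρ μ γ ≡ ⟦ e ⟧ ρ μ γ % bound ρ x
modᵉ-spec ρ μ γ x e v≤B
  rewrite divᵉ-spec ρ μ γ x e v≤B | iter-+ (bound ρ x) (⟦ e ⟧ ρ μ γ / bound ρ x)
  = trans (cong (v ∸_) (*-comm b (v / b))) (sym (m%n≡m∸m/n*n v b))
  where
  b = bound ρ x
  v = ⟦ e ⟧ ρ μ γ

-- The number of rounds of a loop is a register, so a computed number `m` is simulated by `big`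
-- rounds of which only the first `m` have an effect.
iterUpToᵉ : ∀ {k} → Exp k → Exp k → Exp (2 + k) → Exp k
iterUpToᵉ m e₀ e = rec big e₀ (ifn (var (suc zero) <ᵉ wk₂ m) e (var zero))

iter-guarded : ∀ {m v} {f : ℕ → ℕ → ℕ} B → m ≤ B →
               iter B v (λ i acc → branch (m ∸ i) (f i acc) acc) ≡ iter m v f
iter-guarded {m} {v} {f} B m≤B = trans (go B) (cong (λ j → iter j v f) (m≥n⇒m⊓n≡n m≤B))
  where
  go : ∀ B → iter B v (λ i acc → branch (m ∸ i) (f i acc) acc) ≡ iter (B ⊓ m) v f
  go zero = refl
  go (suc B) rewrite go B with m ∸ B | reflects-< B m
  ... | _ | holds B<m rewrite m≤n⇒m⊓n≡m B<m | m≤n⇒m⊓n≡m (<⇒≤ B<m) = refl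
  ... | _ | fails B≮m
    rewrite m≥n⇒m⊓n≡n (≮⇒≥ B≮m) | m≥n⇒m⊓n≡n (≤-trans (≮⇒≥ B≮m) (n≤1+n B)) = refl

digit : (b : ℕ) .{{_ : NonZero b}} → ℕ → ℕ → ℕ
digit b v i = iter i v (λ _ acc → acc / b) % b

iter-/≤ : ∀ b .{{_ : NonZero b}} v i → iter i v (λ _ acc → acc / b) ≤ v
iter-/≤ b v zero    = ≤-refl
iter-/≤ b v (suc i) = ≤-trans (m/n≤m _ b) (iter-/≤ b v i)

digitᵉ : ∀ {k} → Fin 16 → Exp k → Exp k → Exp k
digitᵉ x e i = modᵉ x (iterUpToᵉ i e (divᵉ x (var zero)))

digitᵉ-spec : ∀ {k} ρ μ (γ : Env k) x (e i : Exp k) .{{_ : NonZero (bound ρ x)}} →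
              ⟦ e ⟧ ρ μ γ ≤ bound ρ big → ⟦ i ⟧ ρ μ γ ≤ bound ρ big →
              ⟦ digitᵉ x e i ⟧ ρ μ γ ≡ digit (bound ρ x) (⟦ e ⟧ ρ μ γ) (⟦ i ⟧ ρ μ γ)
digitᵉ-spec ρ μ γ x e i v≤B i≤B =
  trans (modᵉ-spec ρ μ γ x (iterUpToᵉ i e (divᵉ x (var zero))) (subst (_≤ B) (sym shift) shifted≤B))
        (cong (_% b) shift)
  where
  b = bound ρ x
  B = bound ρ big
  v = ⟦ e ⟧ ρ μ γ
  n = ⟦ i ⟧ ρ μ γ
  step : ℕ → ℕ → ℕ
  step j acc = ⟦ divᵉ x (var zero) ⟧ ρ μ (acc ▸ j ▸ γ)
  divisions : ∀ m → iter m v step ≡ iter m v (λ _ acc → acc / b)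
  divisions zero = refl
  divisions (suc m) rewrite divisions m = divᵉ-spec ρ μ (iter m v (λ _ acc → acc / b) ▸ m ▸ γ) x
    (var zero) (≤-trans (iter-/≤ b v m) v≤B)
  shift : ⟦ iterUpToᵉ i e (divᵉ x (var zero)) ⟧ ρ μ γ ≡ iter n v (λ _ acc → acc / b)
  shift = trans (iter-guarded {f = step} B i≤B) (divisions n)
  shifted≤B : iter n v (λ _ acc → acc / b) ≤ B
  shifted≤B = ≤-trans (iter-/≤ b v n) v≤B

-- Digit strings and separating hash functions

iter-shift : ∀ {A : Set} m (a : A) (f : A → A) →
             iter (suc m) a (λ _ → f) ≡ iter m (f a) (λ _ → f)
iter-shift zero    a f = refl
iter-shift (suc m) a f = cong f (iter-shift m a f)

digit-suc : ∀ b .{{_ : NonZero b}} v i → digit b v (suc i) ≡ digit b (v / b) i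
digit-suc b v i = cong (_% b) (iter-shift i v (_/ b))

digit< : ∀ b .{{_ : NonZero b}} v i → digit b v i < b
digit< b v i = m%n<n _ b

-- Makes a loop over all `z < b ^ L` a search through all functions from `L` places to values below
-- `b`.
encodeDigits : ∀ b .{{_ : NonZero b}} L (F : ℕ → ℕ) → (∀ t → F t < b) →
               ∃[ z ] z < b ^ L × (∀ {t} → t < L → digit b z t ≡ F t)
encodeDigits b zero    F F<b = 0 , s≤s z≤n , λ ()
encodeDigits b (suc L) F F<b =
  let z , z<b^L , dig = encodeDigits b L (F ∘ suc) (F<b ∘ suc)
      quot : (F 0 + z * b) / b ≡ z
      quot = trans (+-distrib-/ (F 0) (z * b) (subst (_< b)
               (sym (trans (cong₂ _+_ (m<n⇒m%n≡m (F<b 0)) (m*n%n≡0 z b)) (+-identityʳ _))) (F<b 0)))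
             (cong₂ _+_ (m<n⇒m/n≡0 (F<b 0)) (m*n/n≡m z b))
  in F 0 + z * b
   , ≤-trans (+-monoˡ-≤ (z * b) (F<b 0))
       (≤-trans (*-monoˡ-≤ b z<b^L) (≤-reflexive (*-comm (b ^ L) b)))
   , λ { {zero}  _   → trans ([m+kn]%n≡m%n (F 0) z b) (m<n⇒m%n≡m (F<b 0))
       ; {suc t} t<L → trans (digit-suc b (F 0 + z * b) t)
                         (trans (cong (λ w → digit b w t) quot) (dig (s≤s⁻¹ t<L))) }

-- If the lowest digits agree, the halves differ, and they have one digit less.
bitsSeparate : ∀ l {x y} → x < 2 ^ l → y < 2 ^ l → x ≢ y →
               ∃[ p ] p < l × digit 2 x p ≢ digit 2 y p
bitsSeparate zero x<1 y<1 x≢y = ⊥-elim (x≢y (trans (n<1⇒n≡0 x<1) (sym (n<1⇒n≡0 y<1))))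
bitsSeparate (suc l) {x} {y} x< y< x≢y with x % 2 ≟ y % 2
... | no  x%2≢y%2 = 0 , s≤s z≤n , x%2≢y%2
... | yes x%2≡y%2 =
  let half : ∀ {v} → v < 2 ^ suc l → v / 2 < 2 ^ l
      half {v} v< = m<n*o⇒m/o<n (subst (v <_) (*-comm 2 (2 ^ l)) v<)
      p , p<l , differ = bitsSeparate l (half x<) (half y<) λ eq →
        x≢y (trans (m≡m%n+[m/n]*n x 2)
              (trans (cong₂ (λ r q → r + q * 2) x%2≡y%2 eq) (sym (m≡m%n+[m/n]*n y 2))))
  in suc p , s≤s p<l , λ eq →
     differ (trans (sym (digit-suc 2 x p)) (trans eq (digit-suc 2 y p)))

-- The number whose binary digits are those of `v` at the places `P 0`, `P 1`, ..., the first of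
-- them leading.
hash : (ℕ → ℕ) → ℕ → ℕ → ℕ
hash P m v = iter m 0 λ t acc → acc + acc + digit 2 v (P t)

hash< : ∀ P m v → hash P m v < 2 ^ m
hash< P zero    v = s≤s z≤n
hash< P (suc m) v = begin-strict
  h + h + d      ≤⟨ +-monoʳ-≤ (h + h) (s≤s⁻¹ (digit< 2 v (P m))) ⟩
  h + h + 1      ≡⟨ +-assoc h h 1 ⟩
  h + (h + 1)    <⟨ +-mono-<-≤ (hash< P m v) (subst (_≤ 2 ^ m) (+-comm 1 h) (hash< P m v)) ⟩
  2 ^ m + 2 ^ m  ≡⟨ cong (2 ^ m +_) (+-identityʳ _) ⟨
  2 ^ suc m      ∎
  where
  open ≤-Reasoning
  h = hash P m v
  d = digit 2 v (P m)

double-injective : ∀ {a b c d} → c < 2 → d < 2 → a + a + c ≡ b + b + d → a ≡ b × c ≡ d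
double-injective {a} {b} {c} {d} c<2 d<2 eq = quot , rem
  where
  double : ∀ x y → x + x + y ≡ y + x * 2
  double x y = trans (+-comm (x + x) y)
    (cong (y +_) (trans (cong (x +_) (sym (+-identityʳ x))) (*-comm 2 x)))
  eq′ : c + a * 2 ≡ d + b * 2
  eq′ = trans (sym (double a c)) (trans eq (double b d))
  rem : c ≡ d
  rem = trans (sym (m<n⇒m%n≡m c<2)) (trans (sym ([m+kn]%n≡m%n c a 2))
          (trans (cong (_% 2) eq′) (trans ([m+kn]%n≡m%n d b 2) (m<n⇒m%n≡m d<2))))
  quot : a ≡ b
  quot = *-cancelʳ-≡ a b 2 (+-cancelˡ-≡ c (a * 2) (b * 2) (trans eq′ (cong (_+ b * 2) (sym rem))))

InjectiveOn : ∀ {A : Set} → (A → ℕ) → List A → Set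
InjectiveOn h xs = ∀ {x y} → x ∈ˡ xs → y ∈ˡ xs → h x ≡ h y → x ≡ y

hash-cong : ∀ {P P′} m v → (∀ {t} → t < m → P t ≡ P′ t) → hash P m v ≡ hash P′ m v
hash-cong zero    v eq = refl
hash-cong (suc m) v eq =
  cong₂ (λ h p → h + h + digit 2 v p) (hash-cong m v (eq ∘ m<n⇒m<1+n)) (eq ≤-refl)

-- Further places cannot merge what earlier ones separate. Hence a list of fewer than `r` stops may
-- still be hashed with `r` places.
hash-mono : ∀ {P m m′ xs} → m ≤′ m′ → InjectiveOn (hash P m) xs → InjectiveOn (hash P m′) xs
hash-mono ≤′-refl inj = inj
hash-mono {P} {xs = xs} (≤′-step {m′} le) inj x∈ y∈ eq = hash-mono {P} {xs = xs} le inj x∈ y∈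
  (proj₁ (double-injective {hash P m′ _} (digit< 2 _ (P m′)) (digit< 2 _ (P m′)) eq))

-- A new element collides with at most one old one, so each element costs
-- one further position.
separatingPositions : ∀ l xs → Unique xs → All (_< 2 ^ l) xs →
  ∃[ P ] (∀ t → P t < suc l) × InjectiveOn (hash P (length xs)) xs
-- `P` is total, so place 0 fills the positions that no element needs; it is below `suc l` even when
-- `l` is 0.
separatingPositions l [] [] [] = (λ _ → 0) , (λ _ → s≤s z≤n) , λ ()
separatingPositions l (x ∷ xs) (x∉xs ∷ unique) (x< ∷ xs<)
  with separatingPositions l xs unique xs<
... | P , P≤l , inj = P [ m ↦ p ] , below , injective
  where
  m = length xs
  collision : Dec (Any (λ y → hash P m x ≡ hash P m y) xs)
  collision = Any.any? (λ y → hash P m x ≟ hash P m y) xs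
  separator : ∃[ p ] p < suc l × (∀ {y} → y ∈ˡ xs → hash P m x ≡ hash P m y →
              digit 2 x p ≢ digit 2 y p)
  separator with collision
  ... | no  none = 0 , s≤s z≤n , λ y∈ eq → ⊥-elim (none (Any.map (λ { refl → eq }) y∈))
  ... | yes some =
    let z , z∈ , eq = find some
        p , p<l , differ = bitsSeparate l x< (All.lookup xs< z∈) (All.lookup x∉xs z∈)
    in p , m<n⇒m<1+n p<l , λ y∈ eq′ →
       subst (λ w → digit 2 x p ≢ digit 2 w p) (inj z∈ y∈ (trans (sym eq) eq′)) differ
  p = proj₁ separator
  below : ∀ t → (P [ m ↦ p ]) t < suc l
  below t with t ≡ᵇ m
  ... | true  = proj₁ (proj₂ separator)
  ... | false = P≤l t
  step : ∀ v → hash (P [ m ↦ p ]) (suc m) v ≡ hash P m v + hash P m v + digit 2 v p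
  step v = cong₂ (λ h q → h + h + digit 2 v q)
    (hash-cong m v λ t<m → update-other P p (<⇒≢ t<m)) (update-same P m p)
  split : ∀ {v w} → hash (P [ m ↦ p ]) (suc m) v ≡ hash (P [ m ↦ p ]) (suc m) w →
          hash P m v ≡ hash P m w × digit 2 v p ≡ digit 2 w p
  split {v} {w} eq = double-injective (digit< 2 v p) (digit< 2 w p)
    (trans (sym (step v)) (trans eq (step w)))
  injective : InjectiveOn (hash (P [ m ↦ p ]) (suc m)) (x ∷ xs)
  injective (here refl) (here refl) eq = refl
  injective (there v∈)  (there w∈)  eq = inj v∈ w∈ (proj₁ (split eq))
  injective (here refl) (there w∈)  eq =
    ⊥-elim (proj₂ (proj₂ separator) w∈ (proj₁ (split eq)) (proj₂ (split eq)))
  injective (there v∈)  (here refl) eq =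
    ⊥-elim (proj₂ (proj₂ separator) v∈ (proj₁ (split (sym eq))) (proj₂ (split (sym eq))))

-- The relabelling that turns hash values into colours; a value that no element has is sent to
-- `length xs`, a colour beyond all layers.
position : ∀ {A : Set} → (A → ℕ) → List A → ℕ → ℕ
position h []       t = 0
position h (x ∷ xs) t with h x ≟ t
... | yes _ = 0
... | no  _ = suc (position h xs t)

position≤ : ∀ {A : Set} (h : A → ℕ) xs t → position h xs t ≤ length xs
position≤ h []       t = z≤n
position≤ h (x ∷ xs) t with h x ≟ t
... | yes _ = z≤n
... | no  _ = s≤s (position≤ h xs t)

data Ranked {A : Set} (c : A → ℕ) : ℕ → List A → Set where
  []  : ∀ {i} → Ranked c i []
  _∷_ : ∀ {i x xs} → c x ≡ i → Ranked c (suc i) xs → Ranked c i (x ∷ xs)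

position-ranked : ∀ {A : Set} {h : A → ℕ} {c} xs i → Unique xs → InjectiveOn h xs →
                  (∀ {x} → x ∈ˡ xs → c x ≡ i + position h xs (h x)) → Ranked c i xs
position-ranked [] i [] inj eq = []
position-ranked {h = h} {c} (x ∷ xs) i (x∉xs ∷ unique) inj eq =
  first ∷ position-ranked xs (suc i) unique (λ v∈ w∈ → inj (there v∈) (there w∈)) rest
  where
  first : c x ≡ i
  first with h x ≟ h x | eq (here refl)
  ... | yes _ | cx≡ = trans cx≡ (+-identityʳ i)
  ... | no  ≢ | _   = ⊥-elim (≢ refl)
  rest : ∀ {y} → y ∈ˡ xs → c y ≡ suc i + position h xs (h y)
  rest {y} y∈ with h x ≟ h y | eq (there y∈)
  ... | yes hx≡hy | _   = ⊥-elim (All.lookup x∉xs y∈ (inj (here refl) (there y∈) hx≡hy))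
  ... | no  _     | cy≡ = trans cy≡ (+-suc i _)

-- Powers against exponentials

n<2^n : ∀ n → n < 2 ^ n
n<2^n zero    = s≤s z≤n
n<2^n (suc n) = subst (_≤ 2 ^ suc n) (+-comm (suc n) 1)
  (+-mono-≤ (n<2^n n) (≤-trans (m^n>0 2 n) (m≤m+n (2 ^ n) 0)))

^-distribʳ-* : ∀ m n o → (m * n) ^ o ≡ m ^ o * n ^ o
^-distribʳ-* m n zero    = refl
^-distribʳ-* m n (suc o) =
  trans (cong (m * n *_) (^-distribʳ-* m n o)) ([m*n]*[o*p]≡[m*o]*[n*p] m n (m ^ o) (n ^ o))

-- Write x as at most L (q + 1) with q = x / L, and use q + 1 ≤ 2 ^ q.
power-bound : ∀ x L .{{_ : NonZero L}} → x ^ L ≤ L ^ L * 2 ^ x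
power-bound x L = begin
  x ^ L                   ≤⟨ ^-monoˡ-≤ L x≤ ⟩
  (L * 2 ^ q) ^ L         ≡⟨ ^-distribʳ-* L (2 ^ q) L ⟩
  L ^ L * (2 ^ q) ^ L     ≡⟨ cong (L ^ L *_) (^-*-assoc 2 q L) ⟩
  L ^ L * 2 ^ (q * L)     ≤⟨ *-monoʳ-≤ (L ^ L) (^-monoʳ-≤ 2 (m/n*n≤m x L)) ⟩
  L ^ L * 2 ^ x           ∎
  where
  open ≤-Reasoning
  q = x / L
  x≤ : x ≤ L * 2 ^ q
  x≤ = begin
    x                 ≡⟨ m≡m%n+[m/n]*n x L ⟩
    x % L + q * L     ≤⟨ +-monoˡ-≤ (q * L) (<⇒≤ (m%n<n x L)) ⟩
    suc q * L         ≤⟨ *-monoˡ-≤ L (n<2^n q) ⟩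
    2 ^ q * L         ≡⟨ *-comm (2 ^ q) L ⟩
    L * 2 ^ q         ∎

-- Counting

pigeonhole : ∀ {A : Set} {xs ys : List A} → Unique xs → (∀ {x} → x ∈ˡ xs → x ∈ˡ ys) →
             length xs ≤ length ys
pigeonhole {xs = []} [] incl = z≤n
pigeonhole {A} {xs = x ∷ xs} (x∉xs ∷ unique) incl with ∈-∃++ (incl (here refl))
... | ys , zs , refl = begin
  suc (length xs)               ≤⟨ s≤s (pigeonhole unique incl′) ⟩
  suc (length (ys ++ zs))       ≡⟨ cong suc (length-++ ys) ⟩
  suc (length ys + length zs)   ≡⟨ +-suc (length ys) (length zs) ⟨
  length ys + suc (length zs)   ≡⟨ length-++ ys ⟨
  length (ys ++ x ∷ zs)         ∎
  where
  open ≤-Reasoning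
  incl′ : ∀ {y} → y ∈ˡ xs → y ∈ˡ ys ++ zs
  incl′ y∈ with ∈-++⁻ ys (incl (there y∈))
  ... | inj₁ y∈ys            = ∈-++⁺ˡ y∈ys
  ... | inj₂ (here refl)     = ⊥-elim (All.lookup x∉xs y∈ refl)
  ... | inj₂ (there y∈zs)    = ∈-++⁺ʳ ys y∈zs

-- Plans: the tours of positive weight, reduced to their new stops

data Layered {A : Set} (L : ℕ → A → Set) : ℕ → List A → ℕ → Set where
  []  : ∀ {i} → Layered L i [] i
  _∷_ : ∀ {i j x xs} → L i x → Layered L (suc i) xs j → Layered L i (x ∷ xs) j

module _ {A : Set} {L : ℕ → A → Set} where

  layered-++ : ∀ {i j m xs ys} → Layered L i xs j → Layered L j ys m → Layered L i (xs ++ ys) m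
  layered-++ []       q = q
  layered-++ (l ∷ ls) q = l ∷ layered-++ ls q

  layered-split : ∀ {i m} xs {ys} → Layered L i (xs ++ ys) m →
                  ∃[ j ] Layered L i xs j × Layered L j ys m
  layered-split []       ls       = _ , [] , ls
  layered-split (x ∷ xs) (l ∷ ls) = let j , p , q = layered-split xs ls in j , l ∷ p , q

  layered-length : ∀ {i j xs} → Layered L i xs j → i + length xs ≡ j
  layered-length {i} []       = +-identityʳ i
  layered-length {i} (l ∷ ls) = trans (+-suc i _) (layered-length ls)

  layered-≤ : ∀ {i j xs} → Layered L i xs j → i ≤ j
  layered-≤ {i} ls = subst (i ≤_) (layered-length ls) (m≤m+n i _)

  layered-find : ∀ {i j xs t} → Layered L i xs j → i ≤ t → t < j → ∃[ x ] x ∈ˡ xs × L t x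
  layered-find []           i≤t t<i = ⊥-elim (<⇒≱ t<i i≤t)
  layered-find {i} {t = t} (l ∷ ls) i≤t t<j with i ≟ t
  ... | yes refl = _ , here refl , l
  ... | no  i≢t  = let x , x∈ , lx = layered-find ls (≤∧≢⇒< i≤t i≢t) t<j
                   in x , there x∈ , lx

  layered-all : ∀ {i j xs x} → Layered L i xs j → x ∈ˡ xs → ∃[ t ] i ≤ t × t < j × L t x
  layered-all (l ∷ ls) (here refl) = _ , ≤-refl , layered-≤ ls , l
  layered-all (l ∷ ls) (there x∈)  =
    let t , i<t , t<j , lx = layered-all ls x∈ in t , <⇒≤ i<t , t<j , lx

  -- The colour of an element tells its layer, and the list takes each layer only once.
  layered-unique : ∀ {c : A → ℕ} {i j xs} → (∀ {t x} → L t x → c x ≡ t) →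
                   Layered L i xs j → Unique xs
  layered-unique c≡ []       = []
  layered-unique c≡ (l ∷ ls) = All.tabulate (λ { y∈ refl →
      let t , i<t , _ , ly = layered-all ls y∈
      in <-irrefl (trans (sym (c≡ l)) (c≡ ly)) i<t }) ∷ layered-unique c≡ ls

ranked-≥ : ∀ {A : Set} {c : A → ℕ} {i xs x} → Ranked c i xs → x ∈ˡ xs → i ≤ c x
ranked-≥ (eq ∷ rs) (here refl) = ≤-reflexive (sym eq)
ranked-≥ (eq ∷ rs) (there x∈)  = <⇒≤ (ranked-≥ rs x∈)

ranked-< : ∀ {A : Set} {c : A → ℕ} {i xs x} → Ranked c i xs → x ∈ˡ xs → c x < i + length xs
ranked-< {i = i} {_ ∷ xs} (eq ∷ rs) (here refl) =
  subst₂ _≤_ (cong suc (sym eq)) (sym (+-suc i (length xs))) (s≤s (m≤m+n i _))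
ranked-< {c = c} {i} {_ ∷ xs} {x} (eq ∷ rs) (there x∈) =
  subst (c x <_) (sym (+-suc i (length xs))) (ranked-< rs x∈)

ranked-injective : ∀ {A : Set} {c : A → ℕ} {i xs} → Ranked c i xs → InjectiveOn c xs
ranked-injective (eq ∷ rs) (here refl) (here refl) _ = refl
ranked-injective (eq ∷ rs) (there x∈)  (there y∈)  p = ranked-injective rs x∈ y∈ p
ranked-injective (eq ∷ rs) (here refl) (there y∈)  p =
  ⊥-elim (<-irrefl (trans (sym eq) p) (ranked-≥ rs y∈))
ranked-injective (eq ∷ rs) (there x∈)  (here refl) p =
  ⊥-elim (<-irrefl (trans (sym eq) (sym p)) (ranked-≥ rs x∈))

-- `Dep` are the depots, `K` the vertices allowed as stops, `N` those that must be stops, and `M` is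
-- meant as the number of vertices in `K`.
module Plans {n : ℕ} (r g k : ℕ) (D : Fin n → Fin n → ℕ)
             (Dep K N : Fin n → Set) (M : ℕ) where

  len : Fin n → List (Fin n) → Fin n → ℕ
  len s []       t = D s t
  len s (x ∷ xs) t = D s x + len x xs t

  len-++ : ∀ s xs u ys t → len s (xs ++ u ∷ ys) t ≡ len s xs u + len u ys t
  len-++ s []       u ys t = refl
  len-++ s (x ∷ xs) u ys t =
    trans (cong (D s x +_) (len-++ x xs u ys t)) (sym (+-assoc (D s x) _ _))

  record Block : Set where
    field
      home     : Fin n
      home∈Dep : Dep home
      stops    : List (Fin n)
      stops≢[] : stops ≢ []

    price : ℕ
    price = len home stops home

    field price≤g : price ≤ g

  open Block public

  layers : List Block → List (Fin n)
  layers bs = concat (map stops bs)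

  -- `fits` asks for `length blocks + (M - length (layers blocks)) ≤ k` without truncated
  -- subtraction: one vehicle per block and one for each vertex counted by `M` that is not a stop.
  record Plan : Set where
    field
      blocks  : List Block
      unique  : Unique (layers blocks)
      inK     : ∀ {v} → v ∈ˡ layers blocks → K v
      covers  : ∀ {v} → N v → v ∈ˡ layers blocks
      cheap   : total (map price blocks) ≤ r
      fits    : M + length blocks ≤ k + length (layers blocks)

  -- κ i ≢ 0 means that a tour returns to its depot after the i-th stop.
  module _ (q : ℕ) (col : Fin n → ℕ) (κ : ℕ → ℕ) where

    -- The i-th stop is taken from layer i.  By the last condition no other remote
    -- vertex has its colour, so the colours of the remote vertices show that all
    -- of them are visited.
    Layer : ℕ → Fin n → Set
    Layer i u = K u × col u ≡ i × (∀ u′ → N u′ → col u′ ≡ i → u′ ≡ u)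

    -- For an open tour from s, cur i s v is the least length up to v before the
    -- i-th stop, nxt i s v the least length with this stop, and best i the cost of
    -- closing it there; tot and cnt are the weight and number of the closed tours.
    record Run : Set where
      field
        cur nxt      : ℕ → Fin n → Fin n → ℕ
        best tot cnt : ℕ → ℕ
        cur-zero     : ∀ {s v} → cur 0 s v ≡ D s v
        -- Entries above `r` stand for infinity and need not come from a stop.
        nxt-sound    : ∀ {i s v} → i < q → nxt i s v ≤ r →
                       ∃[ u ] Layer i u × cur i s u + D u v ≤ nxt i s v
        nxt-complete : ∀ {i s u v} → i < q → Layer i u → nxt i s v ≤ cur i s u + D u v
        cur-reset    : ∀ {i s v} → i < q → κ i ≢ 0 → cur (suc i) s v ≡ D s v
        cur-continue : ∀ {i s v} → i < q → κ i ≡ 0 → cur (suc i) s v ≡ nxt i s v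
        best-sound   : ∀ {i} → i < q → best i ≤ r → ∃[ s ] Dep s × nxt i s s ≤ best i
        best-complete : ∀ {i s} → i < q → Dep s → best i ≤ nxt i s s
        tot-zero     : tot 0 ≡ 0
        tot-≤        : ∀ {i} → i < q → tot i ≤ tot (suc i)
        tot-closed   : ∀ {i} → i < q → κ i ≢ 0 → best i ≤ g → tot (suc i) ≡ tot i + best i
        -- A tour beyond the capacity is charged more than `r`; totals never decrease, so such an
        -- attempt cannot be accepted.
        tot-exceeded : ∀ {i} → i < q → κ i ≢ 0 → g < best i → r < tot (suc i)
        tot-open     : ∀ {i} → i < q → κ i ≡ 0 → tot (suc i) ≡ tot i
        cnt-zero     : cnt 0 ≡ 0
        cnt-closed   : ∀ {i} → i < q → κ i ≢ 0 → cnt (suc i) ≡ suc (cnt i)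
        cnt-open     : ∀ {i} → i < q → κ i ≡ 0 → cnt (suc i) ≡ cnt i

    -- `covers` asks only for colours below `q`: the layer of such a colour has a stop, and `Layer`
    -- forces a remote vertex of that colour to be this stop. `closed` makes sure that no tour is
    -- left open after the last stop.
    record Accepts (run : Run) : Set where
      open Run run
      field
        cheap  : tot q ≤ r
        fits   : M + cnt q ≤ k + q
        covers : ∀ u → N u → col u < q
        closed : q ≢ 0 → κ (q ∸ 1) ≢ 0

  -- The blocks use the layers below `done`, the open tour those from `done` up to but excluding
  -- `i`. Its depot is chosen only when it closes, so `current` recovers the stops for every start
  -- and end.
  record Partial {q col κ} (run : Run q col κ) (i : ℕ) : Set where
    open Run run
    field
      blocks   : List Block
      done     : ℕ
      layered  : Layered (Layer q col κ) 0 (layers blocks) done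
      price≤   : total (map price blocks) ≤ tot i
      count    : length blocks ≡ cnt i
      current  : ∀ {s v} → cur i s v ≤ r →
                 ∃[ xs ] Layered (Layer q col κ) done xs i × len s xs v ≤ cur i s v
      finished : (i ≢ 0 → κ (i ∸ 1) ≢ 0) → done ≡ i

  partialPlan : ∀ {q col κ} (run : Run q col κ) i → i ≤ q → Run.tot run i ≤ r → Partial run i
  partialPlan run zero i≤q tot≤r = record
    { blocks = [] ; done = 0 ; layered = [] ; price≤ = z≤n ; count = sym (Run.cnt-zero run)
    ; current = λ _ → [] , [] , ≤-reflexive (sym (Run.cur-zero run)) ; finished = λ _ → refl }
  partialPlan {q} {col} {κ} run (suc i) i<q tot≤r
    with partialPlan run i (<⇒≤ i<q) (≤-trans (Run.tot-≤ run i<q) tot≤r) | κ i ≟ 0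
  ... | P | yes κi≡0 = record
    { blocks = blocks ; done = done ; layered = layered
    ; price≤ = subst (total (map price blocks) ≤_) (sym (tot-open i<q κi≡0)) price≤
    ; count = trans count (sym (cnt-open i<q κi≡0))
    ; current = λ {s} {v} cur≤ →
        let xs , ls , len≤ = extend (subst (_≤ r) (cur-continue i<q κi≡0) cur≤)
        in xs , ls , subst (len s xs v ≤_) (sym (cur-continue i<q κi≡0)) len≤
    ; finished = λ κ≢0 → ⊥-elim (κ≢0 (λ ()) κi≡0) }
    where
    open Run run
    open Partial P
    extend : ∀ {s v} → nxt i s v ≤ r →
             ∃[ xs ] Layered (Layer q col κ) done xs (suc i) × len s xs v ≤ nxt i s v
    extend {s} {v} nxt≤r =
      let u , lu , le = nxt-sound i<q nxt≤r
          xs , ls , len≤ = current (≤-trans (m≤m+n _ (D u v)) (≤-trans le nxt≤r))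
      in xs ++ u ∷ [] , layered-++ ls (lu ∷ []) ,
         ≤-trans (≤-reflexive (len-++ s xs u [] v)) (≤-trans (+-monoˡ-≤ (D u v) len≤) le)
  ... | P | no κi≢0 = record
    { blocks = blocks ++ new ∷ [] ; done = suc i
    ; layered = subst (λ xs → Layered (Layer q col κ) 0 xs (suc i))
        (trans (cong (layers blocks ++_) (sym (++-identityʳ (stops new))))
          (trans (concat-++ (map stops blocks) (stops new ∷ []))
            (cong concat (sym (map-++ stops blocks (new ∷ []))))))
        (layered-++ layered (proj₁ (proj₂ (proj₂ tour))))
    ; price≤ = begin
        total (map price (blocks ++ new ∷ []))      ≡⟨ cong total (map-++ price blocks (new ∷ [])) ⟩
        total (map price blocks ++ price new ∷ [])  ≡⟨ total-++ (map price blocks) _ ⟩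
        total (map price blocks) + (price new + 0)
          ≤⟨ +-mono-≤ price≤ (≤-trans (≤-reflexive (+-identityʳ _)) price≤best) ⟩
        tot i + best i                              ≡⟨ tot≡ ⟨
        tot (suc i)                                 ∎
    ; count = trans (length-++ blocks) (trans (+-comm (length blocks) 1)
                (trans (cong suc count) (sym (cnt-closed i<q κi≢0))))
    ; current = λ _ → [] , [] , ≤-reflexive (sym (cur-reset i<q κi≢0))
    ; finished = λ _ → refl }
    where
    open Run run
    open Partial P
    open ≤-Reasoning
    best≤g : best i ≤ g
    best≤g = ≮⇒≥ λ g<best → <⇒≱ (tot-exceeded i<q κi≢0 g<best) tot≤r
    tot≡ : tot (suc i) ≡ tot i + best i
    tot≡ = tot-closed i<q κi≢0 best≤g
    best≤r : best i ≤ r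
    best≤r = ≤-trans (m≤n+m (best i) (tot i)) (subst (_≤ r) tot≡ tot≤r)
    tour : ∃[ s ] Σ[ xs ∈ List (Fin n) ] Layered (Layer q col κ) done xs (suc i) ×
           xs ≢ [] × Dep s × len s xs s ≤ best i
    tour =
      let s , dep , nxt≤  = best-sound i<q best≤r
          u , lu , le     = nxt-sound i<q (≤-trans nxt≤ best≤r)
          xs , ls , len≤  = current (≤-trans (m≤m+n _ (D u s)) (≤-trans le (≤-trans nxt≤ best≤r)))
      in s , xs ++ u ∷ [] , layered-++ ls (lu ∷ []) , nonempty xs , dep ,
         ≤-trans (≤-reflexive (len-++ s xs u [] s))
           (≤-trans (+-monoˡ-≤ (D u s) len≤) (≤-trans le nxt≤))
      where
      nonempty : ∀ xs {u : Fin n} → xs ++ u ∷ [] ≢ []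
      nonempty []       ()
      nonempty (x ∷ xs) ()
    price≤best : len (proj₁ tour) (proj₁ (proj₂ tour)) (proj₁ tour) ≤ best i
    price≤best = let _ , _ , _ , _ , _ , le = tour in le
    new : Block
    new = let s , xs , _ , xs≢[] , dep , le = tour in record
      { home = s ; home∈Dep = dep ; stops = xs ; stops≢[] = xs≢[] ; price≤g = ≤-trans le best≤g }

  accepted⇒plan : ∀ {q col κ} (run : Run q col κ) → Accepts q col κ run → Plan
  accepted⇒plan {q} {col} {κ} run acc = record
    { blocks = blocks
    ; unique = layered-unique (λ (_ , c≡ , _) → c≡) all
    ; inK    = λ v∈ → let _ , _ , _ , kv , _ = layered-all all v∈ in kv
    ; covers = λ {v} nv →
        let x , x∈ , _ , _ , only = layered-find all z≤n (Accepts.covers acc v nv)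
        in subst (_∈ˡ layers blocks) (sym (only v nv refl)) x∈
    ; cheap  = ≤-trans price≤ (Accepts.cheap acc)
    ; fits   = subst₂ (λ c m → M + c ≤ k + m) (sym count) (sym (layered-length all))
                 (Accepts.fits acc) }
    where
    open Partial (partialPlan run q ≤-refl (Accepts.cheap acc))
    all : Layered (Layer q col κ) 0 (layers blocks) q
    all = subst (Layered _ 0 (layers blocks)) (finished (Accepts.closed acc)) layered

  data Closing (κ : ℕ → ℕ) : ℕ → List (Fin n) → Set where
    last : ∀ {i x} → κ i ≢ 0 → Closing κ i (x ∷ [])
    more : ∀ {i x y xs} → κ i ≡ 0 → Closing κ (suc i) (y ∷ xs) → Closing κ i (x ∷ y ∷ xs)

  data Closings (κ : ℕ → ℕ) : ℕ → List Block → Set where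
    []  : ∀ {i} → Closings κ i []
    _∷_ : ∀ {i b bs} → Closing κ i (stops b) → Closings κ (i + length (stops b)) bs →
          Closings κ i (b ∷ bs)

  -- `c` bounds the way from the depot to `y`, so `c + len y ys s` bounds the whole tour. In each
  -- layer the tour's own stop is among the candidates, so the tables are never more expensive.
  runStops : ∀ {q col κ} (run : Run q col κ) {s c} i y ys {j} →
             Dep s → Closing κ i (y ∷ ys) → Layered (Layer q col κ) i (y ∷ ys) j → j ≤ q →
             Run.cur run i s y ≤ c → c + len y ys s ≤ g →
             Run.tot run j ≤ Run.tot run i + (c + len y ys s) × Run.cnt run j ≡ suc (Run.cnt run i) ×
             (∀ {s v} → Run.cur run j s v ≡ D s v) × κ (j ∸ 1) ≢ 0
  runStops run {s} {c} i y [] dep (last κi≢0) (l ∷ []) i<q cur≤ c≤g =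
    subst (_≤ tot i + (c + D y s)) (sym (tot-closed i<q κi≢0 (≤-trans best≤ c≤g))) (+-monoʳ-≤ (tot i) best≤) ,
    cnt-closed i<q κi≢0 , cur-reset i<q κi≢0 , κi≢0
    where
    open Run run
    best≤ : best i ≤ c + D y s
    best≤ = ≤-trans (best-complete i<q dep)
              (≤-trans (nxt-complete i<q l) (+-monoˡ-≤ (D y s) cur≤))
  runStops run {s} {c} i y (y′ ∷ ys) {j} dep (more κi≡0 cl) (l ∷ ls) j≤q cur≤ c≤g =
    let tot≤ , cnt≡ , reset , closed = runStops run (suc i) y′ ys dep cl ls j≤q
          (≤-trans (≤-reflexive (cur-continue i<q κi≡0))
            (≤-trans (nxt-complete i<q l) (+-monoˡ-≤ (D y y′) cur≤)))
          (subst (_≤ g) (sym assoc) c≤g)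
    in subst₂ (λ a b → tot j ≤ a + b) (tot-open i<q κi≡0) assoc tot≤ ,
       trans cnt≡ (cong suc (cnt-open i<q κi≡0)) , reset , closed
    where
    open Run run
    i<q = ≤-trans (layered-≤ ls) j≤q
    assoc : c + D y y′ + len y′ ys s ≡ c + (D y y′ + len y′ ys s)
    assoc = +-assoc c (D y y′) _

  runBlocks : ∀ {q col κ} (run : Run q col κ) i bs {j} →
              Closings κ i bs → Layered (Layer q col κ) i (layers bs) j → j ≤ q →
              (∀ {s v} → Run.cur run i s v ≡ D s v) → (i ≢ 0 → κ (i ∸ 1) ≢ 0) →
              Run.tot run j ≤ Run.tot run i + total (map price bs) × Run.cnt run j ≡ Run.cnt run i + length bs ×
              (j ≢ 0 → κ (j ∸ 1) ≢ 0)
  runBlocks run i [] [] [] j≤q cur≡ closed =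
    m≤m+n _ 0 , sym (+-identityʳ _) , closed
  runBlocks {q} {col} {κ} run i (b ∷ bs) {j} (cl ∷ cls) ls j≤q cur≡ closed
    with layered-split (stops b) ls
  ... | m , ls₁ , ls₂ =
    let tot≤ , cnt≡ , reset , closed′ = block (stops b) (stops≢[] b) cl ls₁ (price≤g b)
        tot≤′ , cnt≡′ , closed″ = runBlocks run m bs
          (subst (λ i → Closings κ i bs) (layered-length ls₁) cls) ls₂ j≤q reset (λ _ → closed′)
    in ≤-trans tot≤′ (≤-trans (+-monoˡ-≤ _ tot≤) (≤-reflexive (+-assoc (tot i) (price b) _))) ,
       trans cnt≡′ (trans (cong (_+ length bs) cnt≡) (sym (+-suc (cnt i) (length bs)))) , closed″
    where
    open Run run
    block : ∀ xs → xs ≢ [] → Closing κ i xs → Layered (Layer q col κ) i xs m →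
            len (home b) xs (home b) ≤ g →
            tot m ≤ tot i + len (home b) xs (home b) × cnt m ≡ suc (cnt i) ×
            (∀ {s v} → cur m s v ≡ D s v) × κ (m ∸ 1) ≢ 0
    block []       ≢[] _  _  _  = ⊥-elim (≢[] refl)
    block (y ∷ ys) _   cl ls le =
      runStops run i y ys (home∈Dep b) cl ls (≤-trans (layered-≤ ls₂) j≤q) (≤-reflexive cur≡) le

  -- Any run for these colours and marks will do. A stop of the plan lies in its layer because all
  -- remote vertices are stops and the stops have distinct colours.
  plan⇒accepted : (P : Plan) → ∀ {q col κ} → q ≡ length (layers (Plan.blocks P)) →
                  Ranked col 0 (layers (Plan.blocks P)) → Closings κ 0 (Plan.blocks P) →
                  (run : Run q col κ) → Accepts q col κ run
  plan⇒accepted P {col = col} {κ} refl ranked closings run = record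
    { cheap  = ≤-trans tot≤ (≤-trans (≤-reflexive (cong (_+ total (map price blocks)) tot-zero)) cheap)
    ; fits   = subst (λ c → M + c ≤ k + q) (sym (trans cnt≡ (cong (_+ length blocks) cnt-zero))) fits
    ; covers = λ u nu → ranked-< ranked (covers nu)
    ; closed = closed }
    where
    open Plan P
    open Run run
    q = length (layers blocks)
    layer : ∀ {v} → v ∈ˡ layers blocks → ∀ {i} → col v ≡ i → Layer q col κ i v
    layer v∈ refl = inK v∈ , refl , λ u nu eq → ranked-injective ranked (covers nu) v∈ eq
    layered : ∀ {i} xs → (∀ {v} → v ∈ˡ xs → v ∈ˡ layers blocks) → Ranked col i xs →
              Layered (Layer q col κ) i xs (i + length xs)
    layered {i} []       incl []        = subst (Layered _ i []) (sym (+-identityʳ i)) []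
    layered {i} (x ∷ xs) incl (eq ∷ rs) = layer (incl (here refl)) eq ∷
      subst (Layered _ (suc i) xs) (sym (+-suc i (length xs))) (layered xs (incl ∘ there) rs)
    outcome = runBlocks run 0 blocks closings (layered (layers blocks) id ranked) ≤-refl
               cur-zero (λ ≢0 → ⊥-elim (≢0 refl))
    tot≤   = proj₁ outcome
    cnt≡   = proj₁ (proj₂ outcome)
    closed = proj₂ (proj₂ outcome)

  closeFlags : List (Fin n) → List ℕ
  closeFlags []           = []
  closeFlags (x ∷ [])     = 1 ∷ []
  closeFlags (x ∷ y ∷ xs) = 0 ∷ closeFlags (y ∷ xs)

  nth : List ℕ → ℕ → ℕ
  nth []       i       = 0
  nth (x ∷ xs) zero    = x
  nth (x ∷ xs) (suc i) = nth xs i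

  flags : List Block → ℕ → ℕ
  flags bs = nth (concat (map (closeFlags ∘ stops) bs))

  flags≤1 : ∀ bs i → flags bs i ≤ 1
  flags≤1 bs = nth≤1 (blocks bs)
    where
    nth≤1 : ∀ {xs} → All (_≤ 1) xs → ∀ i → nth xs i ≤ 1
    nth≤1 []       i       = z≤n
    nth≤1 (p ∷ ps) zero    = p
    nth≤1 (p ∷ ps) (suc i) = nth≤1 ps i
    stop : ∀ xs {fs} → All (_≤ 1) fs → All (_≤ 1) (closeFlags xs ++ fs)
    stop []           ps = ps
    stop (x ∷ [])     ps = ≤-refl ∷ ps
    stop (x ∷ y ∷ xs) ps = z≤n ∷ stop (y ∷ xs) ps
    blocks : ∀ bs → All (_≤ 1) (concat (map (closeFlags ∘ stops) bs))
    blocks []       = []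
    blocks (b ∷ bs) = stop (stops b) (blocks bs)

  flags-closing : ∀ bs {κ} → (∀ {i} → i < length (layers bs) → κ i ≡ flags bs i) →
                  Closings κ 0 bs
  flags-closing bs {κ} eq = blocks bs 0 eq
    where
    stop : ∀ xs fs i m → xs ≢ [] →
           (∀ {j} → j < length xs + m → κ (i + j) ≡ nth (closeFlags xs ++ fs) j) →
           Closing κ i xs × (∀ {j} → j < m → κ (i + length xs + j) ≡ nth fs j)
    stop [] fs i m ≢[] eq = ⊥-elim (≢[] refl)
    stop (x ∷ []) fs i m _ eq =
      last (λ κi≡0 → 1+n≢0 (trans (sym (eq (s≤s z≤n))) (trans (cong κ (+-identityʳ i)) κi≡0))) ,
      λ {j} j<m → trans (cong κ (+-assoc i 1 j)) (eq (s≤s j<m))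
    stop (x ∷ y ∷ xs) fs i m _ eq =
      let cl , rest = stop (y ∷ xs) fs (suc i) m (λ ()) λ {j} j< →
            trans (cong κ (sym (+-suc i j))) (eq (s≤s j<))
      in more (trans (cong κ (sym (+-identityʳ i))) (eq (s≤s z≤n))) cl ,
         λ {j} j<m → trans (cong (λ a → κ (a + j)) (+-suc i (suc (length xs)))) (rest j<m)
    blocks : ∀ bs i → (∀ {j} → j < length (layers bs) → κ (i + j) ≡ flags bs j) → Closings κ i bs
    blocks []       i eq = []
    blocks (b ∷ bs) i eq =
      let cl , rest = stop (stops b) (concat (map (closeFlags ∘ stops) bs)) i (length (layers bs))
                        (stops≢[] b) (λ j< → eq (subst (_ <_) (sym (length-++ (stops b))) j<))
      in cl ∷ blocks bs (i + length (stops b)) rest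

-- Routings and plans

sum-tabulate : ∀ {m} (f : Fin m → ℕ) → total (tabulate f) ≡ sum +-0-commutativeMonoid f
sum-tabulate {zero}  f = refl
sum-tabulate {suc m} f = cong (f zero +_) (sum-tabulate (f ∘ suc))

sum-lookup : ∀ {A : Set} (f : A → ℕ) xs →
             sum +-0-commutativeMonoid (f ∘ Listᵇ.lookup xs) ≡ total (map f xs)
sum-lookup f []       = refl
sum-lookup f (x ∷ xs) = cong (f x +_) (sum-lookup f xs)

deduplicate-⊆ : ∀ {m} (xs : List (Fin m)) → deduplicate Fin._≟_ xs ⊆ xs
deduplicate-⊆ []       = []
deduplicate-⊆ (x ∷ xs) = refl ∷ ⊆-trans (filter-⊆ _ _) (deduplicate-⊆ xs)

weight-◅◅ : ∀ {m} (G : Graph m) {u v w} (p : Graph.Walk G u v) (q : Graph.Walk G v w) →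
            Graph.weight G (p ◅◅ q) ≡ Graph.weight G p + Graph.weight G q
weight-◅◅ G ε             q = refl
weight-◅◅ G ((x , _) ◅ p) q =
  trans (cong (x +_) (weight-◅◅ G p q)) (sym (+-assoc x _ _))

-- `D-walk` is limited to r: larger entries need not be realised.
record Distance (I : GasCVRP) (r : ℕ) : Set where
  open GasCVRP I
  field
    D      : Fin n → Fin n → ℕ
    D-refl : ∀ v → D v v ≡ 0
    D-tri  : ∀ u v w → D u w ≤ D u v + D v w
    D-sym  : ∀ u v → D u v ≡ D v u
    D-edge : ∀ {u v x} → edge u v ≡ just x → D u v ≤ x
    D-walk : ∀ {u v} → D u v ≤ r → ∃[ p ] weight {u} {v} p ≤ D u v

module Correspondence (I : GasCVRP) (r : ℕ) (dist : Distance I r) where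
  open GasCVRP I
  open Distance dist

  -- Clients at distance 0 from each other are served together; the least
  -- of them represents the others.
  Representative : Fin n → Set
  Representative v =
    v ∈ clients × (∀ u → toℕ u < toℕ v → u ∈ clients → D u v ≢ 0)

  Remote : Fin n → Set
  Remote v = Representative v × (∀ s → s ∈ depots → D s v ≢ 0)

  representative? : ∀ v → Dec (Representative v)
  representative? v = (v ∈? clients) ×-dec
    all? (λ u → (toℕ u <? toℕ v) →-dec ((u ∈? clients) →-dec ¬? (D u v ≟ 0)))

  representatives : List (Fin n)
  representatives = filter representative? (allFin n)

  open Plans r gas vehicles D (_∈ depots) Representative Remote (length representatives) public

  D-≡0 : ∀ {u v w} → D u v ≡ 0 → D v w ≡ 0 → D u w ≡ 0
  D-≡0 {u} {v} {w} uv vw = n≤0⇒n≡0 (subst₂ (λ a b → D u w ≤ a + b) uv vw (D-tri u v w))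

  -- Moving to an earlier client at distance 0 as long as there is one terminates, and distance 0 is
  -- transitive.
  representative-of : ∀ c → c ∈ clients → ∃[ v ] Representative v × D v c ≡ 0
  representative-of c = <-rec
    (λ m → ∀ c → toℕ c ≡ m → c ∈ clients → ∃[ v ] Representative v × D v c ≡ 0) step (toℕ c) c refl
    where
    step : ∀ m → (∀ {m′} → m′ < m → ∀ c → toℕ c ≡ m′ → c ∈ clients →
                    ∃[ v ] Representative v × D v c ≡ 0) →
           ∀ c → toℕ c ≡ m → c ∈ clients → ∃[ v ] Representative v × D v c ≡ 0
    step _ ih c refl c∈C
      with any? (λ u → (toℕ u <? toℕ c) ×-dec ((u ∈? clients) ×-dec (D u c ≟ 0)))
    ... | yes (u , u<c , u∈C , uc) =
      let v , rep , vu = ih u<c u refl u∈C in v , rep , D-≡0 vu uc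
    ... | no none =
      c , (c∈C , λ u u<c u∈C uc → none (u , u<c , u∈C , uc)) , D-refl c

  -- At distance 0 the one with the smaller index would keep the other from being the least of its
  -- class.
  separated : ∀ {x y} → Representative x → Representative y → x ≢ y → 1 ≤ D x y
  separated {x} {y} (x∈C , xmin) (y∈C , ymin) x≢y with <-cmp (toℕ x) (toℕ y)
  ... | tri< x<y _ _ = n≢0⇒n>0 (ymin x x<y x∈C)
  ... | tri≈ _ x≡y _ = ⊥-elim (x≢y (toℕ-injective x≡y))
  ... | tri> _ _ y<x = n≢0⇒n>0 (xmin y y<x y∈C ∘ trans (D-sym y x))

  -- From plans to routings

  ∈-last : ∀ {u v} (p : Walk u v) → v ∈ˡ vertices p
  ∈-last ε       = here refl
  ∈-last (_ ◅ p) = there (∈-last p)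

  ∈-◅◅ˡ : ∀ {u v w c} (p : Walk u v) (q : Walk v w) → c ∈ˡ vertices p → c ∈ˡ vertices (p ◅◅ q)
  ∈-◅◅ˡ ε       ε       c∈          = c∈
  ∈-◅◅ˡ ε       (_ ◅ q) (here refl) = here refl
  ∈-◅◅ˡ (_ ◅ p) q       (here refl) = here refl
  ∈-◅◅ˡ (_ ◅ p) q       (there c∈)  = there (∈-◅◅ˡ p q c∈)

  ∈-◅◅ʳ : ∀ {u v w c} (p : Walk u v) (q : Walk v w) → c ∈ˡ vertices q → c ∈ˡ vertices (p ◅◅ q)
  ∈-◅◅ʳ ε       q c∈ = c∈
  ∈-◅◅ʳ (_ ◅ p) q c∈ = there (∈-◅◅ʳ p q c∈)

  weight-≤ : ∀ {u v w a b} (p : Walk u v) (q : Walk v w) →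
             weight p ≤ a → weight q ≤ b → weight (p ◅◅ q) ≤ a + b
  weight-≤ p q p≤ q≤ = ≤-trans (≤-reflexive (weight-◅◅ graph p q)) (+-mono-≤ p≤ q≤)

  free-walk : ∀ {u v} → D u v ≡ 0 → ∃[ p ] weight {u} {v} p ≤ 0
  free-walk uv = let p , p≤ = D-walk (subst (_≤ r) (sym uv) z≤n) in p , subst (weight p ≤_) uv p≤

  -- Each listed vertex at distance 0 is visited by a free way out and back; a stop thereby serves
  -- its whole class.
  spin : ∀ v cs → Σ[ p ∈ Walk v v ] weight p ≤ 0 ×
         (∀ {c} → c ∈ˡ cs → D v c ≡ 0 → c ∈ˡ vertices p)
  spin v []       = ε , z≤n , λ ()
  spin v (c ∷ cs) with spin v cs | D v c ≟ 0
  ... | p , p≤ , visits | no vc≢0 = p , p≤ , λ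
    { (here refl) vc → ⊥-elim (vc≢0 vc) ; (there c∈) vc → visits c∈ vc }
  ... | p , p≤ , visits | yes vc≡0 =
    let out , out≤   = free-walk vc≡0
        back , back≤ = free-walk (trans (D-sym c v) vc≡0)
    in out ◅◅ (back ◅◅ p) , weight-≤ out (back ◅◅ p) out≤ (weight-≤ back p back≤ p≤) , λ
    { (here refl) _ → ∈-◅◅ˡ out (back ◅◅ p) (∈-last out)
    ; (there c∈) vc → ∈-◅◅ʳ out (back ◅◅ p) (∈-◅◅ʳ back p (visits c∈ vc)) }

  trip : ∀ s xs t → len s xs t ≤ r → Σ[ p ∈ Walk s t ] weight p ≤ len s xs t ×
         (∀ {x c} → x ∈ˡ xs → D x c ≡ 0 → c ∈ˡ vertices p)
  trip s []       t len≤r = let p , p≤ = D-walk len≤r in p , p≤ , λ ()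
  trip s (x ∷ xs) t len≤r =
    let p , p≤           = D-walk (m+n≤o⇒m≤o (D s x) len≤r)
        q , q≤ , round   = spin x (allFin n)
        l , l≤ , visits  = trip x xs t (m+n≤o⇒n≤o (D s x) len≤r)
    in p ◅◅ (q ◅◅ l) , weight-≤ p (q ◅◅ l) p≤ (weight-≤ q l q≤ l≤) , λ
    { (here refl) xc → ∈-◅◅ʳ p (q ◅◅ l) (∈-◅◅ˡ q l (round (∈-allFin _) xc))
    ; (there x∈)  xc → ∈-◅◅ʳ p (q ◅◅ l) (∈-◅◅ʳ q l (visits x∈ xc)) }

  record Tour : Set where
    field
      base     : Fin n
      base∈D   : base ∈ depots
      route     : Walk base base
      route≤gas : weight route ≤ gas

  open Tour

  Serves : Fin n → Tour → Set
  Serves c t = c ∈ˡ vertices (route t)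

  routing : ∀ ts → length ts ≤ vehicles → (∀ c → c ∈ clients → Any (Serves c) ts) →
            Σ[ R ∈ Routing I ] Routing.totalWeight R ≡ total (map (weight ∘ route) ts)
  routing ts ts≤k served = record
    { k′ = length ts ; k′≤vehicles = ts≤k
    ; start = base ∘ tour ; start∈D = λ j → base∈D (tour j) ; walk = λ j → route (tour j)
    ; assign = λ c c∈C → Any.index (served c c∈C)
    ; visited = λ c c∈C → Anyₚ.lookup-index (served c c∈C)
    ; within-gas = λ j → route≤gas (tour j) } , sum-lookup (weight ∘ route) ts
    where tour = Listᵇ.lookup ts

  blockTours : ∀ bs → total (map price bs) ≤ r → ∃[ ts ] length ts ≡ length bs ×
               total (map (weight ∘ route) ts) ≤ total (map price bs) ×
               (∀ {v c} → v ∈ˡ layers bs → D v c ≡ 0 → Any (Serves c) ts)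
  blockTours []       _    = [] , refl , z≤n , λ ()
  blockTours (b ∷ bs) sum≤r =
    let p , p≤ , visits = trip (home b) (stops b) (home b) (m+n≤o⇒m≤o (price b) sum≤r)
        ts , length≡ , ts≤ , served = blockTours bs (m+n≤o⇒n≤o (price b) sum≤r)
        t = record { base = home b ; base∈D = home∈Dep b ; route = p
                   ; route≤gas = ≤-trans p≤ (price≤g b) }
    in t ∷ ts , cong suc length≡ , +-mono-≤ p≤ ts≤ , λ v∈ vc →
       case-∈ visits served (∈-++⁻ (stops b) v∈) vc
    where
    case-∈ : ∀ {v c xs ys t ts} → (∀ {x c} → x ∈ˡ xs → D x c ≡ 0 → Serves c t) →
             (∀ {v c} → v ∈ˡ ys → D v c ≡ 0 → Any (Serves c) ts) →
             v ∈ˡ xs ⊎ v ∈ˡ ys → D v c ≡ 0 → Any (Serves c) (t ∷ ts)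
    case-∈ f g (inj₁ v∈) vc = here (f v∈ vc)
    case-∈ f g (inj₂ v∈) vc = there (g v∈ vc)

  freeTours : ∀ us → (∀ {v} → v ∈ˡ us → ∃[ s ] s ∈ depots × D s v ≡ 0) →
              ∃[ ts ] length ts ≡ length us × total (map (weight ∘ route) ts) ≤ 0 ×
              (∀ {v c} → v ∈ˡ us → D v c ≡ 0 → Any (Serves c) ts)
  freeTours []       _    = [] , refl , z≤n , λ ()
  freeTours (u ∷ us) near =
    let s , s∈D , su = near (here refl)
        len≡0 : len s (u ∷ []) s ≡ 0
        len≡0 = cong₂ _+_ su (trans (D-sym u s) su)
        p , p≤ , visits = trip s (u ∷ []) s (subst (_≤ r) (sym len≡0) z≤n)
        p≤0 = subst (weight p ≤_) len≡0 p≤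
        ts , length≡ , ts≤ , served = freeTours us (near ∘ there)
        t = record { base = s ; base∈D = s∈D ; route = p ; route≤gas = ≤-trans p≤0 z≤n }
    in t ∷ ts , cong suc length≡ , +-mono-≤ p≤0 ts≤ , λ
    { (here refl) vc → here (visits (here refl) vc) ; (there v∈) vc → there (served v∈ vc) }

  -- A representative that is not a stop is not remote, by `covers`, so it is served from a depot at
  -- distance 0 by a vehicle of its own, on a walk of weight 0.
  plan⇒routing : Plan → Σ[ R ∈ Routing I ] Routing.totalWeight R ≤ r
  plan⇒routing P =
    let ts , ts≡ , ts≤ , served  = blockTours blocks cheap
        ts′ , ts′≡ , ts′≤ , served′ = freeTours rest near
        R , total≡ = routing (ts ++ ts′)
          (subst (_≤ vehicles)
            (sym (trans (length-++ ts) (cong₂ _+_ ts≡ ts′≡))) enough)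
          (λ c c∈C → serve served served′ c c∈C)
    in R , (begin
      Routing.totalWeight R                        ≡⟨ total≡ ⟩
      total (map (weight ∘ route) (ts ++ ts′))      ≡⟨ cong total (map-++ _ ts ts′) ⟩
      total (map (weight ∘ route) ts ++ map (weight ∘ route) ts′)
        ≡⟨ total-++ (map (weight ∘ route) ts) _ ⟩
      total (map (weight ∘ route) ts) + total (map (weight ∘ route) ts′)
        ≤⟨ +-mono-≤ (≤-trans ts≤ cheap) ts′≤ ⟩
      r + 0                                        ≡⟨ +-identityʳ r ⟩
      r                                            ∎)
    where
    open Plan P
    open ≤-Reasoning hiding (start)
    _∈layers? : ∀ v → Dec (v ∈ˡ layers blocks)
    v ∈layers? = Any.any? (v Fin.≟_) (layers blocks)
    rest : List (Fin n)
    rest = filter (¬? ∘ _∈layers?) representatives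
    rest⁻ : ∀ {v} → v ∈ˡ rest → v ∈ˡ representatives × ¬ v ∈ˡ layers blocks
    rest⁻ = ∈-filter⁻ (¬? ∘ _∈layers?)
    near : ∀ {v} → v ∈ˡ rest → ∃[ s ] s ∈ depots × D s v ≡ 0
    near {v} v∈ with any? (λ s → (s ∈? depots) ×-dec (D s v ≟ 0))
    ... | yes found = found
    ... | no  none  = ⊥-elim (proj₂ (rest⁻ v∈)
            (covers (proj₂ (∈-filter⁻ representative? {xs = allFin n} (proj₁ (rest⁻ v∈))) ,
                     λ s s∈D sv → none (s , s∈D , sv))))
    -- The stops are representatives by `inK`, and `rest` avoids them, so together they are at most
    -- as many as the representatives; this turns `fits` into a bound on the vehicles used.
    counted : length (rest ++ layers blocks) ≤ length representatives
    counted = pigeonhole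
      (Uniqueₚ.++⁺ (Uniqueₚ.filter⁺ _ (Uniqueₚ.filter⁺ _ (Uniqueₚ.allFin⁺ n))) unique
        λ (v∈ , v∈′) → proj₂ (rest⁻ v∈) v∈′)
      λ v∈ → [ (λ v∈ → proj₁ (rest⁻ v∈))
             , (λ v∈ → ∈-filter⁺ representative? (∈-allFin _) (inK v∈)) ]′ (∈-++⁻ rest v∈)
    enough : length blocks + length rest ≤ vehicles
    enough = +-cancelʳ-≤ (length (layers blocks)) _ _ (begin
      length blocks + length rest + length (layers blocks)    ≡⟨ +-assoc (length blocks) _ _ ⟩
      length blocks + (length rest + length (layers blocks))  ≡⟨ cong (length blocks +_) (length-++ rest) ⟨
      length blocks + length (rest ++ layers blocks)          ≤⟨ +-monoʳ-≤ (length blocks) counted ⟩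
      length blocks + length representatives                  ≡⟨ +-comm (length blocks) _ ⟩
      length representatives + length blocks                  ≤⟨ fits ⟩
      vehicles + length (layers blocks)                       ∎)
    serve : ∀ {ts ts′} → (∀ {v c} → v ∈ˡ layers blocks → D v c ≡ 0 → Any (Serves c) ts) →
            (∀ {v c} → v ∈ˡ rest → D v c ≡ 0 → Any (Serves c) ts′) →
            ∀ c → c ∈ clients → Any (Serves c) (ts ++ ts′)
    serve {ts} served served′ c c∈C with representative-of c c∈C
    ... | v , rep , vc with v ∈layers?
    ...   | yes v∈ = Anyₚ.++⁺ˡ (served v∈ vc)
    ...   | no  v∉ = Anyₚ.++⁺ʳ ts (served′
              (∈-filter⁺ (¬? ∘ _∈layers?) (∈-filter⁺ representative? (∈-allFin v) rep) v∉) vc)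

  -- From routings to plans

  len-tri : ∀ s u xs t → len s xs t ≤ D s u + len u xs t
  len-tri s u []       t = D-tri s u t
  len-tri s u (x ∷ xs) t = ≤-trans (+-monoˡ-≤ _ (D-tri s u x)) (≤-reflexive (+-assoc (D s u) _ _))

  -- By the triangle inequality a detour never shortens the way. This passes from all vertices of a
  -- walk to its stops.
  len-⊆ : ∀ {xs ys} → xs ⊆ ys → ∀ s t → len s xs t ≤ len s ys t
  len-⊆ [] s t = ≤-refl
  len-⊆ {xs} (y ∷ʳ incl) s t = ≤-trans (len-tri s y xs t) (+-monoʳ-≤ (D s y) (len-⊆ incl y t))
  len-⊆ (_∷_ {x} refl incl) s t = +-monoʳ-≤ (D s x) (len-⊆ incl x t)

  len-∈ : ∀ {x} s xs t → x ∈ˡ xs → D s x ≤ len s xs t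
  len-∈ s (x ∷ xs) t (here refl) = m≤m+n _ _
  len-∈ {v} s (x ∷ xs) t (there x∈) = ≤-trans (D-tri s x v) (+-monoʳ-≤ (D s x) (len-∈ x xs t x∈))

  len-vertices : ∀ {u v} (p : Walk u v) → len u (vertices p) v ≤ weight p
  len-vertices {u} ε rewrite D-refl u = ≤-refl
  len-vertices {u} {v} (_◅_ {j = w} (x , uw) p) rewrite D-refl u =
    ≤-trans (len-tri u w (vertices p) v) (+-mono-≤ (D-edge uw) (len-vertices p))

  -- Each leg between distinct representatives costs at least 1. `y` is the final stop, kept for the
  -- way home.
  len-last : ∀ x xs t → Unique (x ∷ xs) → (∀ {v} → v ∈ˡ x ∷ xs → Representative v) →
             ∃[ y ] y ∈ˡ x ∷ xs × length xs + D y t ≤ len x xs t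
  len-last x [] t _ _ = x , here refl , ≤-refl
  len-last x (x′ ∷ xs) t ((x≢x′ ∷ _) ∷ unique) rep =
    let y , y∈ , le = len-last x′ xs t unique (rep ∘ there)
    in y , there y∈ , +-mono-≤ (separated (rep (here refl)) (rep (there (here refl))) x≢x′) le

  -- With `m ≥ 2` stops the `m - 1` legs between them cost at least 1 each, and so does the way from
  -- the last via `s` to the first, by the triangle inequality. A single stop may cost nothing,
  -- hence the `1 ⊔`.
  length≤len : ∀ s xs → Unique xs → (∀ {v} → v ∈ˡ xs → Representative v) →
               length xs ≤ 1 ⊔ len s xs s
  length≤len s []       _ _ = z≤n
  length≤len s (x ∷ []) _ _ = m≤m⊔n 1 (D s x + D x s)
  length≤len s (x ∷ x′ ∷ xs) ((x≢x′ ∷ x∉xs) ∷ unique) rep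
    with len-last x′ xs s unique (rep ∘ there)
  ... | y , y∈ , le = ≤-trans (begin
    2 + length xs                             ≡⟨ +-comm 1 (suc (length xs)) ⟩
    suc (length xs) + 1                       ≤⟨ +-monoʳ-≤ (suc (length xs)) (separated (rep (there y∈)) (rep (here refl)) (fresh y∈)) ⟩
    suc (length xs) + D y x                   ≤⟨ +-monoʳ-≤ (suc (length xs)) (D-tri y s x) ⟩
    suc (length xs) + (D y s + D s x)         ≡⟨ +-assoc (suc (length xs)) _ _ ⟨
    suc (length xs + D y s) + D s x           ≡⟨ +-comm _ (D s x) ⟩
    D s x + (1 + (length xs + D y s))         ≤⟨ +-monoʳ-≤ (D s x) (+-mono-≤ (separated (rep (here refl)) (rep (there (here refl))) x≢x′) le) ⟩
    D s x + (D x x′ + len x′ xs s)            ∎) (m≤n⊔m 1 _)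
    where
    open ≤-Reasoning hiding (start)
    fresh : ∀ {y} → y ∈ˡ x′ ∷ xs → y ≢ x
    fresh (here refl) refl = x≢x′ refl
    fresh (there y∈)  refl = All.lookup x∉xs y∈ refl

  module _ (R : Routing I) where
    open Routing R

    -- `assign` depends on the membership proof. Deciding membership fixes one proof, so every
    -- client has one vehicle and the stops of different walks are disjoint.
    server : Fin n → Maybe (Fin k′)
    server c with c ∈? clients
    ... | yes c∈C = just (assign c c∈C)
    ... | no  _   = nothing

    server-visits : ∀ {c j} → server c ≡ just j → c ∈ˡ vertices (walk j)
    server-visits {c} eq with c ∈? clients
    server-visits {c} refl | yes c∈C = visited c c∈C

    server-just : ∀ {c} → c ∈ clients → ∃[ j ] server c ≡ just j
    server-just {c} c∈C with c ∈? clients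
    ... | yes p   = assign c p , refl
    ... | no  c∉C = ⊥-elim (c∉C c∈C)

    Served : Fin k′ → Fin n → Set
    Served j v = Representative v × server v ≡ just j

    served? : ∀ j v → Dec (Served j v)
    served? j v = representative? v ×-dec maybe-≡-dec Fin._≟_ (server v) (just j)

    stopsOf : Fin k′ → List (Fin n)
    stopsOf j = deduplicate Fin._≟_ (filter (served? j) (vertices (walk j)))

    stopsOf-unique : ∀ j → Unique (stopsOf j)
    stopsOf-unique j = DecUniqueₚ.deduplicate-! Fin._≟_ _

    stopsOf⁺ : ∀ {j v} → Served j v → v ∈ˡ stopsOf j
    stopsOf⁺ {j} sv@(_ , eq) =
      ∈-deduplicate⁺ Fin._≟_ (∈-filter⁺ (served? j) (server-visits eq) sv)

    stopsOf⁻ : ∀ {j v} → v ∈ˡ stopsOf j → Served j v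
    stopsOf⁻ {j} v∈ =
      proj₂ (∈-filter⁻ (served? j) {xs = vertices (walk j)} (∈-deduplicate⁻ Fin._≟_ _ v∈))

    w : Fin k′ → ℕ
    w j = weight (walk j)

    len-stopsOf : ∀ j → len (start j) (stopsOf j) (start j) ≤ w j
    len-stopsOf j = ≤-trans
      (len-⊆ (⊆-trans (deduplicate-⊆ _) (filter-⊆ (served? j) (vertices (walk j)))) _ _)
      (len-vertices (walk j))

    length-stopsOf : ∀ j → length (stopsOf j) ≤ 1 ⊔ w j
    length-stopsOf j = ≤-trans
      (length≤len (start j) (stopsOf j) (stopsOf-unique j) (proj₁ ∘ stopsOf⁻))
      (⊔-monoʳ-≤ 1 (len-stopsOf j))

    -- `free` collects the stops of the walks of weight 0.
    record Split (js : List (Fin k′)) : Set where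
      field
        blocks  : List Block
        free    : List (Fin n)
        unique  : Unique (layers blocks)
        owned   : ∀ {v} → v ∈ˡ layers blocks → ∃[ j ] j ∈ˡ js × Served j v
        covered : ∀ {v j} → j ∈ˡ js → Served j v → v ∈ˡ layers blocks ⊎ v ∈ˡ free
        remote  : ∀ {v j} → j ∈ˡ js → Served j v → Remote v → v ∈ˡ layers blocks
        price≤  : total (map price blocks) ≤ total (map w js)
        length≤ : length (layers blocks) ≤ total (map w js)
        count≤  : length free + length blocks ≤ length js

    -- A walk of weight 0 has at most one stop, which is not remote and goes to `free`. A walk of
    -- positive weight has at most as many stops as its weight and becomes a block, or is dropped
    -- when it has none. Summing gives `length≤`.
    splitTours : ∀ js → Unique js → Split js
    splitTours [] [] = record
      { blocks = [] ; free = [] ; unique = [] ; owned = λ () ; covered = λ () ; remote = λ ()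
      ; price≤ = z≤n ; length≤ = z≤n ; count≤ = z≤n }
    splitTours (j ∷ js) (j∉js ∷ js!) with splitTours js js! | w j in wj≡ | stopsOf j in stops≡
    ... | S | zero | _ = record
      { blocks = blocks ; free = stopsOf j ++ free ; unique = unique
      ; owned = λ v∈ → let j , j∈ , sv = owned v∈ in j , there j∈ , sv
      ; covered = λ
          { (here refl) sv → inj₂ (∈-++⁺ˡ (stopsOf⁺ sv))
          ; (there j∈) sv → case covered j∈ sv of λ
              { (inj₁ v∈) → inj₁ v∈ ; (inj₂ v∈) → inj₂ (∈-++⁺ʳ (stopsOf j) v∈) } }
      ; remote = λ
          { {v} (here refl) sv (_ , far) → ⊥-elim (far (start j) (start∈D j) (n≤0⇒n≡0
              (≤-trans (len-∈ (start j) (stopsOf j) (start j) (stopsOf⁺ sv))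
                (subst (len (start j) (stopsOf j) (start j) ≤_) wj≡ (len-stopsOf j)))))
          ; (there j∈) sv rv → remote j∈ sv rv }
      ; price≤ = subst (λ a → _ ≤ a + _) (sym wj≡) price≤
      ; length≤ = subst (λ a → _ ≤ a + _) (sym wj≡) length≤
      ; count≤ = begin
          length (stopsOf j ++ free) + length blocks
            ≡⟨ cong (_+ length blocks) (length-++ (stopsOf j)) ⟩
          length (stopsOf j) + length free + length blocks
            ≡⟨ +-assoc (length (stopsOf j)) _ _ ⟩
          length (stopsOf j) + (length free + length blocks)
            ≤⟨ +-mono-≤ (subst (λ a → length (stopsOf j) ≤ 1 ⊔ a) wj≡ (length-stopsOf j)) count≤ ⟩
          suc (length js) ∎ }
      where
      open Split S
      open ≤-Reasoning hiding (start)
    ... | S | suc a | [] = record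
      { blocks = blocks ; free = free ; unique = unique
      ; owned = λ v∈ → let j , j∈ , sv = owned v∈ in j , there j∈ , sv
      ; covered = λ
          { (here refl) sv → ⊥-elim (∉[] (subst (_ ∈ˡ_) stops≡ (stopsOf⁺ sv)))
          ; (there j∈) sv → covered j∈ sv }
      ; remote = λ
          { (here refl) sv → ⊥-elim (∉[] (subst (_ ∈ˡ_) stops≡ (stopsOf⁺ sv)))
          ; (there j∈) sv → remote j∈ sv }
      ; price≤ = ≤-trans price≤ (m≤n+m _ (w j)) ; length≤ = ≤-trans length≤ (m≤n+m _ (w j))
      ; count≤ = m≤n⇒m≤1+n count≤ }
      where
      open Split S
      ∉[] : ∀ {v : Fin n} → ¬ v ∈ˡ []
      ∉[] ()
    ... | S | suc a | x ∷ xs = record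
      { blocks = block ∷ blocks ; free = free
      ; unique = Uniqueₚ.++⁺ (stopsOf-unique j) unique λ (v∈ , v∈′) →
          let i , i∈ , _ , eq = owned v∈′
          in All.lookup j∉js i∈ (just-injective (trans (sym (proj₂ (stopsOf⁻ v∈))) eq))
      ; owned = λ v∈ → case ∈-++⁻ (stopsOf j) v∈ of λ
          { (inj₁ v∈) → j , here refl , stopsOf⁻ v∈
          ; (inj₂ v∈) → let i , i∈ , sv = owned v∈ in i , there i∈ , sv }
      ; covered = λ
          { (here refl) sv → inj₁ (∈-++⁺ˡ (stopsOf⁺ sv))
          ; (there j∈) sv → case covered j∈ sv of λ
              { (inj₁ v∈) → inj₁ (∈-++⁺ʳ (stopsOf j) v∈) ; (inj₂ v∈) → inj₂ v∈ } }
      ; remote = λ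
          { (here refl) sv _ → ∈-++⁺ˡ (stopsOf⁺ sv)
          ; (there j∈) sv rv → ∈-++⁺ʳ (stopsOf j) (remote j∈ sv rv) }
      ; price≤ = +-mono-≤ (len-stopsOf j) price≤
      ; length≤ = ≤-trans (≤-reflexive (length-++ (stopsOf j)))
          (+-mono-≤ (subst (length (stopsOf j) ≤_)
            (trans (cong (1 ⊔_) wj≡) (sym wj≡)) (length-stopsOf j)) length≤)
      ; count≤ = ≤-trans (≤-reflexive (+-suc (length free) (length blocks))) (s≤s count≤) }
      where
      open Split S
      block : Block
      block = record
        { home = start j ; home∈Dep = start∈D j ; stops = stopsOf j
        ; stops≢[] = λ eq → case trans (sym eq) stops≡ of λ ()
        ; price≤g = ≤-trans (len-stopsOf j) (within-gas j) }

    -- For `fits`: each representative is a stop of a block or lies in `free`, and by `count≤` the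
    -- blocks and the members of `free` are together no more than the walks.
    routing⇒plan : totalWeight ≤ r → Σ[ P ∈ Plan ] length (layers (Plan.blocks P)) ≤ r
    routing⇒plan tot≤r = record
      { blocks = blocks ; unique = unique
      ; inK = λ v∈ → let _ , _ , rep , _ = owned v∈ in rep
      ; covers = λ rv → let j , eq = server-just (proj₁ (proj₁ rv))
                        in remote (∈-allFin j) (proj₁ rv , eq) rv
      ; cheap = ≤-trans price≤ total≤r
      ; fits = begin
          length representatives + length blocks
            ≤⟨ +-monoˡ-≤ (length blocks) represented ⟩
          length (layers blocks ++ free) + length blocks
            ≡⟨ cong (_+ length blocks) (length-++ (layers blocks)) ⟩
          length (layers blocks) + length free + length blocks
            ≡⟨ +-assoc (length (layers blocks)) _ _ ⟩
          length (layers blocks) + (length free + length blocks)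
            ≤⟨ +-monoʳ-≤ (length (layers blocks)) (≤-trans count≤ (≤-trans (≤-reflexive (length-tabulate id)) k′≤vehicles)) ⟩
          length (layers blocks) + vehicles
            ≡⟨ +-comm (length (layers blocks)) vehicles ⟩
          vehicles + length (layers blocks) ∎ } , ≤-trans length≤ total≤r
      where
      open Split (splitTours (allFin k′) (Uniqueₚ.allFin⁺ k′))
      open ≤-Reasoning hiding (start)
      total≤r : total (map w (allFin k′)) ≤ r
      total≤r = subst (_≤ r)
        (sym (trans (cong total (map-tabulate id w)) (sum-tabulate w))) tot≤r
      represented : length representatives ≤ length (layers blocks ++ free)
      represented = pigeonhole (Uniqueₚ.filter⁺ _ (Uniqueₚ.allFin⁺ n)) λ v∈ →
        let rep     = proj₂ (∈-filter⁻ representative? {xs = allFin n} v∈)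
            j , eq  = server-just (proj₁ rep)
        in case covered (∈-allFin j) (rep , eq) of λ
             { (inj₁ v∈) → ∈-++⁺ˡ v∈ ; (inj₂ v∈) → ∈-++⁺ʳ (layers blocks) v∈ }

-- All-pairs distances

module FloydWarshall (I : GasCVRP) (r : ℕ) where
  open GasCVRP I

  -- A non-edge has length `suc r`, which counts as infinite since only distances up to `r` must be
  -- realised by walks; the diagonal is 0 even where a loop has positive weight.
  link : Fin n → Fin n → ℕ
  link s v with s Fin.≟ v
  ... | yes _ = 0
  ... | no  _ = maybe′ id (suc r) (edge s v)

  link-refl : ∀ v → link v v ≡ 0
  link-refl v with v Fin.≟ v
  ... | yes _  = refl
  ... | no v≢v = ⊥-elim (v≢v refl)

  link-sym : ∀ s v → link s v ≡ link v s
  link-sym s v with s Fin.≟ v | v Fin.≟ s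
  ... | yes _    | yes _    = refl
  ... | no _     | no _     = cong (maybe′ id (suc r)) (edge-sym s v)
  ... | yes refl | no v≢v   = ⊥-elim (v≢v refl)
  ... | no v≢v   | yes refl = ⊥-elim (v≢v refl)

  link-edge : ∀ {u v x} → edge u v ≡ just x → link u v ≤ x
  link-edge {u} {v} eq with u Fin.≟ v
  ... | yes _ = z≤n
  ... | no  _ = ≤-reflexive (cong (maybe′ id (suc r)) eq)

  link-walk : ∀ {u v} → link u v ≤ r → ∃[ p ] weight {u} {v} p ≤ link u v
  link-walk {u} {v} le with u Fin.≟ v
  ... | yes refl = ε , z≤n
  ... | no  _ with edge u v in eq
  ...   | just x  = (x , eq) ◅ ε , ≤-reflexive (+-identityʳ x)
  ...   | nothing = ⊥-elim (1+n≰n le)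

  -- The invariant of Floyd and Warshall without reference to shortest paths: after `i` rounds the
  -- triangle inequality holds through the vertices below `i`, and every entry up to `r` is
  -- realised.
  record Pass (i : ℕ) (f : Fin n → Fin n → ℕ) : Set where
    field
      refl₀  : ∀ v → f v v ≡ 0
      symm   : ∀ u v → f u v ≡ f v u
      below  : ∀ u v → f u v ≤ link u v
      walked : ∀ {u v} → f u v ≤ r → ∃[ p ] weight {u} {v} p ≤ f u v
      tri    : ∀ u m v → toℕ m < i → f u v ≤ f u m + f m v

  pass-zero : ∀ {f} → (∀ u v → f u v ≡ link u v) → Pass 0 f
  pass-zero {f} f≡ = record
    { refl₀ = λ v → trans (f≡ v v) (link-refl v)
    ; symm = λ u v → trans (f≡ u v) (trans (link-sym u v) (sym (f≡ v u)))
    ; below = λ u v → ≤-reflexive (f≡ u v)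
    ; walked = λ {u} {v} le → let p , p≤ = link-walk (subst (_≤ r) (f≡ u v) le)
                              in p , subst (weight p ≤_) (sym (f≡ u v)) p≤
    ; tri = λ u m v () }

  pass-suc : ∀ {f f′} k → (∀ u v → f′ u v ≡ f u v ⊓ (f u k + f k v)) →
             Pass (toℕ k) f → Pass (suc (toℕ k)) f′
  pass-suc {f} {f′} k f′≡ P = record
    { refl₀ = λ v → n≤0⇒n≡0 (≤-trans (old v v) (≤-reflexive (refl₀ v)))
    ; symm = λ u v → trans (f′≡ u v) (trans (cong₂ _⊓_ (symm u v)
        (trans (+-comm (f u k) (f k v)) (cong₂ _+_ (symm k v) (symm u k)))) (sym (f′≡ v u)))
    ; below = λ u v → ≤-trans (old u v) (below u v)
    ; walked = walked′
    ; tri = tri′ }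
    where
    open Pass P
    open ≤-Reasoning
    old : ∀ u v → f′ u v ≤ f u v
    old u v = ≤-trans (≤-reflexive (f′≡ u v)) (m⊓n≤m _ _)
    new : ∀ u v → f′ u v ≤ f u k + f k v
    new u v = ≤-trans (≤-reflexive (f′≡ u v)) (m⊓n≤n (f u v) _)
    sel : ∀ u v → f′ u v ≡ f u v ⊎ f′ u v ≡ f u k + f k v
    sel u v with ⊓-sel (f u v) (f u k + f k v)
    ... | inj₁ eq = inj₁ (trans (f′≡ u v) eq)
    ... | inj₂ eq = inj₂ (trans (f′≡ u v) eq)
    walked′ : ∀ {u v} → f′ u v ≤ r → ∃[ p ] weight {u} {v} p ≤ f′ u v
    walked′ {u} {v} le with f′ u v | sel u v
    ... | _ | inj₁ refl = walked le
    ... | _ | inj₂ refl =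
      let p , p≤ = walked (m+n≤o⇒m≤o (f u k) le)
          q , q≤ = walked (m+n≤o⇒n≤o (f u k) le)
      in p ◅◅ q , ≤-trans (≤-reflexive (weight-◅◅ graph p q)) (+-mono-≤ p≤ q≤)
    -- Rerouting through `k` does not lower the entries in the row and column of `k`, as the detour
    -- contains the old leg.
    through : ∀ u v → f u k ≤ f′ u k × f k v ≤ f′ k v
    through u v = to , from
      where
      to : f u k ≤ f′ u k
      to with sel u k
      ... | inj₁ eq = ≤-reflexive (sym eq)
      ... | inj₂ eq = ≤-trans (m≤m+n _ _) (≤-reflexive (sym eq))
      from : f k v ≤ f′ k v
      from with sel k v
      ... | inj₁ eq = ≤-reflexive (sym eq)
      ... | inj₂ eq = ≤-trans (m≤n+m _ (f k k)) (≤-reflexive (sym eq))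
    tri′ : ∀ u m v → toℕ m < suc (toℕ k) → f′ u v ≤ f′ u m + f′ m v
    tri′ u m v m≤k with m Fin.≟ k
    ... | yes refl = ≤-trans (new u v) (+-mono-≤ (proj₁ (through u v)) (proj₂ (through u v)))
    ... | no  m≢k  with ≤∧≢⇒< (s≤s⁻¹ m≤k) (m≢k ∘ toℕ-injective)
    ...   | m<k with sel u m | sel m v
    ...     | inj₁ p | inj₁ q = ≤-trans (old u v)
              (≤-trans (tri u m v m<k) (≤-reflexive (sym (cong₂ _+_ p q))))
    ...     | inj₁ p | inj₂ q = begin
              f′ u v                     ≤⟨ new u v ⟩
              f u k + f k v              ≤⟨ +-monoˡ-≤ (f k v) (tri u m k m<k) ⟩
              f u m + f m k + f k v      ≡⟨ +-assoc (f u m) _ _ ⟩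
              f u m + (f m k + f k v)    ≡⟨ cong₂ _+_ p q ⟨
              f′ u m + f′ m v            ∎
    ...     | inj₂ p | inj₁ q = begin
              f′ u v                     ≤⟨ new u v ⟩
              f u k + f k v              ≤⟨ +-monoʳ-≤ (f u k) (tri k m v m<k) ⟩
              f u k + (f k m + f m v)    ≡⟨ +-assoc (f u k) _ _ ⟨
              f u k + f k m + f m v      ≡⟨ cong₂ _+_ p q ⟨
              f′ u m + f′ m v            ∎
    -- Both legs pass through `k`; the way from `k` to `m` and back is left out.
    ...     | inj₂ p | inj₂ q = begin
              f′ u v                                 ≤⟨ new u v ⟩
              f u k + f k v                          ≤⟨ +-mono-≤ (m≤m+n (f u k) (f k m)) (m≤n+m (f k v) (f m k)) ⟩
              f u k + f k m + (f m k + f k v)        ≡⟨ cong₂ _+_ p q ⟨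
              f′ u m + f′ m v                        ∎

  distance : ∀ {f} → Pass n f → Distance I r
  distance {f} P = record
    { D = f ; D-refl = refl₀ ; D-tri = λ u v w → tri u v w (toℕ<n v) ; D-sym = symm
    ; D-edge = λ {u} {v} eq → ≤-trans (below u v) (link-edge eq) ; D-walk = walked }
    where open Pass P

-- The program

-- A loop over `# i` is bounded by the i-th of the registers after the fourth.
-- Array 3 holds the distances, 4 and 5 mark the representatives and the remote
-- ones among them.
regs : (n k g r l L b Z nn top : ℕ) → Regs
regs n k g r l L b Z nn top =
  cells (n ∷ k ∷ g ∷ r ∷ n ∷ r ∷ l ∷ L ∷ b ∷ Z ∷ 2 ∷ nn ∷ 1 ∷ suc r ∷ top ∷ [])

rowᵉ colᵉ : ∀ {k} → Exp k → Exp k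
rowᵉ t = divᵉ (# 0) t
colᵉ t = modᵉ (# 0) t

atᵉ : ∀ {k} → Exp k → Exp k → Exp k
atᵉ s v = mulᵉ (# 0) s ⊞ v

linkᵉ : ∀ {k} → Exp (suc k)
linkᵉ = ifn (rowᵉ t ≡ᵉ colᵉ t) (lit 0) (ifn (get 0 t) (get 0 t ⊟ lit 1) (lit 1 ⊞ glob (# 3)))
  where t = var zero

relaxᵉ : ∀ {k} → Exp (2 + k)
relaxᵉ = ifn (old ≤ᵉ new) old new
  where
  t = var zero
  m = var (suc zero)
  old = get 3 t
  new = get 3 (atᵉ (rowᵉ t) m) ⊞ get 3 (atᵉ m (colᵉ t))

-- The new entries go through array 9 because the expression given to `fill` must not read the array
-- being filled.
relaxᶜ : ∀ {k} → Cmd (suc k)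
relaxᶜ = fill 9 (# 7) relaxᵉ ▷ fill 3 (# 7) (get 9 (var zero))

leastᵉ farᵉ : ∀ {k} → Exp (2 + k)
leastᵉ = var zero <ᵉ var (suc zero) →ᵉ get 2 (var zero) →ᵉ get 3 (atᵉ (var zero) (var (suc zero)))
farᵉ = get 1 (var zero) →ᵉ get 3 (atᵉ (var zero) (var (suc zero)))

representativeᵉ remoteᵉ : ∀ {k} → Exp (suc k)
representativeᵉ = get 2 (var zero) ∧ᵉ allᵉ (# 0) leastᵉ
remoteᵉ = get 4 (var zero) ∧ᵉ allᵉ (# 0) farᵉ

prepareᶜ : ∀ {k} → Cmd k
prepareᶜ = fill 3 (# 7) linkᵉ ▷ iterate (# 0) relaxᶜ ▷
           fill 4 (# 0) representativeᵉ ▷ fill 5 (# 0) remoteᵉ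

-- Arrays as vectors, predicates and counts

reflects-all-Fin : ∀ {n} {P : Fin n → Set} {f : ℕ → ℕ} → (∀ v → Reflects (P v) (f (toℕ v))) →
                   Reflects (∀ v → P v) (1 ∸ (iter n 0 λ i acc → branch acc 1 (1 ∸ f i)))
reflects-all-Fin {n} {P} {f} ref = reflects-map {∀ {i} → i < n → ∀ v → toℕ v ≡ i → P v}
  (λ all v → all (toℕ<n v) v refl) (λ all _ v _ → all v)
  (reflects-all {λ i → ∀ v → toℕ v ≡ i → P v} {f} n λ {i} i<n →
    reflects-map (λ p v eq → subst P (toℕ-injective (trans (toℕ-fromℕ< i<n) (sym eq))) p)
                 (λ all → all (fromℕ< i<n) (toℕ-fromℕ< i<n))
                 (subst (λ j → Reflects (P (fromℕ< i<n)) (f j)) (toℕ-fromℕ< i<n) (ref (fromℕ< i<n))))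

minimum-≤-Fin : ∀ {n v w} {f : ℕ → ℕ} → w < v → minimum n v f ≤ w → ∃[ i ] f (toℕ {n} i) ≤ w
minimum-≤-Fin {n} {v} {w} {f} w<v le =
  let i , i<n , fi≤w = minimum-≤ {n} {v} {f} w<v le
  in fromℕ< i<n , subst (λ j → f j ≤ w) (sym (toℕ-fromℕ< i<n)) fi≤w

cells-lookup : ∀ {m} (xs : Vec ℕ m) i → cells xs (toℕ i) ≡ Vec.lookup xs i
cells-lookup (x ∷ xs) zero    = refl
cells-lookup (x ∷ xs) (suc i) = cells-lookup xs i

cells-++ˡ : ∀ {m o} (xs : Vec ℕ m) (ys : Vec ℕ o) i → cells (xs Vec.++ ys) (toℕ i) ≡ Vec.lookup xs i
cells-++ˡ (x ∷ xs) ys zero    = refl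
cells-++ˡ (x ∷ xs) ys (suc i) = cells-++ˡ xs ys i

cells-++ʳ : ∀ {m o} (xs : Vec ℕ m) (ys : Vec ℕ o) i → cells (xs Vec.++ ys) (m + i) ≡ cells ys i
cells-++ʳ []       ys i = refl
cells-++ʳ (x ∷ xs) ys i = cells-++ʳ xs ys i

cells-concat : ∀ {m o} (xss : Vec (Vec ℕ m) o) i j →
               cells (Vec.concat xss) (m * toℕ i + toℕ j) ≡ Vec.lookup (Vec.lookup xss i) j
cells-concat {m} (xs ∷ xss) zero    j rewrite *-zeroʳ m = cells-++ˡ xs (Vec.concat xss) j
cells-concat {m} (xs ∷ xss) (suc i) j rewrite *-suc m (toℕ i) | +-assoc m (m * toℕ i) (toℕ j) =
  trans (cells-++ʳ xs (Vec.concat xss) _) (cells-concat xss i j)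

reflects-bits : ∀ {m} (p : Subset m) v →
                Reflects (v ∈ p) (cells (Vec.map (λ b → if b then 1 else 0) p) (toℕ v))
reflects-bits p v
  rewrite cells-lookup (Vec.map (λ b → if b then 1 else 0) p) v
        | Vecₚ.lookup-map v (λ b → if b then 1 else 0) p
  with Vec.lookup p v in eq
... | true  = holds (Vecₚ.lookup⇒[]= v p eq)
... | false = fails λ v∈p → case trans (sym (Vecₚ.[]=⇒lookup v∈p)) eq of λ ()

count-filter : ∀ {m} {A : Set} {P : A → Set} (P? : ∀ a → Dec (P a)) (g : Fin m → A) {f : ℕ → ℕ} →
               (∀ i → Reflects (P (g i)) (f (toℕ i))) →
               iter m 0 (λ i acc → acc + branch (f i) 1 0) ≡ length (filter P? (tabulate g))
count-filter {zero}  P? g ref = refl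
count-filter {suc m} {P = P} P? g {f} ref = trans (front m) first
  where
  -- The loop adds the last index last, the list starts with index 0; this moves the first summand
  -- to the front.
  front : ∀ m → iter (suc m) 0 (λ i acc → acc + branch (f i) 1 0) ≡
                branch (f 0) 1 0 + iter m 0 (λ i acc → acc + branch (f (suc i)) 1 0)
  front zero    = sym (+-identityʳ _)
  front (suc m) = trans (cong (_+ branch (f (suc m)) 1 0) (front m)) (+-assoc (branch (f 0) 1 0) _ _)
  rest = count-filter P? (g ∘ suc) {f ∘ suc} (ref ∘ suc)
  first : branch (f 0) 1 0 + iter m 0 (λ i acc → acc + branch (f (suc i)) 1 0) ≡
          length (filter P? (tabulate g))
  first with f 0 | ref zero | P? (g zero)
  ... | _ | holds p  | yes _  = cong suc rest
  ... | _ | fails ¬p | no  _  = rest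
  ... | _ | holds p  | no  ¬p = ⊥-elim (¬p p)
  ... | _ | fails ¬p | yes p  = ⊥-elim (¬p p)

countᵉ : ∀ {k} → Exp k
countᵉ = sumᵉ (# 0) (ifn (get 4 (var zero)) (lit 1) (lit 0))

-- Arrays 6 and 14 hold the colours and the marks, 7 and 9 the lengths of the
-- open tours before and after a stop, 8 the current layer, 10 the weight and
-- number of the closed tours, 11 and 12 the cost of closing a tour and whether
-- to do so, and 13 counts the successful attempts.
infinityᵉ : ∀ {k} → Exp k
infinityᵉ = lit 1 ⊞ glob (# 3)

onlyᵉ stepᵉ : ∀ {k} → Exp (3 + k)
onlyᵉ = get 5 (var (# 0)) →ᵉ get 6 (var (# 0)) ≡ᵉ var (# 2) →ᵉ var (# 0) ≡ᵉ var (# 1)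
stepᵉ = ifn (get 8 (var (# 0)))
  (get 7 (atᵉ (rowᵉ (var (# 1))) (var (# 0))) ⊞ get 3 (atᵉ (var (# 0)) (colᵉ (var (# 1)))))
  infinityᵉ

layerᵉ nextᵉ : ∀ {k} → Exp (2 + k)
layerᵉ = get 4 (var (# 0)) ∧ᵉ get 6 (var (# 0)) ≡ᵉ var (# 1) ∧ᵉ allᵉ (# 0) onlyᵉ
nextᵉ = minᵉ (# 0) infinityᵉ stepᵉ

homeᵉ : ∀ {k} → Exp (suc k)
homeᵉ = ifn (get 1 (var zero)) (get 9 (atᵉ (var zero) (var zero))) infinityᵉ

bestᵉ : ∀ {k} → Exp k
bestᵉ = minᵉ (# 0) infinityᵉ homeᵉ

chargeᵉ : ∀ {k} → Exp k
chargeᵉ = ifn (get 12 (lit 0))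
  (ifn (get 11 (lit 0) ≤ᵉ glob (# 2)) (get 11 (lit 0)) infinityᵉ) (lit 0)

reloadᵉ : Exp 6
reloadᵉ = ifn (get 14 (var (# 1))) (get 3 (var (# 0))) (get 9 (var (# 0)))

-- Variable 0 is the layer and variable 4 the number `q` of layers in use. The surrounding loop
-- always runs `r` layers, its bound being a register; array 12 holds 0 from layer `q` on, so the
-- totals no longer change.
layerᶜ : Cmd 5
layerᶜ =
  fill 8 (# 0) layerᵉ ▷
  fill 9 (# 7) nextᵉ ▷
  put 11 (lit 0) bestᵉ ▷
  put 12 (lit 0) ((var (# 0) <ᵉ var (# 4)) ∧ᵉ get 14 (var (# 0))) ▷
  put 10 (lit 0) (get 10 (lit 0) ⊞ chargeᵉ) ▷
  put 10 (lit 1) (get 10 (lit 1) ⊞ ifn (get 12 (lit 0)) (lit 1) (lit 0)) ▷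
  fill 7 (# 7) reloadᵉ

colouredᵉ : Exp 5
colouredᵉ = get 5 (var (# 0)) →ᵉ get 6 (var (# 0)) <ᵉ var (# 4)

acceptᵉ : Exp 4
acceptᵉ =
  get 10 (lit 0) ≤ᵉ glob (# 3) ∧ᵉ
  countᵉ ⊞ get 10 (lit 1) ≤ᵉ glob (# 1) ⊞ var (# 3) ∧ᵉ
  allᵉ (# 0) colouredᵉ ∧ᵉ
  (var (# 3) →ᵉ get 14 (var (# 3) ⊟ lit 1))

initᶜ : Cmd 4
initᶜ = put 10 (lit 0) (lit 0) ▷ put 10 (lit 1) (lit 0) ▷ fill 7 (# 7) (get 3 (var zero))

opaque
  searchᶜ : Cmd 4
  searchᶜ =
    initᶜ ▷ iterate (# 1) layerᶜ ▷ put 13 (lit 0) (get 13 (lit 0) ⊞ acceptᵉ)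

-- A loop bound doubles as a base: `# 6` refers to the register that holds 2, `# 4` to the one that
-- holds `b`. Inside the loop, variable 2 is the vertex and variable 5 the number `z₁` that spells
-- the places.
hashᵉ : Exp 5
hashᵉ = rec (# 1) (lit 0)
  (var (# 0) ⊞ var (# 0) ⊞ digitᵉ (# 6) (var (# 2)) (digitᵉ (# 4) (var (# 5)) (var (# 1))))

colourᵉ markᵉ : Exp 5
colourᵉ = digitᵉ (# 4) (var (# 2)) hashᵉ
markᵉ   = digitᵉ (# 4) (var (# 1)) (var (# 0))

attemptᶜ : Cmd 4
attemptᶜ = fill 6 (# 0) colourᵉ ▷ fill 14 (# 1) markᵉ ▷ searchᶜ

-- From the outside in: the number `q` of stops from 0 to `r`, then `z₁` for the places, `z₂` for
-- the colours of the hash values and `z₃` for the marks.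
searchAllᶜ : Cmd 0
searchAllᶜ = iterate (# 9) (iterate (# 5) (iterate (# 5) (iterate (# 5) attemptᶜ)))

iter-cong : ∀ {A : Set} {a : A} {f g : ℕ → A → A} m →
            (∀ i → i < m → f i (iter i a g) ≡ g i (iter i a g)) → iter m a f ≡ iter m a g
iter-cong zero eq = refl
iter-cong {f = f} (suc m) eq =
  trans (cong (f m) (iter-cong m (λ i i<m → eq i (m<n⇒m<1+n i<m)))) (eq m ≤-refl)

branch-nonzero : ∀ {A : Set} {c} {x y : A} → c ≢ 0 → branch c x y ≡ x
branch-nonzero {c = zero}  c≢0 = ⊥-elim (c≢0 refl)
branch-nonzero {c = suc _} c≢0 = refl

branch-zero : ∀ {A : Set} {c} {x y : A} → c ≡ 0 → branch c x y ≡ y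
branch-zero refl = refl



assign : ℕ → Exp 0 → Program
assign x e = compile none 20 e ⨾ x ≔ 20

verdictᵉ : Exp 0
verdictᵉ = ifn (get 13 (lit 0)) (lit 1) (lit 0)

mainᶜ : Cmd 0
mainᶜ = prepareᶜ ▷ searchAllᶜ

decide : Program
decide = compileᶜ none 20 mainᶜ ⨾ assign 0 verdictᵉ

-- Correctness of the search

module Correctness
  (I : GasCVRP) (r l L Z nn top : ℕ)
  (nn≡ : nn ≡ GasCVRP.n I * GasCVRP.n I) (L≡ : L ≡ 2 ^ r) (Z≡ : Z ≡ (2 + (l + r)) ^ L)
  (n≤2^l : GasCVRP.n I ≤ 2 ^ l) (n≤top : GasCVRP.n I ≤ top) (r≤top : r ≤ top)
  (L≤top : L ≤ top) (b≤top : 2 + (l + r) ≤ top) (Z≤top : Z ≤ top) (nn≤top : nn ≤ top) where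
  open GasCVRP I

  b : ℕ
  b = 2 + (l + r)

  ρ : Regs
  ρ = regs n vehicles gas r l L b Z nn top

  instance
    n≢0 : NonZero n
    n≢0 = >-nonZero (≤-trans (s≤s z≤n) (toℕ<n (proj₁ depot)))

  index : Fin n → Fin n → ℕ
  index s v = n * toℕ s + toℕ v

  index<nn : ∀ s v → index s v < nn
  index<nn s v = begin-strict
    n * toℕ s + toℕ v    <⟨ +-monoʳ-< (n * toℕ s) (toℕ<n v) ⟩
    n * toℕ s + n        ≡⟨ +-comm (n * toℕ s) n ⟩
    n + n * toℕ s        ≡⟨ *-suc n (toℕ s) ⟨
    n * suc (toℕ s)      ≤⟨ *-monoʳ-≤ n (toℕ<n s) ⟩
    n * n                ≡⟨ nn≡ ⟨
    nn                   ∎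
    where open ≤-Reasoning

  index-% : ∀ s v → index s v % n ≡ toℕ v
  index-% s v = trans (cong (_% n) (trans (+-comm (n * toℕ s) (toℕ v)) (cong (toℕ v +_) (*-comm n (toℕ s)))))
    (trans ([m+kn]%n≡m%n (toℕ v) (toℕ s) n) (m<n⇒m%n≡m (toℕ<n v)))

  index-/ : ∀ s v → index s v / n ≡ toℕ s
  index-/ s v = sym (quotient-unique (m≤m+n (n * toℕ s) (toℕ v))
    (subst (index s v <_) (trans (+-comm (n * toℕ s) n) (sym (*-suc n (toℕ s))))
      (+-monoʳ-< (n * toℕ s) (toℕ<n v))))

  index≤top : ∀ s v → index s v ≤ top
  index≤top s v = ≤-trans (<⇒≤ (index<nn s v)) nn≤top

  row : ∀ {k} μ (γ : Env k) s v → ⟦ rowᵉ (var zero) ⟧ ρ μ (index s v ▸ γ) ≡ toℕ s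
  row μ γ s v = trans (divᵉ-spec ρ μ (index s v ▸ γ) (# 0) (var zero) (index≤top s v)) (index-/ s v)

  column : ∀ {k} μ (γ : Env k) s v → ⟦ colᵉ (var zero) ⟧ ρ μ (index s v ▸ γ) ≡ toℕ v
  column μ γ s v = trans (modᵉ-spec ρ μ (index s v ▸ γ) (# 0) (var zero) (index≤top s v)) (index-% s v)

  at : ∀ {k μ} {γ : Env k} e e′ {s v} → ⟦ e ⟧ ρ μ γ ≡ toℕ s → ⟦ e′ ⟧ ρ μ γ ≡ toℕ v →
       ⟦ atᵉ e e′ ⟧ ρ μ γ ≡ index s v
  at {μ = μ} {γ} e e′ p q = cong₂ _+_ (trans (iter-+ n (⟦ e ⟧ ρ μ γ)) (cong (n *_) p)) q

  reflects-allᵉ : ∀ {k} {P : Fin n → Set} μ (γ : Env k) e →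
                  (∀ v → Reflects (P v) (⟦ e ⟧ ρ μ (toℕ v ▸ γ))) →
                  Reflects (∀ v → P v) (⟦ allᵉ (# 0) e ⟧ ρ μ γ)
  reflects-allᵉ μ γ e = reflects-all-Fin {f = λ i → ⟦ e ⟧ ρ μ (i ▸ γ)}

  open FloydWarshall I r

  μ₀ μ₁ μ₂ μ₃ μ₄ : Mem
  μ₀ = arr (encode I r)
  μ₁ = ⟦ fill 3 (# 7) linkᵉ ⟧ᶜ ρ none μ₀
  μ₂ = ⟦ iterate (# 0) relaxᶜ ⟧ᶜ ρ none μ₁
  μ₃ = ⟦ fill 4 (# 0) representativeᵉ ⟧ᶜ ρ none μ₂
  μ₄ = ⟦ fill 5 (# 0) remoteᵉ ⟧ᶜ ρ none μ₃

  kept : ∀ {k} (γ : Env k) μ a c {u : Unwritten a c} → ⟦ c ⟧ᶜ ρ γ μ a ≡ μ a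
  kept γ μ a c {u} = unwritten c u

  filled : ∀ {k} (γ : Env k) μ a x e {u : Unread a e} {t} → t < bound ρ x →
           ⟦ fill a x e ⟧ᶜ ρ γ μ a t ≡ ⟦ e ⟧ ρ μ (t ▸ γ)
  filled γ μ a x e {u} = fill-get a x e u

  edges : ∀ u v → μ₀ 0 (index u v) ≡ maybe′ suc 0 (edge u v)
  edges u v = trans (cells-concat (Vec.tabulate λ u → Vec.tabulate (entry u)) u v)
    (trans (cong (λ xs → Vec.lookup xs v) (Vecₚ.lookup∘tabulate (λ u → Vec.tabulate (entry u)) u))
      (Vecₚ.lookup∘tabulate (entry u) v))
    where
    entry : Fin n → Fin n → ℕ
    entry u v = maybe′ suc 0 (edge u v)

  linked : ∀ s v → μ₁ 3 (index s v) ≡ link s v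
  linked s v = trans (filled none μ₀ 3 (# 7) linkᵉ (index<nn s v))
    (trans (cong₂ (λ a b → value a b (μ₀ 0 (index s v))) (row μ₀ none s v) (column μ₀ none s v))
      (trans (cong (value (toℕ s) (toℕ v)) (edges s v)) (eval s v)))
    where
    value : ℕ → ℕ → ℕ → ℕ
    value a b e = branch (branch (1 ∸ (a ∸ b)) (1 ∸ (b ∸ a)) 0) 0 (branch e (e ∸ 1) (suc r))
    eval : ∀ s v → value (toℕ s) (toℕ v) (maybe′ suc 0 (edge s v)) ≡ link s v
    eval s v with branch (1 ∸ (toℕ s ∸ toℕ v)) (1 ∸ (toℕ v ∸ toℕ s)) 0
                | reflects-≡ (toℕ s) (toℕ v) | s Fin.≟ v
    ... | _ | holds _  | yes _   = refl
    ... | _ | holds eq | no  s≢v = ⊥-elim (s≢v (toℕ-injective eq))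
    ... | _ | fails ne | yes s≡v = ⊥-elim (ne (cong toℕ s≡v))
    ... | _ | fails _  | no  _   with edge s v
    ...   | just x  = refl
    ...   | nothing = refl

  relaxed : ∀ μ k u v → ⟦ relaxᶜ ⟧ᶜ ρ (toℕ k ▸ none) μ 3 (index u v) ≡
            μ 3 (index u v) ⊓ (μ 3 (index u k) + μ 3 (index k v))
  relaxed μ k u v = trans
    (filled (toℕ k ▸ none) (⟦ fill 9 (# 7) relaxᵉ ⟧ᶜ ρ (toℕ k ▸ none) μ) 3 (# 7) (get 9 (var zero)) (index<nn u v))
    (trans (filled (toℕ k ▸ none) μ 9 (# 7) relaxᵉ (index<nn u v))
      (trans (branch-≤ (μ 3 (index u v)) _)
        (cong₂ (λ i j → μ 3 (index u v) ⊓ (μ 3 i + μ 3 j))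
          (at {μ = μ} {index u v ▸ toℕ k ▸ none} (rowᵉ (var zero)) (var (suc zero)) {u} {k} (row μ (toℕ k ▸ none) u v) refl)
          (at {μ = μ} {index u v ▸ toℕ k ▸ none} (var (suc zero)) (colᵉ (var zero)) {k} {v} refl (column μ (toℕ k ▸ none) u v)))))

  passes : ∀ i → i ≤ n →
           Pass i (λ u v → iter i μ₁ (λ m → ⟦ relaxᶜ ⟧ᶜ ρ (m ▸ none)) 3 (index u v))
  passes zero    _   = pass-zero linked
  passes (suc i) i<n = subst (λ i → Pass (suc i) (λ u v → mems (suc i) 3 (index u v)))
    (toℕ-fromℕ< i<n)
    (pass-suc (fromℕ< i<n) (relaxed (mems (toℕ (fromℕ< i<n))) (fromℕ< i<n))
      (subst (λ i → Pass i (λ u v → mems i 3 (index u v))) (sym (toℕ-fromℕ< i<n))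
        (passes i (<⇒≤ i<n))))
    where
    mems : ℕ → Mem
    mems i = iter i μ₁ λ m → ⟦ relaxᶜ ⟧ᶜ ρ (m ▸ none)

  dist : Distance I r
  dist = distance (passes n ≤-refl)

  open Distance dist public
  open Correspondence I r dist public

  -- After the preparation these arrays are read but never written, so the facts survive every
  -- attempt.
  record Tables (μ : Mem) : Set where
    field
      depots-table : ∀ s → Reflects (s ∈ depots) (μ 1 (toℕ s))
      D-table      : ∀ u v → μ 3 (index u v) ≡ D u v
      repr-table   : ∀ v → Reflects (Representative v) (μ 4 (toℕ v))
      remote-table : ∀ v → Reflects (Remote v) (μ 5 (toℕ v))

  tables-frame : ∀ {μ μ′} → μ′ 1 ≡ μ 1 → μ′ 3 ≡ μ 3 → μ′ 4 ≡ μ 4 → μ′ 5 ≡ μ 5 →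
                 Tables μ → Tables μ′
  tables-frame p₁ p₃ p₄ p₅ tab = record
    { depots-table = λ s → subst (λ f → Reflects (s ∈ depots) (f (toℕ s))) (sym p₁) (depots-table s)
    ; D-table = λ u v → trans (cong (λ f → f (index u v)) p₃) (D-table u v)
    ; repr-table = λ v → subst (λ f → Reflects (Representative v) (f (toℕ v))) (sym p₄) (repr-table v)
    ; remote-table = λ v → subst (λ f → Reflects (Remote v) (f (toℕ v))) (sym p₅) (remote-table v) }
    where open Tables tab

  depots₂ : ∀ s → Reflects (s ∈ depots) (μ₂ 1 (toℕ s))
  depots₂ s = subst (λ f → Reflects (s ∈ depots) (f (toℕ s)))
    (sym (trans (kept none μ₁ 1 (iterate (# 0) relaxᶜ)) (kept none μ₀ 1 (fill 3 (# 7) linkᵉ))))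
    (reflects-bits depots s)

  clients₂ : ∀ v → Reflects (v ∈ clients) (μ₂ 2 (toℕ v))
  clients₂ v = subst (λ f → Reflects (v ∈ clients) (f (toℕ v)))
    (sym (trans (kept none μ₁ 2 (iterate (# 0) relaxᶜ)) (kept none μ₀ 2 (fill 3 (# 7) linkᵉ))))
    (reflects-bits clients v)

  representatives₃ : ∀ v → Reflects (Representative v) (μ₃ 4 (toℕ v))
  representatives₃ v = subst (Reflects (Representative v))
    (sym (filled none μ₂ 4 (# 0) representativeᵉ (toℕ<n v)))
    (reflects-× (clients₂ v)
      (reflects-allᵉ μ₂ (toℕ v ▸ none) leastᵉ λ u → reflects-→ (reflects-< (toℕ u) (toℕ v)) (reflects-→ (clients₂ u)
        (subst (λ i → Reflects (D u v ≢ 0) (μ₂ 3 i))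
          (sym (at {μ = μ₂} {toℕ u ▸ toℕ v ▸ none} (var zero) (var (suc zero)) refl refl))
          (reflects-≢0 (D u v))))))

  remotes₄ : ∀ v → Reflects (Remote v) (μ₄ 5 (toℕ v))
  remotes₄ v = subst (Reflects (Remote v))
    (sym (filled none μ₃ 5 (# 0) remoteᵉ (toℕ<n v)))
    (reflects-× (representatives₃ v)
      (reflects-allᵉ μ₃ (toℕ v ▸ none) farᵉ λ s → reflects-→
        (subst (λ f → Reflects (s ∈ depots) (f (toℕ s)))
          (sym (kept none μ₂ 1 (fill 4 (# 0) representativeᵉ))) (depots₂ s))
        (subst (Reflects (D s v ≢ 0))
          (trans (cong (λ i → μ₂ 3 i) (sym (at {μ = μ₃} {toℕ s ▸ toℕ v ▸ none} (var zero) (var (suc zero)) refl refl)))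
            (sym (cong (λ f → f (⟦ atᵉ (var zero) (var (suc zero)) ⟧ ρ μ₃ (toℕ s ▸ toℕ v ▸ none)))
              (kept none μ₂ 3 (fill 4 (# 0) representativeᵉ)))))
          (reflects-≢0 (D s v)))))

  prepared : Tables (⟦ prepareᶜ ⟧ᶜ ρ none μ₀)
  prepared = record
    { depots-table = λ s → subst (λ f → Reflects (s ∈ depots) (f (toℕ s)))
        (sym (trans (kept none μ₃ 1 (fill 5 (# 0) remoteᵉ))
                    (kept none μ₂ 1 (fill 4 (# 0) representativeᵉ)))) (depots₂ s)
    ; D-table = λ u v → cong (λ f → f (index u v))
        (trans (kept none μ₃ 3 (fill 5 (# 0) remoteᵉ))
               (kept none μ₂ 3 (fill 4 (# 0) representativeᵉ)))
    ; repr-table = λ v → subst (λ f → Reflects (Representative v) (f (toℕ v)))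
        (sym (kept none μ₃ 4 (fill 5 (# 0) remoteᵉ))) (representatives₃ v)
    ; remote-table = remotes₄ }

  counted : ∀ {k μ} {γ : Env k} → Tables μ → ⟦ countᵉ ⟧ ρ μ γ ≡ length representatives
  counted tab = count-filter representative? id (Tables.repr-table tab)

  record Input (col : Fin n → ℕ) (κ : ℕ → ℕ) (μ : Mem) : Set where
    field
      tables  : Tables μ
      colours : ∀ v → μ 6 (toℕ v) ≡ col v
      marks   : ∀ {i} → i < r → μ 14 i ≡ κ i

  -- One layer in the terms of `Run`: array 7 before it is `cur`, arrays 9 and 11 after it are `nxt`
  -- and `best`, and array 10 has `tot` and `cnt`. The guard `q ∸ i` covers the layers that are not
  -- in use.
  record LayerStep (col : Fin n → ℕ) (κ : ℕ → ℕ) (q i : ℕ) (μ μ′ : Mem) : Set where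
    field
      sound      : ∀ {s v} → μ′ 9 (index s v) ≤ r →
                   ∃[ u ] Layer q col κ i u × μ 7 (index s u) + D u v ≤ μ′ 9 (index s v)
      complete   : ∀ {s u v} → Layer q col κ i u → μ′ 9 (index s v) ≤ μ 7 (index s u) + D u v
      home-sound : μ′ 11 0 ≤ r → ∃[ s ] s ∈ depots × μ′ 9 (index s s) ≤ μ′ 11 0
      home-complete : ∀ {s} → s ∈ depots → μ′ 11 0 ≤ μ′ 9 (index s s)
      tot≡       : μ′ 10 0 ≡ μ 10 0 + branch (branch (q ∸ i) (κ i) 0)
                     (branch (1 ∸ (μ′ 11 0 ∸ gas)) (μ′ 11 0) (suc r)) 0
      cnt≡       : μ′ 10 1 ≡ μ 10 1 + branch (branch (q ∸ i) (κ i) 0) 1 0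
      cur≡       : ∀ s v → μ′ 7 (index s v) ≡ branch (κ i) (D s v) (μ′ 9 (index s v))

  module _ {col : Fin n → ℕ} {κ : ℕ → ℕ} {μ : Mem} (inp : Input col κ μ)
           (i : ℕ) (i<r : i < r) (γ : Env 4) where
    open Input inp
    open Tables tables

    private
      q = γ (# 3)
      m₁ = ⟦ fill 8 (# 0) layerᵉ ⟧ᶜ ρ (i ▸ γ) μ
      m₂ = ⟦ fill 9 (# 7) nextᵉ ⟧ᶜ ρ (i ▸ γ) m₁
      m₃ = ⟦ put 11 (lit 0) bestᵉ ⟧ᶜ ρ (i ▸ γ) m₂
      m₄ = ⟦ put 12 (lit 0) ((var (# 0) <ᵉ var (# 4)) ∧ᵉ get 14 (var (# 0))) ⟧ᶜ ρ (i ▸ γ) m₃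
      m₅ = ⟦ put 10 (lit 0) (get 10 (lit 0) ⊞ chargeᵉ) ⟧ᶜ ρ (i ▸ γ) m₄
      m₆ = ⟦ put 10 (lit 1) (get 10 (lit 1) ⊞ ifn (get 12 (lit 0)) (lit 1) (lit 0)) ⟧ᶜ ρ (i ▸ γ) m₅
      reload : Cmd 5
      reload = fill 7 (# 7) reloadᵉ

    after : Mem
    after = ⟦ layerᶜ ⟧ᶜ ρ (i ▸ γ) μ

    after-kept : ∀ a {u : Unwritten a layerᶜ} → after a ≡ μ a
    after-kept a {u} = kept (i ▸ γ) μ a layerᶜ {u}

    after-input : Input col κ after
    after-input = record
      { tables  = tables-frame {μ} {after} (after-kept 1) (after-kept 3) (after-kept 4) (after-kept 5) tables
      ; colours = λ v → trans (cong (λ f → f (toℕ v)) (after-kept 6)) (colours v)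
      ; marks   = λ {j} j<r → trans (cong (λ f → f j) (after-kept 14)) (marks j<r) }

    layer-table : ∀ u → Reflects (Layer q col κ i u) (m₁ 8 (toℕ u))
    layer-table u = subst (Reflects (Layer q col κ i u))
      (sym (filled (i ▸ γ) μ 8 (# 0) layerᵉ (toℕ<n u)))
      (reflects-× (repr-table u) (reflects-× (coloured u)
        (reflects-allᵉ μ (toℕ u ▸ i ▸ γ) onlyᵉ λ u′ →
          reflects-→ (remote-table u′) (reflects-→ (coloured u′)
            (reflects-map toℕ-injective (cong toℕ) (reflects-≡ (toℕ u′) (toℕ u)))))))
      where
      coloured : ∀ u → Reflects (col u ≡ i) (branch (1 ∸ (μ 6 (toℕ u) ∸ i)) (1 ∸ (i ∸ μ 6 (toℕ u))) 0)
      coloured u = subst (λ c → Reflects (c ≡ i) _) (colours u) (reflects-≡ (μ 6 (toℕ u)) i)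

    step-value : ∀ s v u → ⟦ stepᵉ ⟧ ρ m₁ (toℕ u ▸ index s v ▸ i ▸ γ) ≡
                 branch (m₁ 8 (toℕ u)) (μ 7 (index s u) + D u v) (suc r)
    step-value s v u = cong (λ a → branch (m₁ 8 (toℕ u)) a (suc r)) (cong₂ _+_
      (trans (cong (m₁ 7) (at {μ = m₁} {toℕ u ▸ index s v ▸ i ▸ γ} (rowᵉ (var (# 1))) (var (# 0))
                             {s} {u} (row m₁ (i ▸ γ) s v) refl))
             (cong (λ f → f (index s u)) (kept (i ▸ γ) μ 7 (fill 8 (# 0) layerᵉ))))
      (trans (cong (m₁ 3) (at {μ = m₁} {toℕ u ▸ index s v ▸ i ▸ γ} (var (# 0)) (colᵉ (var (# 1)))
                             {u} {v} refl (column m₁ (i ▸ γ) s v)))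
        (trans (cong (λ f → f (index u v)) (kept (i ▸ γ) μ 3 (fill 8 (# 0) layerᵉ))) (D-table u v))))

    nxt-value : ∀ s v → after 9 (index s v) ≡
                minimum n (suc r) (λ u → ⟦ stepᵉ ⟧ ρ m₁ (u ▸ index s v ▸ i ▸ γ))
    nxt-value s v = trans (cong (λ f → f (index s v)) (kept (i ▸ γ) m₆ 9 reload))
      (filled (i ▸ γ) m₁ 9 (# 7) nextᵉ (index<nn s v))

    layer-sound : ∀ {s v} → after 9 (index s v) ≤ r →
                  ∃[ u ] Layer q col κ i u × μ 7 (index s u) + D u v ≤ after 9 (index s v)
    layer-sound {s} {v} le =
      let u , fu≤ = minimum-≤-Fin {f = λ u → ⟦ stepᵉ ⟧ ρ m₁ (u ▸ index s v ▸ i ▸ γ)}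
                      (s≤s le) (≤-reflexive (sym (nxt-value s v)))
      in u , split u (subst (_≤ after 9 (index s v)) (step-value s v u) fu≤)
      where
      split : ∀ u → branch (m₁ 8 (toℕ u)) (μ 7 (index s u) + D u v) (suc r) ≤ after 9 (index s v) →
              Layer q col κ i u × μ 7 (index s u) + D u v ≤ after 9 (index s v)
      split u p with m₁ 8 (toℕ u) | layer-table u
      ... | _ | holds lu = lu , p
      ... | _ | fails _  = ⊥-elim (<⇒≱ (s≤s le) p)

    layer-complete : ∀ {s u v} → Layer q col κ i u →
                     after 9 (index s v) ≤ μ 7 (index s u) + D u v
    layer-complete {s} {u} {v} lu = subst₂ _≤_ (sym (nxt-value s v))
      (trans (step-value s v u) eval)
      (≤-minimum {n} {suc r} {λ u → ⟦ stepᵉ ⟧ ρ m₁ (u ▸ index s v ▸ i ▸ γ)} (toℕ<n u))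
      where
      eval : branch (m₁ 8 (toℕ u)) (μ 7 (index s u) + D u v) (suc r) ≡ μ 7 (index s u) + D u v
      eval with m₁ 8 (toℕ u) | layer-table u
      ... | _ | holds _   = refl
      ... | _ | fails ¬lu = ⊥-elim (¬lu lu)

    home-value : ∀ s → ⟦ homeᵉ ⟧ ρ m₂ (toℕ s ▸ i ▸ γ) ≡
                 branch (μ 1 (toℕ s)) (after 9 (index s s)) (suc r)
    home-value s = cong₂ (λ d a → branch d a (suc r))
      (cong (λ f → f (toℕ s)) (trans (kept (i ▸ γ) m₁ 1 (fill 9 (# 7) nextᵉ))
                                     (kept (i ▸ γ) μ 1 (fill 8 (# 0) layerᵉ))))
      (trans (cong (m₂ 9) (at {μ = m₂} {toℕ s ▸ i ▸ γ} (var zero) (var zero) {s} {s} refl refl))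
        (cong (λ f → f (index s s)) (sym (kept (i ▸ γ) m₆ 9 reload))))

    best-value : after 11 0 ≡ minimum n (suc r) (λ s → ⟦ homeᵉ ⟧ ρ m₂ (s ▸ i ▸ γ))
    best-value = cong (λ f → f 0) (kept (i ▸ γ) m₆ 11 reload)

    home-sound : after 11 0 ≤ r → ∃[ s ] s ∈ depots × after 9 (index s s) ≤ after 11 0
    home-sound le =
      let s , fs≤ = minimum-≤-Fin {f = λ s → ⟦ homeᵉ ⟧ ρ m₂ (s ▸ i ▸ γ)}
                      (s≤s le) (≤-reflexive (sym best-value))
      in s , split s (subst (_≤ after 11 0) (home-value s) fs≤)
      where
      split : ∀ s → branch (μ 1 (toℕ s)) (after 9 (index s s)) (suc r) ≤ after 11 0 →
              s ∈ depots × after 9 (index s s) ≤ after 11 0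
      split s p with μ 1 (toℕ s) | depots-table s
      ... | _ | holds s∈ = s∈ , p
      ... | _ | fails _  = ⊥-elim (<⇒≱ (s≤s le) p)

    home-complete : ∀ {s} → s ∈ depots → after 11 0 ≤ after 9 (index s s)
    home-complete {s} s∈ = subst₂ _≤_ (sym best-value) (trans (home-value s) eval)
      (≤-minimum {n} {suc r} {λ s → ⟦ homeᵉ ⟧ ρ m₂ (s ▸ i ▸ γ)} (toℕ<n s))
      where
      eval : branch (μ 1 (toℕ s)) (after 9 (index s s)) (suc r) ≡ after 9 (index s s)
      eval with μ 1 (toℕ s) | depots-table s
      ... | _ | holds _  = refl
      ... | _ | fails s∉ = ⊥-elim (s∉ s∈)

    closing : ℕ
    closing = branch (q ∸ i) (κ i) 0

    closing-value : branch (q ∸ i) (m₃ 14 i) 0 ≡ closing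
    closing-value = cong (λ a → branch (q ∸ i) a 0)
      (trans (cong (λ f → f i) (trans (kept (i ▸ γ) m₁ 14 (fill 9 (# 7) nextᵉ))
                                      (kept (i ▸ γ) μ 14 (fill 8 (# 0) layerᵉ)))) (marks i<r))

    tens : m₂ 10 ≡ μ 10
    tens = trans (kept (i ▸ γ) m₁ 10 (fill 9 (# 7) nextᵉ)) (kept (i ▸ γ) μ 10 (fill 8 (# 0) layerᵉ))

    tot-value : after 10 0 ≡ μ 10 0 +
      branch closing (branch (1 ∸ (after 11 0 ∸ gas)) (after 11 0) (suc r)) 0
    tot-value = trans (cong (λ f → f 0) (kept (i ▸ γ) m₆ 10 reload)) (cong₂ _+_ (cong (λ f → f 0) tens)
      (cong₂ (λ c a → branch c (branch (1 ∸ (a ∸ gas)) a (suc r)) 0) closing-value (sym best-value)))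

    cnt-value : after 10 1 ≡ μ 10 1 + branch closing 1 0
    cnt-value = trans (cong (λ f → f 1) (kept (i ▸ γ) m₆ 10 reload))
      (cong₂ _+_ (cong (λ f → f 1) tens) (cong (λ c → branch c 1 0) closing-value))

    cur-value : ∀ s v → after 7 (index s v) ≡ branch (κ i) (D s v) (after 9 (index s v))
    cur-value s v = trans (filled (i ▸ γ) m₆ 7 (# 7) reloadᵉ (index<nn s v))
      (trans (cong₂ (λ c a → branch c a (m₂ 9 (index s v)))
          (trans (cong (λ f → f i) (trans (kept (i ▸ γ) m₁ 14 (fill 9 (# 7) nextᵉ))
                                         (kept (i ▸ γ) μ 14 (fill 8 (# 0) layerᵉ)))) (marks i<r))
          (trans (cong (λ f → f (index s v)) (trans (kept (i ▸ γ) m₁ 3 (fill 9 (# 7) nextᵉ))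
                                         (kept (i ▸ γ) μ 3 (fill 8 (# 0) layerᵉ)))) (D-table s v)))
        (cong (branch (κ i) (D s v)) (cong (λ f → f (index s v)) (sym (kept (i ▸ γ) m₆ 9 reload)))))

    layer-step : LayerStep col κ q i μ after
    layer-step = record
      { sound = layer-sound ; complete = layer-complete ; home-sound = home-sound
      ; home-complete = home-complete ; tot≡ = tot-value ; cnt≡ = cnt-value ; cur≡ = cur-value }

  record Initial (μ : Mem) : Set where
    field
      cur₀ : ∀ s v → μ 7 (index s v) ≡ D s v
      tot₀ : μ 10 0 ≡ 0
      cnt₀ : μ 10 1 ≡ 0

  module _ {col : Fin n → ℕ} {κ : ℕ → ℕ} {q : ℕ} (q≤r : q ≤ r) (mems : ℕ → Mem)
           (initial : Initial (mems 0))
           (steps : ∀ {i} → i < r → LayerStep col κ q i (mems i) (mems (suc i))) where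
    open Initial initial

    private
      step : ∀ {i} → i < q → LayerStep col κ q i (mems i) (mems (suc i))
      step i<q = steps (<-≤-trans i<q q≤r)

      closing≡ : ∀ {i} → i < q → branch (q ∸ i) (κ i) 0 ≡ κ i
      closing≡ {i} i<q = branch-nonzero (reflects-nonzero (reflects-< i q) i<q)

      tot-step : ∀ {i} → i < q → mems (suc i) 10 0 ≡ mems i 10 0 +
        branch (κ i) (branch (1 ∸ (mems (suc i) 11 0 ∸ gas)) (mems (suc i) 11 0) (suc r)) 0
      tot-step {i} i<q = trans (LayerStep.tot≡ (step i<q))
        (cong (λ c → mems i 10 0 +
          branch c (branch (1 ∸ (mems (suc i) 11 0 ∸ gas)) (mems (suc i) 11 0) (suc r)) 0)
          (closing≡ i<q))

      cnt-step : ∀ {i} → i < q → mems (suc i) 10 1 ≡ mems i 10 1 + branch (κ i) 1 0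
      cnt-step {i} i<q = trans (LayerStep.cnt≡ (step i<q))
        (cong (λ c → mems i 10 1 + branch c 1 0) (closing≡ i<q))

    run : Run q col κ
    run = record
      { cur = λ i s v → mems i 7 (index s v)
      ; nxt = λ i s v → mems (suc i) 9 (index s v)
      ; best = λ i → mems (suc i) 11 0
      ; tot = λ i → mems i 10 0
      ; cnt = λ i → mems i 10 1
      ; cur-zero = λ {s} {v} → cur₀ s v
      ; nxt-sound = λ i<q → LayerStep.sound (step i<q)
      ; nxt-complete = λ i<q → LayerStep.complete (step i<q)
      ; cur-reset = λ {i} {s} {v} i<q κ≢0 →
          trans (LayerStep.cur≡ (step i<q) s v) (branch-nonzero κ≢0)
      ; cur-continue = λ {i} {s} {v} i<q κ≡0 →
          trans (LayerStep.cur≡ (step i<q) s v) (branch-zero κ≡0)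
      ; best-sound = λ i<q → LayerStep.home-sound (step i<q)
      ; best-complete = λ i<q → LayerStep.home-complete (step i<q)
      ; tot-zero = tot₀
      ; tot-≤ = λ {i} i<q → ≤-trans (m≤m+n (mems i 10 0) _) (≤-reflexive (sym (tot-step i<q)))
      ; tot-closed = λ {i} i<q κ≢0 best≤g → trans (tot-step i<q) (cong (mems i 10 0 +_)
          (trans (branch-nonzero κ≢0)
            (branch-nonzero (reflects-nonzero (reflects-≤ (mems (suc i) 11 0) gas) best≤g))))
      ; tot-exceeded = λ {i} i<q κ≢0 g<best → subst (r <_)
          (sym (trans (tot-step i<q) (cong (mems i 10 0 +_) (trans (branch-nonzero κ≢0)
            (branch-zero (exceeded (mems (suc i) 11 0) g<best))))))
          (m≤n+m (suc r) (mems i 10 0))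
      ; tot-open = λ {i} i<q κ≡0 → trans (tot-step i<q)
          (trans (cong (mems i 10 0 +_) (branch-zero κ≡0)) (+-identityʳ _))
      ; cnt-zero = cnt₀
      ; cnt-closed = λ {i} i<q κ≢0 → trans (cnt-step i<q)
          (trans (cong (mems i 10 1 +_) (branch-nonzero κ≢0)) (+-comm _ 1))
      ; cnt-open = λ {i} i<q κ≡0 → trans (cnt-step i<q)
          (trans (cong (mems i 10 1 +_) (branch-zero κ≡0)) (+-identityʳ _)) }
      where
      exceeded : ∀ x → gas < x → 1 ∸ (x ∸ gas) ≡ 0
      exceeded x g<x with 1 ∸ (x ∸ gas) | reflects-≤ x gas
      ... | _ | holds x≤g = ⊥-elim (<⇒≱ g<x x≤g)
      ... | _ | fails _   = refl

    -- The loop runs through all `r` layers, a run ends at `q`; from there on the guard `q ∸ i` is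
    -- 0.
    idle : ∀ {i} → q ≤′ i → i ≤ r → mems i 10 0 ≡ mems q 10 0 × mems i 10 1 ≡ mems q 10 1
    idle ≤′-refl _ = refl , refl
    idle (≤′-step {i} q≤i) i<r =
      let tot≡ , cnt≡ = idle q≤i (<⇒≤ i<r)
          stop : branch (q ∸ i) (κ i) 0 ≡ 0
          stop = branch-zero (m≤n⇒m∸n≡0 (≤′⇒≤ q≤i))
      in trans (LayerStep.tot≡ (steps i<r))
           (trans (cong (mems i 10 0 +_) (branch-zero stop)) (trans (+-identityʳ _) tot≡)) ,
         trans (LayerStep.cnt≡ (steps i<r))
           (trans (cong (mems i 10 1 +_) (branch-zero stop)) (trans (+-identityʳ _) cnt≡))

    accept-value : ∀ (γ : Env 4) → γ (# 3) ≡ q → Input col κ (mems r) →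
                   Reflects (Accepts q col κ run) (⟦ acceptᵉ ⟧ ρ (mems r) γ)
    accept-value γ refl inp = reflects-map
      (λ (cheap , fits , covers , closed) → record
        { cheap = cheap ; fits = fits ; covers = covers ; closed = closed })
      (λ acc → let open Accepts acc in cheap , fits , covers , closed)
      (reflects-× (subst (λ t → Reflects (t ≤ r) (1 ∸ (mems r 10 0 ∸ r))) tot≡
                    (reflects-≤ (mems r 10 0) r))
        (reflects-× (subst₂ (λ M c → Reflects (M + c ≤ vehicles + q)
                        (1 ∸ (⟦ countᵉ ⟧ ρ (mems r) γ + mems r 10 1 ∸ (vehicles + q))))
                      (counted {γ = γ} tables) cnt≡
                      (reflects-≤ (⟦ countᵉ ⟧ ρ (mems r) γ + mems r 10 1) (vehicles + q)))
          (reflects-× (reflects-allᵉ (mems r) γ colouredᵉ λ u → reflects-→ (remote-table u)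
              (subst (λ c → Reflects (c < q) (q ∸ mems r 6 (toℕ u))) (colours u)
                (reflects-< (mems r 6 (toℕ u)) q)))
            (last-mark q (λ q≢0 → marks (<-≤-trans (∸-monoʳ-< (s≤s z≤n) (n≢0⇒n>0 q≢0)) q≤r))))))
      where
      open Input inp
      open Tables tables
      tot≡ = proj₁ (idle (≤⇒≤′ q≤r) ≤-refl)
      cnt≡ = proj₂ (idle (≤⇒≤′ q≤r) ≤-refl)
      last-mark : ∀ q → (q ≢ 0 → mems r 14 (q ∸ 1) ≡ κ (q ∸ 1)) →
                  Reflects (q ≢ 0 → κ (q ∸ 1) ≢ 0) (branch q (mems r 14 (q ∸ 1)) 1)
      last-mark zero    eq = holds λ ≢0 → ⊥-elim (≢0 refl)
      last-mark (suc q) eq = reflects-map (λ ≢0 _ → ≢0) (λ f → f (λ ()))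
        (subst (λ c → Reflects (c ≢ 0) (mems r 14 q)) (eq (λ ())) (reflects-≢0 (mems r 14 q)))

  module _ {col : Fin n → ℕ} {κ : ℕ → ℕ} {μ : Mem} (inp : Input col κ μ)
           (γ : Env 4) where

    private
      μᵢ = ⟦ initᶜ ⟧ᶜ ρ γ μ

    mems : ℕ → Mem
    mems i = iter i μᵢ λ i → ⟦ layerᶜ ⟧ᶜ ρ (i ▸ γ)

    init-input : Input col κ μᵢ
    init-input = record
      { tables  = tables-frame {μ} {μᵢ} (kept γ μ 1 initᶜ) (kept γ μ 3 initᶜ)
                    (kept γ μ 4 initᶜ) (kept γ μ 5 initᶜ) tables
      ; colours = λ v → trans (cong (λ f → f (toℕ v)) (kept γ μ 6 initᶜ)) (colours v)
      ; marks   = λ {i} i<r → trans (cong (λ f → f i) (kept γ μ 14 initᶜ)) (marks i<r) }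
      where open Input inp

    inputs : ∀ i → i ≤ r → Input col κ (mems i)
    inputs zero    _   = init-input
    inputs (suc i) i<r = after-input (inputs i (<⇒≤ i<r)) i i<r γ

    initial : Initial μᵢ
    initial = record
      { cur₀ = λ s v → trans (filled γ reset 7 (# 7) (get 3 (var zero)) (index<nn s v))
                         (Tables.D-table (Input.tables inp) s v)
      ; tot₀ = cong (λ f → f 0) (kept γ reset 10 (fill 7 (# 7) (get 3 (var zero))))
      ; cnt₀ = cong (λ f → f 1) (kept γ reset 10 (fill 7 (# 7) (get 3 (var zero)))) }
      where
      reset : Mem
      reset = ⟦ put 10 (lit 1) (lit 0) ⟧ᶜ ρ γ (⟦ put 10 (lit 0) (lit 0) ⟧ᶜ ρ γ μ)

    layer-steps : ∀ {i} → i < r → LayerStep col κ (γ (# 3)) i (mems i) (mems (suc i))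
    layer-steps {i} i<r = layer-step (inputs i (<⇒≤ i<r)) i i<r γ

    opaque
      unfolding searchᶜ

      search-keeps : Tables (⟦ searchᶜ ⟧ᶜ ρ γ μ)
      search-keeps = tables-frame {μ} {⟦ searchᶜ ⟧ᶜ ρ γ μ} (kept γ μ 1 searchᶜ)
        (kept γ μ 3 searchᶜ) (kept γ μ 4 searchᶜ) (kept γ μ 5 searchᶜ) (Input.tables inp)

      search : γ (# 3) ≤ r → ∃[ a ] ⟦ searchᶜ ⟧ᶜ ρ γ μ 13 0 ≡ μ 13 0 + a ×
               Σ[ R ∈ Run (γ (# 3)) col κ ] Reflects (Accepts (γ (# 3)) col κ R) a
      search q≤r = ⟦ acceptᵉ ⟧ ρ (mems r) γ
        , cong (λ f → f 0 + ⟦ acceptᵉ ⟧ ρ (mems r) γ)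
            (trans (kept γ μᵢ 13 (iterate (# 1) layerᶜ)) (kept γ μ 13 initᶜ))
        , run q≤r mems initial layer-steps
        , accept-value q≤r mems initial layer-steps γ refl (inputs r ≤-refl)

  -- Cell 0 of array 13 never decreases. It turns nonzero only if there is a plan, and `Win` forces
  -- it to be nonzero; in this form the statement passes through the four nested loops.
  record Counts {k} (c : Cmd k) (γ : Env k) (Win : Set) : Set where
    field
      keeps : ∀ {μ} → Tables μ → Tables (⟦ c ⟧ᶜ ρ γ μ)
      sound : ∀ {μ} → Tables μ → ⟦ c ⟧ᶜ ρ γ μ 13 0 ≢ 0 → μ 13 0 ≢ 0 ⊎ Plan
      grows : ∀ {μ} → Tables μ → μ 13 0 ≤ ⟦ c ⟧ᶜ ρ γ μ 13 0
      wins  : ∀ {μ} → Tables μ → Win → ⟦ c ⟧ᶜ ρ γ μ 13 0 ≢ 0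

  counts-loop : ∀ {k} {γ : Env k} {Win : ℕ → Set} x c →
                (∀ {i} → i < bound ρ x → Counts c (i ▸ γ) (Win i)) →
                Counts (iterate x c) γ (∃[ i ] i < bound ρ x × Win i)
  counts-loop {γ = γ} {Win} x c body = record
    { keeps = λ tab → keeps′ tab _ ≤-refl ; sound = λ tab → sound′ tab _ ≤-refl
    ; grows = λ tab → grows′ tab _ ≤-refl
    ; wins  = λ tab (i , i<m , win) → wins′ tab _ ≤-refl i<m win }
    where
    mem : Mem → ℕ → Mem
    mem μ i = iter i μ λ i → ⟦ c ⟧ᶜ ρ (i ▸ γ)
    keeps′ : ∀ {μ} → Tables μ → ∀ m → m ≤ bound ρ x → Tables (mem μ m)
    keeps′ tab zero    _   = tab
    keeps′ tab (suc m) m<b = Counts.keeps (body m<b) (keeps′ tab m (<⇒≤ m<b))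
    sound′ : ∀ {μ} → Tables μ → ∀ m → m ≤ bound ρ x → mem μ m 13 0 ≢ 0 → μ 13 0 ≢ 0 ⊎ Plan
    sound′ tab zero    _   ≢0 = inj₁ ≢0
    sound′ tab (suc m) m<b ≢0 with Counts.sound (body m<b) (keeps′ tab m (<⇒≤ m<b)) ≢0
    ... | inj₁ ≢0′ = sound′ tab m (<⇒≤ m<b) ≢0′
    ... | inj₂ P   = inj₂ P
    grows′ : ∀ {μ} → Tables μ → ∀ m → m ≤ bound ρ x → μ 13 0 ≤ mem μ m 13 0
    grows′ tab zero    _   = ≤-refl
    grows′ tab (suc m) m<b = ≤-trans (grows′ tab m (<⇒≤ m<b))
      (Counts.grows (body m<b) (keeps′ tab m (<⇒≤ m<b)))
    wins′ : ∀ {μ} → Tables μ → ∀ m → m ≤ bound ρ x → ∀ {i} → i < m → Win i → mem μ m 13 0 ≢ 0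
    wins′ tab (suc m) m<b {i} i<1+m win with i ≟ m
    ... | yes refl = Counts.wins (body m<b) (keeps′ tab m (<⇒≤ m<b)) win
    ... | no  i≢m  = λ ≡0 → wins′ tab m (<⇒≤ m<b) (≤∧≢⇒< (s≤s⁻¹ i<1+m) i≢m) win
      (n≤0⇒n≡0 (≤-trans (Counts.grows (body m<b) (keeps′ tab m (<⇒≤ m<b))) (≤-reflexive ≡0)))

  colour : ℕ → ℕ → Fin n → ℕ
  colour z₁ z₂ v = digit b z₂ (hash (digit b z₁) r (toℕ v))

  hash-value : ∀ μ v z₃ z₂ z₁ q → z₁ < Z →
               ⟦ hashᵉ ⟧ ρ μ (toℕ {n} v ▸ z₃ ▸ z₂ ▸ z₁ ▸ q ▸ none) ≡
               hash (digit b z₁) r (toℕ v)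
  hash-value μ v z₃ z₂ z₁ q z₁<Z = iter-cong r λ t t<r →
    let h   = hash (digit b z₁) t (toℕ v)
        γ   = h ▸ t ▸ toℕ v ▸ z₃ ▸ z₂ ▸ z₁ ▸ q ▸ none
        pos = digitᵉ-spec ρ μ γ (# 4) (var (# 5)) (var (# 1))
                (≤-trans (<⇒≤ z₁<Z) Z≤top) (≤-trans (<⇒≤ t<r) r≤top)
    in cong (h + h +_) (trans
         (digitᵉ-spec ρ μ γ (# 6) (var (# 2)) (digitᵉ (# 4) (var (# 5)) (var (# 1)))
           (≤-trans (<⇒≤ (toℕ<n v)) n≤top)
           (≤-trans (≤-reflexive pos) (≤-trans (<⇒≤ (digit< b z₁ t)) b≤top)))
         (cong (digit 2 (toℕ v)) pos))

  colour-value : ∀ μ v z₃ z₂ z₁ q → z₁ < Z → z₂ < Z →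
                 ⟦ colourᵉ ⟧ ρ μ (toℕ v ▸ z₃ ▸ z₂ ▸ z₁ ▸ q ▸ none) ≡ colour z₁ z₂ v
  colour-value μ v z₃ z₂ z₁ q z₁<Z z₂<Z = trans
    (digitᵉ-spec ρ μ (toℕ v ▸ z₃ ▸ z₂ ▸ z₁ ▸ q ▸ none) (# 4) (var (# 2)) hashᵉ
      (≤-trans (<⇒≤ z₂<Z) Z≤top)
      (≤-trans (≤-reflexive (hash-value μ v z₃ z₂ z₁ q z₁<Z))
        (≤-trans (<⇒≤ (hash< (digit b z₁) r (toℕ v))) (subst (_≤ top) L≡ L≤top))))
    (cong (digit b z₂) (hash-value μ v z₃ z₂ z₁ q z₁<Z))

  -- Quantifies over all runs because the tables of the actual run are known only once the memory is
  -- given.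
  Win : ℕ → ℕ → ℕ → ℕ → Set
  Win q z₁ z₂ z₃ = (R : Run q (colour z₁ z₂) (digit b z₃)) → Accepts q (colour z₁ z₂) (digit b z₃) R

  paint : Cmd 4 → Cmd 4
  paint c = fill 6 (# 0) colourᵉ ▷ fill 14 (# 1) markᵉ ▷ c

  counts-paint : ∀ {q z₁ z₂ z₃} (let γ = z₃ ▸ z₂ ▸ z₁ ▸ q ▸ none) c →
    (∀ {μ} → Input (colour z₁ z₂) (digit b z₃) μ → Tables (⟦ c ⟧ᶜ ρ γ μ) ×
     ∃[ a ] ⟦ c ⟧ᶜ ρ γ μ 13 0 ≡ μ 13 0 + a ×
     Σ[ R ∈ Run q (colour z₁ z₂) (digit b z₃) ]
     Reflects (Accepts q (colour z₁ z₂) (digit b z₃) R) a) →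
    z₁ < Z → z₂ < Z → z₃ < Z → Counts (paint c) γ (Win q z₁ z₂ z₃)
  counts-paint {q} {z₁} {z₂} {z₃} c search z₁<Z z₂<Z z₃<Z = record
    { keeps = λ tab → proj₁ (search (input tab))
    ; sound = λ tab ≢0 → let _ , eq , _ , ref = outcome tab in split eq ref ≢0
    ; grows = λ tab → let _ , eq , _ = outcome tab in
              ≤-trans (m≤m+n _ _) (≤-reflexive (sym eq))
    ; wins  = λ {μ} tab win ≡0 → let _ , eq , R , ref = outcome tab in
              reflects-nonzero ref (win R) (m+n≡0⇒n≡0 (μ 13 0) (trans (sym eq) ≡0)) }
    where
    γ : Env 4
    γ = z₃ ▸ z₂ ▸ z₁ ▸ q ▸ none
    painted : Mem → Mem
    painted μ = ⟦ fill 6 (# 0) colourᵉ ⟧ᶜ ρ γ μ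
    marked : Mem → Mem
    marked μ = ⟦ fill 14 (# 1) markᵉ ⟧ᶜ ρ γ (painted μ)
    twice : ∀ μ a {u : Unwritten a (fill 6 (# 0) colourᵉ)} {u′ : Unwritten a (fill 14 (# 1) markᵉ)} →
            marked μ a ≡ μ a
    twice μ a {u} {u′} = trans (kept γ (painted μ) a (fill 14 (# 1) markᵉ) {u′})
                               (kept γ μ a (fill 6 (# 0) colourᵉ) {u})
    input : ∀ {μ} → Tables μ → Input (colour z₁ z₂) (digit b z₃) (marked μ)
    input {μ} tab = record
      { tables  = tables-frame {μ} {marked μ} (twice μ 1) (twice μ 3) (twice μ 4) (twice μ 5) tab
      ; colours = λ v → trans (cong (λ f → f (toℕ v)) (kept γ (painted μ) 6 (fill 14 (# 1) markᵉ)))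
          (trans (filled γ μ 6 (# 0) colourᵉ (toℕ<n v)) (colour-value μ v z₃ z₂ z₁ q z₁<Z z₂<Z))
      ; marks   = λ {i} i<r → trans (filled γ (painted μ) 14 (# 1) markᵉ i<r)
          (digitᵉ-spec ρ (painted μ) (i ▸ γ) (# 4) (var (# 1)) (var (# 0))
            (≤-trans (<⇒≤ z₃<Z) Z≤top) (≤-trans (<⇒≤ i<r) r≤top)) }
    outcome : ∀ {μ} → Tables μ → ∃[ a ] ⟦ paint c ⟧ᶜ ρ γ μ 13 0 ≡ μ 13 0 + a ×
              Σ[ R ∈ Run q (colour z₁ z₂) (digit b z₃) ]
              Reflects (Accepts q (colour z₁ z₂) (digit b z₃) R) a
    outcome {μ} tab =
      let _ , a , eq , rest = search (input tab)
      in a , trans eq (cong (λ f → f 0 + a) (twice μ 13)) , rest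
    split : ∀ {x y a} {R : Run q (colour z₁ z₂) (digit b z₃)} → y ≡ x + a →
            Reflects (Accepts q (colour z₁ z₂) (digit b z₃) R) a → y ≢ 0 → x ≢ 0 ⊎ Plan
    split {x} {R = R} eq (holds acc) ≢0 = inj₂ (accepted⇒plan R acc)
    split {x}         eq (fails _)   ≢0 = inj₁ λ x≡0 → ≢0 (trans eq (trans (+-identityʳ x) x≡0))

  counts-attempt : ∀ {q z₁ z₂ z₃} → q < suc r → z₁ < Z → z₂ < Z → z₃ < Z →
                   Counts attemptᶜ (z₃ ▸ z₂ ▸ z₁ ▸ q ▸ none) (Win q z₁ z₂ z₃)
  counts-attempt {q} {z₁} {z₂} {z₃} (s≤s q≤r) = counts-paint searchᶜ
    (λ inp → search-keeps inp γ , search inp γ q≤r)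
    where
    γ : Env 4
    γ = z₃ ▸ z₂ ▸ z₁ ▸ q ▸ none

  counts-all : Counts searchAllᶜ none
    (∃[ q ] q < suc r × ∃[ z₁ ] z₁ < Z × ∃[ z₂ ] z₂ < Z × ∃[ z₃ ] z₃ < Z × Win q z₁ z₂ z₃)
  counts-all =
    counts-loop (# 9) _ λ q<  → counts-loop (# 5) _ λ z₁< →
    counts-loop (# 5) _ λ z₂< → counts-loop (# 5) _ λ z₃< → counts-attempt q< z₁< z₂< z₃<

  -- The digits of `z₁` are places that separate the stops, those of `z₂` send the hash of the
  -- `i`-th stop to `i`, those of `z₃` mark the ends of the blocks. Hash values stay below
  -- `L = 2 ^ r`, and since `r ≤ L` the places and marks fit as well.
  plan-wins : (P : Plan) → length (layers (Plan.blocks P)) ≤ r →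
    ∃[ q ] q < suc r × ∃[ z₁ ] z₁ < Z × ∃[ z₂ ] z₂ < Z × ∃[ z₃ ] z₃ < Z × Win q z₁ z₂ z₃
  plan-wins P q≤r =
    let Pos , Pos≤l , inj = separatingPositions l (map toℕ xs)
          (Uniqueₚ.map⁺ toℕ-injective unique)
          (Allₚ.map⁺ (All.tabulate λ {v} _ → <-≤-trans (toℕ<n v) n≤2^l))
        z₁ , z₁< , dig₁ = encodeDigits b L Pos λ t → ≤-trans (Pos≤l t) (s≤s (m≤n⇒m≤1+n (m≤m+n l r)))
        h   = λ v → hash (digit b z₁) r (toℕ v)
        h≡  : ∀ v → h v ≡ hash Pos r (toℕ v)
        h≡  = λ v → hash-cong r (toℕ v) (λ t<r → dig₁ (<-≤-trans t<r r≤L))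
        z₂ , z₂< , dig₂ = encodeDigits b L (position h xs) λ t →
          s≤s (≤-trans (position≤ h xs t) (≤-trans q≤r (≤-trans (m≤n+m r l) (n≤1+n (l + r)))))
        z₃ , z₃< , dig₃ = encodeDigits b L (flags blocks) λ t → s≤s (≤-trans (flags≤1 blocks t) (s≤s z≤n))
        h-inj : InjectiveOn h xs
        h-inj = λ {v} {w} v∈ w∈ eq → toℕ-injective
          -- One place per stop already separates the stops; the program always reads `r` places.
          (hash-mono {Pos} {xs = map toℕ xs}
            (≤⇒≤′ (subst (_≤ r) (sym (length-map toℕ xs)) q≤r)) inj
            (∈-map⁺ toℕ v∈) (∈-map⁺ toℕ w∈) (trans (sym (h≡ v)) (trans eq (h≡ w))))
    in length xs , s≤s q≤r , z₁ , below z₁< , z₂ , below z₂< , z₃ , below z₃< , λ R →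
       plan⇒accepted P refl
         (position-ranked xs 0 unique h-inj λ {v} _ →
            dig₂ (subst (h v <_) (sym L≡) (hash< (digit b z₁) r (toℕ v))))
         (flags-closing blocks λ i< → dig₃ (<-≤-trans i< (≤-trans q≤r r≤L))) R
    where
    open Plan P
    xs = layers blocks
    r≤L : r ≤ L
    r≤L = subst (r ≤_) (sym L≡) (<⇒≤ (n<2^n r))
    below : ∀ {z} → z < b ^ L → z < Z
    below {z} = subst (z <_) (sym Z≡)

  Solvable : Set
  Solvable = Σ[ R ∈ Routing I ] Routing.totalWeight R ≤ r

  verdict-sound : ⟦ searchAllᶜ ⟧ᶜ ρ none (⟦ prepareᶜ ⟧ᶜ ρ none μ₀) 13 0 ≢ 0 → Solvable
  verdict-sound ≢0 with Counts.sound counts-all prepared ≢0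
  ... | inj₁ ≢0′ = ⊥-elim (≢0′ (cong (λ f → f 0) (kept none μ₀ 13 prepareᶜ)))
  ... | inj₂ P   = plan⇒routing P

  verdict-complete : Solvable → ⟦ searchAllᶜ ⟧ᶜ ρ none (⟦ prepareᶜ ⟧ᶜ ρ none μ₀) 13 0 ≢ 0
  verdict-complete (R , le) =
    let P , short = routing⇒plan R le
    in Counts.wins counts-all prepared (plan-wins P short)

  verdict-value : ∀ {s m} → (m ≢ 0 → Solvable) → (Solvable → m ≢ 0) →
                  reg s 0 ≡ branch m 1 0 → Answers s Solvable
  verdict-value {m = zero}  snd cpl eq = inj₂ (eq , λ R → cpl R refl)
  verdict-value {m = suc m} snd cpl eq = inj₁ (eq , snd (λ ()))

  decide-runs : ∀ {s} → Scope ρ none none 20 s → arr s ≡ arr (encode I r) →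
                Runs s decide (costᶜ mainᶜ ρ + (cost verdictᵉ ρ + 1)) (λ s′ → Answers s′ Solvable)
  decide-runs {s} sc mem =
    runs-seq (compileᶜ-correct mainᶜ sc) λ {s₁} (executed k m) →
    runs-weaken ≤-refl
      (λ {s₂} (sc₂ , _) → verdict-value {s₂} verdict-sound verdict-complete
        (trans (Scope.globals sc₂ {0} (s≤s z≤n))
          (cong (λ μ → branch (μ 13 0) 1 0) (trans m (cong (⟦ mainᶜ ⟧ᶜ ρ none) mem)))))
      (runs-put 0 verdictᵉ (scope-keeps ≤-refl k sc) (s≤s z≤n))

-- Straight-line initialisation of the global registers

assigns : List (ℕ × Exp 0) → Program
assigns []             = skip
assigns ((x , e) ∷ ps) = assign x e ⨾ assigns ps

regsAfter : Regs → Mem → List (ℕ × Exp 0) → Regs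
regsAfter ρ μ []             = ρ
regsAfter ρ μ ((x , e) ∷ ps) = regsAfter (ρ [ x ↦ ⟦ e ⟧ ρ μ none ]) μ ps

costs : Regs → Mem → List (ℕ × Exp 0) → ℕ
costs ρ μ []             = 1
costs ρ μ ((x , e) ∷ ps) = (cost e ρ + 1) + costs (ρ [ x ↦ ⟦ e ⟧ ρ μ none ]) μ ps

runs-assigns : ∀ {ρ s} ps → All (λ p → proj₁ p < 20) ps → Scope ρ none none 20 s →
               Runs s (assigns ps) (costs ρ (arr s) ps) λ s′ →
                 Scope (regsAfter ρ (arr s) ps) none none 20 s′ × arr s′ ≡ arr s
runs-assigns [] [] sc = 1 , _ , skip , ≤-refl , sc , refl
runs-assigns {ρ} {s} ((x , e) ∷ ps) (x<20 ∷ all<20) sc =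
  runs-seq (runs-put x e sc x<20) λ {s₁} (sc₁ , mem) →
  runs-weaken
    (≤-reflexive (cong (λ μ → costs (ρ [ x ↦ ⟦ e ⟧ ρ (arr s) none ]) μ ps) mem))
    (λ {s₂} (sc₂ , mem₂) →
      subst (λ μ → Scope (regsAfter (ρ [ x ↦ ⟦ e ⟧ ρ (arr s) none ]) μ ps) none none 20 s₂) mem sc₂ ,
      trans mem₂ mem)
    (runs-assigns ps all<20 sc₁)

-- The loops of an assignment are bounded by registers that earlier ones have set, so bounding the
-- costs takes bounds for the intermediate values.
data Below (B : ℕ) : Regs → Mem → List (ℕ × Exp 0) → Set where
  []  : ∀ {ρ μ} → Below B ρ μ []
  _∷_ : ∀ {ρ μ x e ps} → ⟦ e ⟧ ρ μ none ≤ B → Below B (ρ [ x ↦ ⟦ e ⟧ ρ μ none ]) μ ps →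
        Below B ρ μ ((x , e) ∷ ps)

unitCosts degrees : List (ℕ × Exp 0) → ℕ
unitCosts []             = 1
unitCosts ((x , e) ∷ ps) = (unitCost e + 1) + unitCosts ps
degrees []             = 0
degrees ((x , e) ∷ ps) = (degree e + 0) + degrees ps

update-≤ : ∀ {B} ρ x {v} → v ≤ B → (∀ y → bound ρ y ≤ B) → ∀ y → bound (ρ [ x ↦ v ]) y ≤ B
update-≤ ρ x v≤B bd y with 4 + toℕ y ≡ᵇ x
... | true  = v≤B
... | false = bd y

costs-bound : ∀ {B ρ μ} ps → 1 ≤ B → (∀ x → bound ρ x ≤ B) → Below B ρ μ ps →
              Poly B (costs ρ μ ps) (unitCosts ps) (degrees ps)
costs-bound [] 1≤B bd [] = lit-bound 1
costs-bound {ρ = ρ} ((x , e) ∷ ps) 1≤B bd (v≤B ∷ below) =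
  sum-bound 1≤B (sum-bound 1≤B (cost-bound e 1≤B bd) (lit-bound 1))
    (costs-bound ps 1≤B (update-≤ ρ x v≤B bd) below)

-- Powers and the binary logarithm as loops

iter-double : ∀ m → iter m 1 (λ _ acc → acc + acc) ≡ 2 ^ m
iter-double zero    = refl
iter-double (suc m) rewrite iter-double m = cong (2 ^ m +_) (sym (+-identityʳ (2 ^ m)))

iter-^ : ∀ x m → iter m 1 (λ _ acc → iter x 0 (λ _ a → a + acc)) ≡ x ^ m
iter-^ x zero    = refl
iter-^ x (suc m) = trans (iter-+ x (iter m 1 (λ _ acc → iter x 0 (λ _ a → a + acc))))
  (cong (x *_) (iter-^ x m))

-- The exponent is a variable and cannot bound a loop, so `n` rounds are made, of which only the
-- first ones double; `logᵉ` needs no exponent above `n`.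
pow₂ᵉ : Exp 2
pow₂ᵉ = rec (# 0) (lit 1) (ifn (var (# 1) <ᵉ var (# 2)) (var (# 0) ⊞ var (# 0)) (var (# 0)))

logᵉ : Exp 0
logᵉ = rec (# 0) (lit 0) (ifn (pow₂ᵉ <ᵉ glob (# 0)) (lit 1 ⊞ var (# 0)) (var (# 0)))

pow₂ : ℕ → ℕ → ℕ
pow₂ n a = iter n 1 λ i acc → branch (a ∸ i) (acc + acc) acc

log : ℕ → ℕ → ℕ
log n m = iter m 0 λ _ a → branch (n ∸ pow₂ n a) (1 + a) a

pow₂-≡ : ∀ n a → a ≤ n → pow₂ n a ≡ 2 ^ a
pow₂-≡ n a a≤n = trans (iter-guarded {a} {1} {λ _ acc → acc + acc} n a≤n) (iter-double a)

-- The exponent is raised only while its power is below `n`, so the power stays within `2 * n`,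
-- which later keeps `2 ^ l` linear in `n`. If it is raised in all `n` rounds, `n < 2 ^ n` settles
-- the lower bound.
log-invariant : ∀ n m → 1 ≤ n → m ≤ n →
                log n m ≤ m × 2 ^ log n m ≤ 2 * n × (log n m ≡ m ⊎ n ≤ 2 ^ log n m)
log-invariant n zero    1≤n _   = z≤n , ≤-trans 1≤n (m≤m+n n _) , inj₁ refl
log-invariant n (suc m) 1≤n m<n with log-invariant n m 1≤n (<⇒≤ m<n)
... | a≤m , ≤2n , alt
  with n ∸ pow₂ n (log n m) | reflects-< (pow₂ n (log n m)) n
     | pow₂-≡ n (log n m) (≤-trans a≤m (<⇒≤ m<n))
... | _ | holds p<n | eq = s≤s a≤m , *-monoʳ-≤ 2 (<⇒≤ (subst (_< n) eq p<n)) , next alt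
  where
  next : log n m ≡ m ⊎ n ≤ 2 ^ log n m → suc (log n m) ≡ suc m ⊎ n ≤ 2 ^ suc (log n m)
  next (inj₁ eq′) = inj₁ (cong suc eq′)
  next (inj₂ n≤)  = inj₂ (≤-trans n≤ (m≤m+n _ _))
... | _ | fails p≮n | eq =
  m≤n⇒m≤1+n a≤m , ≤2n , inj₂ (subst (n ≤_) eq (≮⇒≥ p≮n))

-- Each loop is bounded by a register set before it: register 9, for instance, starts from 1 and is
-- multiplied by `b` from register 8 as often as register 7 says. Register 14 dominates everything
-- that bounds a loop or is divided; `l` and `suc r` are covered by `b`.
setup : List (ℕ × Exp 0)
setup =
  (4  , glob (# 0)) ∷
  (5  , glob (# 3)) ∷
  (6  , logᵉ) ∷
  (7  , rec (# 1) (lit 1) (var (# 0) ⊞ var (# 0))) ∷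
  (8  , lit 2 ⊞ (glob (# 6) ⊞ glob (# 5))) ∷
  (9  , rec (# 3) (lit 1) (mulᵉ (# 4) (var (# 0)))) ∷
  (10 , lit 2) ∷
  (11 , mulᵉ (# 0) (glob (# 4))) ∷
  (12 , lit 1) ∷
  (13 , lit 1 ⊞ glob (# 5)) ∷
  (14 , glob (# 4) ⊞ (glob (# 5) ⊞ (glob (# 7) ⊞ (glob (# 8) ⊞ (glob (# 9) ⊞ (glob (# 11) ⊞ lit 2)))))) ∷
  []

algorithm : Program
algorithm = assigns setup ⨾ decide

programFactor programDegree : List (ℕ × Exp 0) → Cmd 0 → Exp 0 → ℕ
programFactor ps c e = unitCosts ps + (unitCostᶜ c + (unitCost e + 1))
programDegree ps c e = degrees ps + (degreeᶜ c + (degree e + 0))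

program-bound : ∀ ρ ρ′ μ {B} ps c e → 1 ≤ B → (∀ x → bound ρ x ≤ B) → Below B ρ μ ps →
                (∀ x → bound ρ′ x ≤ B) →
                Poly B (costs ρ μ ps + (costᶜ c ρ′ + (cost e ρ′ + 1)))
                  (programFactor ps c e) (programDegree ps c e)
program-bound ρ ρ′ μ ps c e 1≤B bd below bd′ = sum-bound 1≤B (costs-bound ps 1≤B bd below)
  (sum-bound 1≤B (costᶜ-bound c 1≤B bd′) (sum-bound 1≤B (cost-bound e 1≤B bd′) (lit-bound 1)))

opaque
  -- Constants of the program text; their values are immaterial, so they are kept from unfolding.
  timeFactor timeDegree : ℕ
  timeFactor = programFactor setup mainᶜ verdictᵉ
  timeDegree = programDegree setup mainᶜ verdictᵉ

  time-bound : ∀ ρ ρ′ μ {B} → 1 ≤ B → (∀ x → bound ρ x ≤ B) → Below B ρ μ setup →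
               (∀ x → bound ρ′ x ≤ B) →
               Poly B (costs ρ μ setup + (costᶜ mainᶜ ρ′ + (cost verdictᵉ ρ′ + 1)))
                 timeFactor timeDegree
  time-bound ρ ρ′ μ = program-bound ρ ρ′ μ setup mainᶜ verdictᵉ

-- With L = 2^r we have (l + r + 2)^L ≤ L^L · 2^(l + r + 2) ≤ 8 · L · L^L · n; the
-- other summands of `top` below account for the remaining 11 of the 19.
scale : ℕ → ℕ
scale r = 19 * (2 ^ r * (2 ^ r) ^ (2 ^ r))

-- Loop bounds and running time on an instance

module Total (I : GasCVRP) (r : ℕ) where
  open GasCVRP I

  1≤n : 1 ≤ n
  1≤n = ≤-trans (s≤s z≤n) (toℕ<n (proj₁ depot))

  l L b Z nn top : ℕ
  l   = log n n
  L   = iter r 1 λ _ acc → acc + acc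
  b   = 2 + (l + r)
  Z   = iter L 1 λ _ acc → iter b 0 λ _ a → a + acc
  nn  = iter n 0 λ _ a → a + n
  top = n + (r + (L + (b + (Z + (nn + 2)))))

  ρ : Regs
  ρ = regs n vehicles gas r l L b Z nn top

  L≡ : L ≡ 2 ^ r
  L≡ = iter-double r
  Z≡ : Z ≡ b ^ L
  Z≡ = iter-^ b L
  nn≡ : nn ≡ n * n
  nn≡ = iter-+ n n

  n≤2^l : n ≤ 2 ^ l
  n≤2^l with log-invariant n n 1≤n ≤-refl
  ... | _ , _ , inj₁ l≡n = ≤-trans (<⇒≤ (n<2^n n)) (≤-reflexive (cong (2 ^_) (sym l≡n)))
  ... | _ , _ , inj₂ n≤  = n≤

  2^l≤2n : 2 ^ l ≤ 2 * n
  2^l≤2n = proj₁ (proj₂ (log-invariant n n 1≤n ≤-refl))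

  n≤top : n ≤ top
  n≤top = m≤m+n n _
  r≤top : r ≤ top
  r≤top = ≤-trans (m≤m+n r _) (m≤n+m _ n)
  L≤top : L ≤ top
  L≤top = ≤-trans (m≤m+n L _) (≤-trans (m≤n+m _ r) (m≤n+m _ n))
  b≤top : b ≤ top
  b≤top = ≤-trans (m≤m+n b _) (≤-trans (m≤n+m _ L) (≤-trans (m≤n+m _ r) (m≤n+m _ n)))
  rest≤top : Z + (nn + 2) ≤ top
  rest≤top = ≤-trans (m≤n+m _ b) (≤-trans (m≤n+m _ L) (≤-trans (m≤n+m _ r) (m≤n+m _ n)))
  Z≤top : Z ≤ top
  Z≤top = ≤-trans (m≤m+n Z _) rest≤top
  nn≤top : nn ≤ top
  nn≤top = ≤-trans (m≤m+n nn 2) (≤-trans (m≤n+m _ Z) rest≤top)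
  2≤top : 2 ≤ top
  2≤top = ≤-trans (m≤n+m 2 nn) (≤-trans (m≤n+m _ Z) rest≤top)
  1+r≤top : suc r ≤ top
  1+r≤top = ≤-trans (s≤s (≤-trans (m≤n+m r l) (n≤1+n (l + r)))) b≤top
  l≤top : l ≤ top
  l≤top = ≤-trans (≤-trans (m≤m+n l r) (m≤n+m (l + r) 2)) b≤top
  1≤top : 1 ≤ top
  1≤top = ≤-trans (s≤s z≤n) 2≤top

  ρ₀ : Regs
  ρ₀ = cells (n ∷ vehicles ∷ gas ∷ r ∷ [])

  below : ∀ {μ} → Below top ρ₀ μ setup
  below = n≤top ∷ r≤top ∷ l≤top ∷ L≤top ∷ b≤top ∷ Z≤top ∷ 2≤top ∷ nn≤top ∷ 1≤top ∷ 1+r≤top ∷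
          ≤-refl ∷ []

  bound₀ : ∀ x → bound ρ₀ x ≤ top
  bound₀ x = z≤n

  agree : ∀ {μ y} → regsAfter ρ₀ μ setup y ≡ ρ y
  agree {y = 0}  = refl
  agree {y = 1}  = refl
  agree {y = 2}  = refl
  agree {y = 3}  = refl
  agree {y = 4}  = refl
  agree {y = 5}  = refl
  agree {y = 6}  = refl
  agree {y = 7}  = refl
  agree {y = 8}  = refl
  agree {y = 9}  = refl
  agree {y = 10} = refl
  agree {y = 11} = refl
  agree {y = 12} = refl
  agree {y = 13} = refl
  agree {y = 14} = refl
  agree {y = suc (suc (suc (suc (suc (suc (suc (suc (suc (suc (suc (suc (suc (suc (suc y))))))))))))))} = refl

  bounded : ∀ x → bound ρ x ≤ top
  bounded x = subst (_≤ top) (agree {λ _ _ → 0} {4 + toℕ x}) (after x)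
    where
    keep : ∀ {ρ μ} ps → (∀ y → bound ρ y ≤ top) → Below top ρ μ ps →
           ∀ y → bound (regsAfter ρ μ ps) y ≤ top
    keep []             bd []            = bd
    keep {ρ} ((x , e) ∷ ps) bd (v≤ ∷ below) = keep ps (update-≤ ρ x v≤ bd) below
    after = keep {μ = λ _ _ → 0} setup bound₀ below

  algorithm-runs : Runs (encode I r) algorithm (timeFactor * top ^ timeDegree)
                     (λ s → Answers s (Σ[ R ∈ Routing I ] Routing.totalWeight R ≤ r))
  algorithm-runs = runs-weaken
    (Poly.evaluate (time-bound ρ₀ ρ (arr (encode I r)) 1≤top bound₀ (below {arr (encode I r)}) bounded)) id
    (runs-seq (runs-assigns setup registers (scope (λ _ → refl) ≤-refl (λ ()) (λ ())))
      λ (scope glb _ _ _ , mem) → Correctness.decide-runs I r l L Z nn top nn≡ L≡ Z≡ n≤2^l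
        n≤top r≤top L≤top b≤top Z≤top nn≤top
        (scope (λ {y} y<20 → trans (glb y<20) (agree {arr (encode I r)} {y})) ≤-refl (λ ()) (λ ())) mem)
    where
    registers : All (λ p → proj₁ p < 20) setup
    registers = m≤m+n 5 _ ∷ m≤m+n 6 _ ∷ m≤m+n 7 _ ∷ m≤m+n 8 _ ∷ m≤m+n 9 _ ∷ m≤m+n 10 _ ∷
      m≤m+n 11 _ ∷ m≤m+n 12 _ ∷ m≤m+n 13 _ ∷ m≤m+n 14 _ ∷ m≤m+n 15 _ ∷ []

+-scaled : ∀ {x y} a b Y → x ≤ a * Y → y ≤ b * Y → x + y ≤ (a + b) * Y
+-scaled a b Y p q = ≤-trans (+-mono-≤ p q) (≤-reflexive (sym (*-distribʳ-+ Y a b)))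

module _ (I : GasCVRP) (r : ℕ) where
  open Total I r
  open GasCVRP I using (n)

  top-bound : top ≤ scale r * (n * n)
  top-bound = ≤-trans
    -- The summands `n`, `r`, `L`, `b`, `Z`, `nn` and 2 have the factors 1, 1, 1, 5, 8, 1 and 2,
    -- which add up to 19.
    (+-scaled 1 18 Y (once n≤Y) (+-scaled 1 17 Y (once r≤Y) (+-scaled 1 16 Y (once L≤Y)
      (+-scaled 5 11 Y b≤Y (+-scaled 8 3 Y Z≤Y (+-scaled 1 2 Y (once nn≤Y) (constant 2)))))))
    (≤-reflexive (sym (*-assoc 19 X (n * n))))
    where
    open ≤-Reasoning
    S X Y : ℕ
    S = 2 ^ r
    X = S * S ^ S
    Y = X * (n * n)
    once : ∀ {x} → x ≤ Y → x ≤ 1 * Y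
    once {x} = subst (x ≤_) (sym (*-identityˡ Y))
    instance
      n≢0 : NonZero n
      n≢0 = >-nonZero 1≤n
      S≢0 : NonZero S
      S≢0 = m^n≢0 2 r
      SS≢0 : NonZero (S ^ S)
      SS≢0 = m^n≢0 S S
      X≢0 : NonZero X
      X≢0 = m*n≢0 S (S ^ S)
      nn≢0 : NonZero (n * n)
      nn≢0 = m*n≢0 n n
      Y≢0 : NonZero Y
      Y≢0 = m*n≢0 X (n * n)
    constant : ∀ m → m ≤ m * Y
    constant m = m≤m*n m Y
    n≤Y : n ≤ Y
    n≤Y = ≤-trans (m≤m*n n n) (m≤n*m (n * n) X)
    S≤Y : S ≤ Y
    S≤Y = ≤-trans (m≤m*n S (S ^ S)) (m≤m*n X (n * n))
    r≤Y : r ≤ Y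
    r≤Y = ≤-trans (<⇒≤ (n<2^n r)) S≤Y
    L≤Y : L ≤ Y
    L≤Y = subst (_≤ Y) (sym L≡) S≤Y
    nn≤Y : nn ≤ Y
    nn≤Y = subst (_≤ Y) (sym nn≡) (m≤n*m (n * n) X)
    l≤Y : l ≤ 2 * Y
    l≤Y = ≤-trans (<⇒≤ (n<2^n l)) (≤-trans 2^l≤2n (*-monoʳ-≤ 2 n≤Y))
    b≤Y : b ≤ 5 * Y
    b≤Y = +-scaled 2 3 Y (constant 2) (+-scaled 2 1 Y l≤Y (once r≤Y))
    Z≤Y : Z ≤ 8 * Y
    Z≤Y = begin
      Z                              ≡⟨ trans Z≡ (cong (b ^_) L≡) ⟩
      b ^ S                          ≤⟨ power-bound b S ⟩
      S ^ S * 2 ^ b                  ≡⟨ cong (S ^ S *_) (^-distribˡ-+-* 2 2 (l + r)) ⟩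
      S ^ S * (4 * 2 ^ (l + r))      ≡⟨ cong (λ p → S ^ S * (4 * p)) (^-distribˡ-+-* 2 l r) ⟩
      S ^ S * (4 * (2 ^ l * S))      ≤⟨ *-monoʳ-≤ (S ^ S) (*-monoʳ-≤ 4 (*-monoˡ-≤ S 2^l≤2n)) ⟩
      S ^ S * (4 * (2 * n * S))      ≡⟨ rearrange (S ^ S) n S ⟩
      8 * (S * S ^ S * n)            ≤⟨ *-monoʳ-≤ 8 (*-monoʳ-≤ X (m≤m*n n n)) ⟩
      8 * Y                          ∎
      where
      rearrange : ∀ p n s → p * (4 * (2 * n * s)) ≡ 8 * (s * p * n)
      rearrange = solve-∀

-- Computability of the time bound

computeTime : List (ℕ × Exp 0)
computeTime =
  -- Registers 5 to 8 receive `2 ^ r`, its power with itself as exponent, their product and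
  -- `scale r`. Loops need a register as bound, so the degree and the factor are loaded into
  -- registers 9 and 11.
  (4  , glob (# 0)) ∷
  (5  , rec (# 0) (lit 1) (var (# 0) ⊞ var (# 0))) ∷
  (6  , rec (# 1) (lit 1) (mulᵉ (# 1) (var (# 0)))) ∷
  (7  , mulᵉ (# 1) (glob (# 6))) ∷
  (8  , mulᵉ (# 3) (lit 19)) ∷
  (9  , lit timeDegree) ∷
  (10 , rec (# 5) (lit 1) (mulᵉ (# 4) (var (# 0)))) ∷
  (11 , lit timeFactor) ∷
  (0  , mulᵉ (# 7) (glob (# 10))) ∷
  []

timeInR : ℕ → ℕ
timeInR r = timeFactor * scale r ^ timeDegree

assigns-computable : ∀ {f} ps → All (λ p → proj₁ p < 20) ps →
  (∀ m → regsAfter (cells (m ∷ [])) (λ _ → zeros) ps 0 ≡ f m) → Computable f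
assigns-computable {f} ps ps<20 value = assigns ps , halts
  where
  halts : ∀ m → ∃[ t ] ∃[ s ]
          ⟨ assigns ps , ⟪ cells (m ∷ []) , (λ _ → zeros) ⟫ ⟩⇓[ t ] s × output s ≡ f m
  halts m with runs-assigns {s = ⟪ cells (m ∷ []) , (λ _ → zeros) ⟫} ps ps<20
                 (scope (λ _ → refl) ≤-refl (λ ()) (λ ()))
  ... | t , s , ex , _ , sc , _ = t , s , ex , trans (Scope.globals sc {0} (s≤s z≤n)) (value m)

timeInR-computable : Computable timeInR
timeInR-computable = assigns-computable computeTime
  (m≤m+n 5 _ ∷ m≤m+n 6 _ ∷ m≤m+n 7 _ ∷ m≤m+n 8 _ ∷ m≤m+n 9 _ ∷ m≤m+n 10 _ ∷
   m≤m+n 11 _ ∷ m≤m+n 12 _ ∷ m≤m+n 1 _ ∷ []) value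
  where
  L : ℕ → ℕ
  L m = iter m 1 λ _ acc → acc + acc
  LL X S : ℕ → ℕ
  LL m = iter (L m) 1 λ _ acc → iter (L m) 0 λ _ a → a + acc
  X m  = iter (L m) 0 λ _ a → a + LL m
  S m  = iter (X m) 0 λ _ a → a + 19
  S≡ : ∀ m → S m ≡ scale m
  S≡ m = trans (iter-+ (X m) 19) (trans (*-comm (X m) 19) (cong (19 *_)
    (trans (iter-+ (L m) (LL m)) (cong₂ _*_ (iter-double m)
      (trans (iter-^ (L m) (L m)) (cong (λ x → x ^ x) (iter-double m)))))))
  value : ∀ m → (iter timeFactor 0 λ _ a → a + iter timeDegree 1 λ _ acc → iter (S m) 0 λ _ a → a + acc)
                ≡ timeInR m
  value m = trans (iter-+ timeFactor (iter timeDegree 1 λ _ acc → iter (S m) 0 λ _ a → a + acc))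
    (cong (timeFactor *_) (trans (iter-^ (S m) timeDegree) (cong (_^ timeDegree) (S≡ m))))

time≤ : ∀ n r {top} → top ≤ scale r * (n * n) →
        timeFactor * top ^ timeDegree ≤ timeInR r * n ^ (2 * timeDegree)
time≤ n r {top} le = begin
  timeFactor * top ^ timeDegree
    ≤⟨ *-monoʳ-≤ timeFactor (^-monoˡ-≤ timeDegree le) ⟩
  timeFactor * (scale r * (n * n)) ^ timeDegree
    ≡⟨ cong (timeFactor *_) (^-distribʳ-* (scale r) (n * n) timeDegree) ⟩
  timeFactor * (scale r ^ timeDegree * (n * n) ^ timeDegree)
    ≡⟨ *-assoc timeFactor _ _ ⟨
  timeInR r * (n * n) ^ timeDegree
    ≡⟨ cong (λ m → timeInR r * (n * m) ^ timeDegree) (sym (*-identityʳ n)) ⟩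
  timeInR r * (n ^ 2) ^ timeDegree
    ≡⟨ cong (timeInR r *_) (^-*-assoc n 2 timeDegree) ⟩
  timeInR r * n ^ (2 * timeDegree) ∎
  where open ≤-Reasoning

corollary4p2 : ∃[ P ] Σ[ f ∈ (ℕ → ℕ) ] ∃[ e ]
    Computable f ×
    ((I : GasCVRP) (r : ℕ) → ∃[ t ] ∃[ s ]
    ⟨ P , encode I r ⟩⇓[ t ] s ×
    t ≤ f r * GasCVRP.n I ^ e ×
    Answers s (Σ[ R ∈ Routing I ] Routing.totalWeight R ≤ r))
corollary4p2 = algorithm , timeInR , 2 * timeDegree , timeInR-computable , λ I r →
  let t , s , ex , t≤ , ans = Total.algorithm-runs I r
  in t , s , ex , ≤-trans t≤ (time≤ (GasCVRP.n I) r (top-bound I r)) , ans
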